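{- Let $q\in\{2,3\}$ and let $G$ be a finite product of finite $q$-groups. Then for every $\varepsilon>0$, every $n$ and every function $f:\{0,1\}^n\to G$, $|\mathsf{List}^f_\varepsilon|\le\mathrm{poly}(1/\varepsilon)$.
   Context: A $q$-group is a (finite Abelian) group in which every element has order a power of $q$. $\mathcal{P}_1(\{0,1\}^n,G)$ is the set of functions $P(x)=a_0+\sum_{i=1}^n a_ix_i$, $a_i\in G$, $x\in\{0,1\}^n$. $\delta(f,P)=\Pr_{x\sim\{0,1\}^n}[f(x)\ne P(x)]$ and $\mathsf{List}^f_\varepsilon=\{P\in\mathcal{P}_1(\{0,1\}^n,G):\delta(f,P)\le 1/2-\varepsilon\}$. The polynomial bound is independent of $n$, $f$ and $G$. -}

module Defs where

open import Data.Bool using (Bool; true; false)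
open import Data.Nat as ℕ using (ℕ; zero; suc; _<_; _^_)
open import Data.Nat.Properties using (m^n≢0)
open import Data.Fin using (Fin)
open import Data.Integer using (+_)
open import Data.Rational as ℚ using (ℚ; _/_; ½; 1ℚ; _≤_)
open import Data.Rational.Properties using (_≤?_)
open import Data.Vec using (Vec; []; _∷_)
open import Data.List using (List; []; _∷_; length; filter; concatMap; map)
open import Data.Product using (∃; _×_)
open import Relation.Binary.PropositionalEquality using (_≡_; _≢_)
open import Relation.Nullary using (Dec; yes; no; ¬?)
open import Algebra.Structures using (IsAbelianGroup)

-- A finite abelian group, presented (up to isomorphism) on the carrier Fin m,
-- with propositional equality.
record FinAbGroup : Set where
  field
    m    : ℕ
    _+_  : Fin m → Fin m → Fin m
    0g   : Fin m
    neg  : Fin m → Fin m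
    isAbelianGroup : IsAbelianGroup _≡_ _+_ 0g neg
    _≟_  : (a b : Fin m) → Dec (a ≡ b)
  Carrier : Set
  Carrier = Fin m

open FinAbGroup public

mulN : (G : FinAbGroup) → ℕ → Carrier G → Carrier G
mulN G zero    g = 0g G
mulN G (suc k) g = _+_ G g (mulN G k g)

HasOrder : (G : FinAbGroup) → Carrier G → ℕ → Set
HasOrder G g k = (0 < k) × (mulN G k g ≡ 0g G) × (∀ k′ → 0 < k′ → k′ < k → mulN G k′ g ≢ 0g G)

IsQGroup : ℕ → FinAbGroup → Set
IsQGroup q G = ∀ (g : Carrier G) → ∃ λ j → HasOrder G g (q ^ j)

allVecs : ∀ {A : Set} → List A → (n : ℕ) → List (Vec A n)
allVecs xs zero    = [] ∷ []
allVecs xs (suc n) = concatMap (λ x → map (x ∷_) (allVecs xs n)) xs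

allFinList : (m : ℕ) → List (Fin m)
allFinList m = Data.List.allFin m

cube : (n : ℕ) → List (Vec Bool n)
cube n = allVecs (false ∷ true ∷ []) n

evalLin : (G : FinAbGroup) {n : ℕ} → Carrier G → Vec (Carrier G) n → Vec Bool n → Carrier G
evalLin G a₀ []       []          = a₀
evalLin G a₀ (a ∷ as) (true ∷ x)  = _+_ G a (evalLin G a₀ as x)
evalLin G a₀ (a ∷ as) (false ∷ x) = evalLin G a₀ as x

-- P ∈ 𝒫₁({0,1}ⁿ, G) given by coefficients (a₀ , a₁ … aₙ)
Lin : FinAbGroup → ℕ → Set
Lin G n = Carrier G × Vec (Carrier G) n

open import Data.Product using (_,_; proj₁; proj₂)

allLin : (G : FinAbGroup) (n : ℕ) → List (Lin G n)
allLin G n = concatMap (λ a₀ → map (a₀ ,_) (allVecs (allFinList (m G)) n)) (allFinList (m G))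

evalP : (G : FinAbGroup) {n : ℕ} → Lin G n → Vec Bool n → Carrier G
evalP G (a₀ , as) = evalLin G a₀ as

δ : (G : FinAbGroup) (n : ℕ) → (Vec Bool n → Carrier G) → Lin G n → ℚ
δ G n f P = _/_ (+ length (filter (λ x → ¬? (_≟_ G (f x) (evalP G P x))) (cube n))) (2 ^ n) {{m^n≢0 2 n}}

listSize : (G : FinAbGroup) (n : ℕ) → (Vec Bool n → Carrier G) → ℚ → ℕ
listSize G n f ε = length (filter (λ P → δ G n f P ≤? (½ ℚ.- ε)) (allLin G n))

_^ℚ_ : ℚ → ℕ → ℚ
p ^ℚ zero  = 1ℚ
p ^ℚ suc k = p ℚ.* (p ^ℚ k)

{-# OPTIONS --safe #-}
module Submission where

-- Write W = 2ⁿ and call 2|A| - W the advantage of a set A ⊆ {0,1}ⁿ.  Descend from G to 0 through subgroups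
-- S⁺ ⊃ S with S⁺/S ≅ ℤ/q.  For a large absolute constant C, the sum of (advantage of the agreement modulo S)^C
-- over linear functions pairwise incongruent modulo S never exceeds W^C.  Passing from S⁺ to S, the classes
-- modulo S inside one class modulo S⁺ are distinct linear functions to ℤ/q agreeing with one partial function,
-- so everything reduces to the inequality Σ aⱼ^C ≤ b^C, where aⱼ are the advantages of distinct ℤ/q-linear
-- functions with respect to a partial function F and b is the advantage of the domain of F.
--
-- Two distinct linear functions collide with probability at most 1/2, so aᵢ + aⱼ ≤ b; together with a tail
-- bound #{j : aⱼ ≥ t} ≤ M (b/t)⁸ this gives the inequality.  If b ≤ W/6, three functions with positive
-- advantage agree simultaneously on more than a third of the cube, which allows at most three of them.
-- If b > W/6 it suffices to show #{j : aⱼ ≥ t} ≤ M′ (W/t)⁸.  For q = 2 this is the second moment method.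
-- For q = 3, linear functions at Hamming distance ≥ 5 collide with probability at most 17/48, whence at most 48
-- pairwise far ones; those within distance 4 of a centre are sparse after a shift, and are counted by induction
-- on the sparsity, using that functions with disjoint supports are independent.

-- The chain of subgroups may be arbitrarily long, so a step losing even a constant factor would be
-- useless: Σ aⱼ^C ≤ b^C must hold with constant exactly 1. This is why functions are weighed by a
-- power of their advantage instead of being counted. A large C absorbs the constant of the tail
-- bound when all terms are at most b/2, and aᵢ + aⱼ ≤ b controls the one term that can be larger.
-- The tail bound must be relative to b because the domain may cover barely more than half of the
-- cube; a bound in terms of W then says nothing, which forces the separate treatment of small b.
-- For q = 3 a direct second moment argument breaks down: distinct functions may collide with
-- probability 1/2, while agreement 1/2 with one value forces a collision rate of only 1/4 + 1/16 +
-- 1/16 = 3/8. Far pairs have to stay strictly below 3/8. At distance 4 the estimate gives exactly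
-- 3/8, so 5 is the first distance that works.

module ListDecoding where

  open import Defs renaming (_+_ to add; _≟_ to deq; m to order)
  open import Algebra.Bundles using (AbelianGroup; CommutativeMonoid)
  import Algebra.Properties.AbelianGroup as AbelianGroupₚ
  open import Data.Bool using (Bool; true; false)
  open import Data.Empty using (⊥-elim)
  open import Data.Fin using (Fin; zero; suc; toℕ)
  import Data.Fin.Properties as Finₚ
  open import Data.List as List using (List; []; _∷_; length; filter; map; _++_; concatMap)
  import Data.List.Properties as Listₚ
  open import Data.List.Membership.Propositional using (_∈_)
  open import Data.List.Membership.Propositional.Properties using (∈-filter⁻; ∈-map⁻; ∈-allFin)
  open import Data.List.Relation.Unary.All as All using (All; []; _∷_)
  open import Data.List.Relation.Unary.AllPairs as AllPairs using (AllPairs; []; _∷_)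
  import Data.List.Relation.Unary.AllPairs.Properties as AllPairsₚ
  open import Data.List.Relation.Unary.Any as Any using (Any; here; there)
  import Data.List.Relation.Unary.Any.Properties as Anyₚ
  open import Data.List.Relation.Unary.Unique.Propositional using (Unique)
  import Data.List.Relation.Unary.Unique.Propositional.Properties as Uniqueₚ
  open import Data.Maybe using (Maybe; just; nothing)
  open import Data.Nat hiding (_≟_)
  open import Data.Nat.Properties hiding (_≟_)
  open import Data.Nat.Tactic.RingSolver using (solve-∀)
  open import Data.Product using (∃; _×_; _,_; proj₁; proj₂)
  import Data.Product.Properties
  open import Data.Sum using (_⊎_; inj₁; inj₂)
  open import Data.Unit using (⊤; tt)
  open import Data.Vec as Vec using (Vec; []; _∷_; replicate; zipWith)
  import Data.Vec.Properties as Vecₚ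
  open import Data.Vec.Relation.Unary.All as VAll using ([]; _∷_) renaming (All to VAll)
  open import Function using (_∘_)
  open import Level using (0ℓ)
  open import Relation.Binary.PropositionalEquality
  open import Relation.Nullary using (¬_; Dec; yes; no; contradiction; ¬?)
  open import Relation.Nullary.Decidable using (from-yes; _×-dec_)
  open import Relation.Unary using (Decidable)

  private variable
    A B : Set

  -- Finite sums, indicators and Cauchy-Schwarz

  ∑ : List A → (A → ℕ) → ℕ
  ∑ []       f = 0
  ∑ (x ∷ xs) f = f x + ∑ xs f

  ∑-mono-∈ : ∀ (l : List A) {f g} → (∀ {x} → x ∈ l → f x ≤ g x) → ∑ l f ≤ ∑ l g
  ∑-mono-∈ []      h = z≤n
  ∑-mono-∈ (x ∷ l) h = +-mono-≤ (h (here refl)) (∑-mono-∈ l (λ p → h (there p)))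

  ∑-mono : ∀ (l : List A) {f g} → (∀ x → f x ≤ g x) → ∑ l f ≤ ∑ l g
  ∑-mono l h = ∑-mono-∈ l (λ {x} _ → h x)

  ∑-cong : ∀ (l : List A) {f g} → (∀ x → f x ≡ g x) → ∑ l f ≡ ∑ l g
  ∑-cong []      h = refl
  ∑-cong (x ∷ l) h = cong₂ _+_ (h x) (∑-cong l h)

  +-interchange : ∀ a b c d → (a + b) + (c + d) ≡ (a + c) + (b + d)
  +-interchange = solve-∀

  ∑-+ : ∀ (l : List A) f g → ∑ l (λ x → f x + g x) ≡ ∑ l f + ∑ l g
  ∑-+ []      f g = refl
  ∑-+ (x ∷ l) f g = trans (cong (f x + g x +_) (∑-+ l f g)) (+-interchange (f x) (g x) _ _)

  ∑-*ˡ : ∀ (l : List A) c f → ∑ l (λ x → c * f x) ≡ c * ∑ l f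
  ∑-*ˡ []      c f = sym (*-zeroʳ c)
  ∑-*ˡ (x ∷ l) c f = trans (cong (c * f x +_) (∑-*ˡ l c f)) (sym (*-distribˡ-+ c (f x) _))

  ∑-*ʳ : ∀ (l : List A) f c → ∑ l (λ x → f x * c) ≡ ∑ l f * c
  ∑-*ʳ []      f c = refl
  ∑-*ʳ (x ∷ l) f c = trans (cong (f x * c +_) (∑-*ʳ l f c)) (sym (*-distribʳ-+ c (f x) _))

  ∑-const : ∀ (l : List A) c → ∑ l (λ _ → c) ≡ length l * c
  ∑-const []      c = refl
  ∑-const (x ∷ l) c = cong (c +_) (∑-const l c)

  ∑-swap : ∀ (k : List A) (l : List B) (f : A → B → ℕ) →
           ∑ k (λ x → ∑ l (f x)) ≡ ∑ l (λ y → ∑ k (λ x → f x y))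
  ∑-swap []      l f = sym (trans (∑-const l 0) (*-zeroʳ (length l)))
  ∑-swap (x ∷ k) l f = trans (cong (∑ l (f x) +_) (∑-swap k l f)) (sym (∑-+ l (f x) _))

  ∑-++ : ∀ (k l : List A) f → ∑ (k ++ l) f ≡ ∑ k f + ∑ l f
  ∑-++ []      l f = refl
  ∑-++ (x ∷ k) l f = trans (cong (f x +_) (∑-++ k l f)) (sym (+-assoc (f x) _ _))

  ∑-map : ∀ (h : A → B) l f → ∑ (map h l) f ≡ ∑ l (λ x → f (h x))
  ∑-map h []      f = refl
  ∑-map h (x ∷ l) f = cong (f (h x) +_) (∑-map h l f)

  ⟦_⟧ : {P : Set} → Dec P → ℕ
  ⟦ yes _ ⟧ = 1
  ⟦ no  _ ⟧ = 0

  ⟦⟧≤1 : {P : Set} (d : Dec P) → ⟦ d ⟧ ≤ 1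
  ⟦⟧≤1 (yes _) = ≤-refl
  ⟦⟧≤1 (no  _) = z≤n

  ⟦⟧-mono : {P Q : Set} (d : Dec P) (e : Dec Q) → (P → Q) → ⟦ d ⟧ ≤ ⟦ e ⟧
  ⟦⟧-mono (no  _) e       h = z≤n
  ⟦⟧-mono (yes p) (yes _) h = ≤-refl
  ⟦⟧-mono (yes p) (no ¬q) h = contradiction (h p) ¬q

  ∑-filter : {P : A → Set} (P? : Decidable P) (l : List A) (f : A → ℕ) →
             ∑ (filter P? l) f ≡ ∑ l (λ x → ⟦ P? x ⟧ * f x)
  ∑-filter P? [] f = refl
  ∑-filter P? (x ∷ l) f with P? x
  ... | yes _ = cong₂ _+_ (sym (+-identityʳ (f x))) (∑-filter P? l f)
  ... | no  _ = ∑-filter P? l f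

  length-as-∑ : (l : List A) → length l ≡ ∑ l (λ _ → 1)
  length-as-∑ l = sym (trans (∑-const l 1) (*-identityʳ _))

  length-filter : {P : A → Set} (P? : Decidable P) (l : List A) →
                  length (filter P? l) ≡ ∑ l (λ x → ⟦ P? x ⟧)
  length-filter P? l = trans (length-as-∑ (filter P? l))
    (trans (∑-filter P? l (λ _ → 1)) (∑-cong l (λ x → *-identityʳ ⟦ P? x ⟧)))

  ∑-filter-split : {P : A → Set} (P? : Decidable P) (l : List A) (f : A → ℕ) →
                   ∑ l f ≡ ∑ (filter P? l) f + ∑ (filter (λ x → ¬? (P? x)) l) f
  ∑-filter-split P? [] f = refl
  ∑-filter-split P? (x ∷ l) f with P? x
  ... | yes _ = trans (cong (f x +_) (∑-filter-split P? l f)) (sym (+-assoc (f x) _ _))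
  ... | no  _ = trans (cong (f x +_) (∑-filter-split P? l f)) (lem (f x) (∑ (filter P? l) f) _)
    where lem : ∀ a b c → a + (b + c) ≡ b + (a + c)
          lem = solve-∀

  2ab≤a²+b² : ∀ a b → 2 * (a * b) ≤ a * a + b * b
  2ab≤a²+b² a b with ≤-total a b
  ... | inj₁ a≤b with m≤n⇒∃[o]m+o≡n a≤b
  ...   | k , refl = ≤-trans (m≤m+n _ (k * k)) (≤-reflexive (lem a k))
    where lem : ∀ a k → 2 * (a * (a + k)) + k * k ≡ a * a + (a + k) * (a + k)
          lem = solve-∀
  2ab≤a²+b² a b | inj₂ b≤a with m≤n⇒∃[o]m+o≡n b≤a
  ...   | k , refl = ≤-trans (m≤m+n _ (k * k)) (≤-reflexive (lem b k))
    where lem : ∀ b k → 2 * ((b + k) * b) + k * k ≡ (b + k) * (b + k) + b * b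
          lem = solve-∀

  -- Summing 2ab ≤ a² + b² with a = m · f x and b = T, the total, gives 2mT² ≤ m²Q + mT². Then mT²
  -- and a factor m cancel, so no subtraction is involved.
  cauchy-schwarz : ∀ (l : List A) f → ∑ l f * ∑ l f ≤ length l * ∑ l (λ x → f x * f x)
  cauchy-schwarz [] f = z≤n
  cauchy-schwarz l@(_ ∷ _) f = *-cancelˡ-≤ (length l) (+-cancelˡ-≤ (m * (T * T)) _ _ chain)
    where
    m = length l
    T = ∑ l f
    Q = ∑ l (λ x → f x * f x)
    open ≤-Reasoning
    lem₁ : ∀ m T → m * (T * T) + m * (T * T) ≡ 2 * m * T * T
    lem₁ = solve-∀
    lem₂ : ∀ m T y → 2 * m * T * y ≡ 2 * ((m * y) * T)
    lem₂ = solve-∀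
    lem₃ : ∀ m y T → (m * y) * (m * y) + T * T ≡ m * m * (y * y) + T * T
    lem₃ = solve-∀
    lem₄ : ∀ m Q T → m * m * Q + m * (T * T) ≡ m * (T * T) + m * (m * Q)
    lem₄ = solve-∀
    chain : m * (T * T) + m * (T * T) ≤ m * (T * T) + m * (m * Q)
    chain = begin
      m * (T * T) + m * (T * T)                        ≡⟨ lem₁ m T ⟩
      2 * m * T * ∑ l f                                ≡⟨ ∑-*ˡ l (2 * m * T) f ⟨
      ∑ l (λ x → 2 * m * T * f x)                      ≤⟨ ∑-mono l (λ x → ≤-trans (≤-reflexive (lem₂ m T (f x)))
                                                            (≤-trans (2ab≤a²+b² (m * f x) T) (≤-reflexive (lem₃ m (f x) T)))) ⟩
      ∑ l (λ x → m * m * (f x * f x) + T * T)          ≡⟨ ∑-+ l (λ x → m * m * (f x * f x)) (λ _ → T * T) ⟩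
      ∑ l (λ x → m * m * (f x * f x)) + ∑ l (λ _ → T * T)
                                                       ≡⟨ cong₂ _+_ (∑-*ˡ l (m * m) (λ x → f x * f x)) (∑-const l (T * T)) ⟩
      m * m * Q + m * (T * T)                          ≡⟨ lem₄ m Q T ⟩
      m * (T * T) + m * (m * Q)                        ∎

  ∑-square : ∀ (l : List A) f → ∑ l f * ∑ l f ≡ ∑ l (λ x → ∑ l (λ y → f x * f y))
  ∑-square l f = trans (sym (∑-*ʳ l f (∑ l f))) (∑-cong l (λ x → sym (∑-*ˡ l (f x) f)))

  ∑∑-*ˡ : ∀ (l : List A) c (g : A → A → ℕ) → c * ∑ l (λ x → ∑ l (g x)) ≡ ∑ l (λ x → ∑ l (λ y → c * g x y))
  ∑∑-*ˡ l c g = trans (sym (∑-*ˡ l c (λ x → ∑ l (g x)))) (∑-cong l (λ x → sym (∑-*ˡ l c (g x))))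

  ∑∑-const : ∀ (l : List A) c → ∑ l (λ _ → ∑ l (λ _ → c)) ≡ length l * (length l * c)
  ∑∑-const l c = trans (∑-const l _) (cong (length l *_) (∑-const l c))

  -- The diagonal gets the crude bound `K`, every other entry its own comparison. The diagonal of
  -- `h` is added on the right so that a full double sum results, which factors when `h` is a
  -- product.
  ∑∑-offDiagonal : ∀ (l : List A) (g h : A → A → ℕ) K →
    (∀ x → g x x ≤ K) → AllPairs (λ x y → g x y ≤ h x y × g y x ≤ h y x) l →
    ∑ l (λ x → ∑ l (g x)) ≤ length l * K + ∑ l (λ x → ∑ l (h x))
  ∑∑-offDiagonal [] g h K d _ = z≤n
  ∑∑-offDiagonal (a ∷ l) g h K d (pa ∷ ps) = begin
      (g a a + ∑ l (g a)) + ∑ l (λ x → g x a + ∑ l (g x))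
        ≡⟨ cong (g a a + ∑ l (g a) +_) (∑-+ l (λ x → g x a) _) ⟩
      (g a a + ∑ l (g a)) + (∑ l (λ x → g x a) + ∑ l (λ x → ∑ l (g x)))
        ≤⟨ +-mono-≤ (+-mono-≤ (d a) (∑-mono-∈ l (λ p → proj₁ (All.lookup pa p))))
                    (+-mono-≤ (∑-mono-∈ l (λ p → proj₂ (All.lookup pa p))) (∑∑-offDiagonal l g h K d ps)) ⟩
      (K + ∑ l (h a)) + (∑ l (λ x → h x a) + (length l * K + ∑ l (λ x → ∑ l (h x))))
        ≡⟨ lem K (∑ l (h a)) (∑ l (λ x → h x a)) (length l * K) (∑ l (λ x → ∑ l (h x))) ⟩
      (K + length l * K) + (∑ l (h a) + (∑ l (λ x → h x a) + ∑ l (λ x → ∑ l (h x))))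
        ≤⟨ +-monoʳ-≤ (K + length l * K) (+-monoˡ-≤ _ (m≤n+m (∑ l (h a)) (h a a))) ⟩
      (K + length l * K) + ((h a a + ∑ l (h a)) + (∑ l (λ x → h x a) + ∑ l (λ x → ∑ l (h x))))
        ≡⟨ cong (λ z → (K + length l * K) + ((h a a + ∑ l (h a)) + z)) (∑-+ l (λ x → h x a) _) ⟨
      (K + length l * K) + ((h a a + ∑ l (h a)) + ∑ l (λ x → h x a + ∑ l (h x))) ∎
    where
    open ≤-Reasoning
    lem : ∀ K p q r s → (K + p) + (q + (r + s)) ≡ (K + r) + (p + (q + s))
    lem = solve-∀

  ∑∑-scaled : ∀ (l : List A) (g : A → A → ℕ) c B w → (∀ x → g x x ≤ w) →
    AllPairs (λ x y → c * g x y ≤ B × c * g y x ≤ B) l →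
    c * ∑ l (λ x → ∑ l (g x)) ≤ length l * (c * w) + length l * (length l * B)
  ∑∑-scaled l g c B w diag off = begin
      c * ∑ l (λ x → ∑ l (g x))
        ≡⟨ ∑∑-*ˡ l c g ⟩
      ∑ l (λ x → ∑ l (λ y → c * g x y))
        ≤⟨ ∑∑-offDiagonal l (λ x y → c * g x y) (λ _ _ → B) (c * w) (λ x → *-monoʳ-≤ c (diag x)) off ⟩
      length l * (c * w) + ∑ l (λ _ → ∑ l (λ _ → B))
        ≡⟨ cong (length l * (c * w) +_) (∑∑-const l B) ⟩
      length l * (c * w) + length l * (length l * B) ∎
    where open ≤-Reasoning

  -- Power sums from tail bounds

  1+B^-step : ∀ B c → suc B ^ suc c ≤ B ^ suc c + suc c * suc B ^ c
  1+B^-step B zero = ≤-reflexive (lem B)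
    where lem : ∀ B → suc B * 1 ≡ B * 1 + (1 + 0)
          lem = solve-∀
  1+B^-step B (suc c) = begin
      suc B * suc B ^ suc c                                   ≤⟨ *-monoʳ-≤ (suc B) (1+B^-step B c) ⟩
      suc B * (B ^ suc c + suc c * suc B ^ c)                 ≡⟨ lem B (B ^ suc c) c (suc B ^ c) ⟩
      (B * B ^ suc c + suc c * (suc B * suc B ^ c)) + B ^ suc c ≤⟨ +-monoʳ-≤ (B * B ^ suc c + suc c * (suc B * suc B ^ c)) (^-monoˡ-≤ (suc c) (n≤1+n B)) ⟩
      (B * B ^ suc c + suc c * suc B ^ suc c) + suc B ^ suc c ≡⟨ lem′ (B * B ^ suc c) c (suc B ^ suc c) ⟩
      B * B ^ suc c + suc (suc c) * suc B ^ suc c             ∎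
    where
    open ≤-Reasoning
    lem : ∀ B p c q → suc B * (p + suc c * q) ≡ (B * p + suc c * (suc B * q)) + p
    lem = solve-∀
    lem′ : ∀ p c q → (p + suc c * q) + q ≡ p + suc (suc c) * q
    lem′ = solve-∀

  -- Induction on the truncation level. Raising it from `B` to `B + 1` affects only entries with
  -- `a x` above `B`, each by at most (c + 1)(B + 1)^c, the derivative at the right end. By the tail
  -- hypothesis one level costs at most (c + 1)K in total.
  layer-cake : ∀ (l : List A) (a : A → ℕ) c K B →
    (∀ t → 1 ≤ t → length (filter (λ x → t ≤? a x) l) * t ^ c ≤ K) →
    ∑ l (λ x → (a x ⊓ B) ^ suc c) ≤ suc c * K * B
  layer-cake l a c K zero tail = ≤-trans (∑-mono l {g = λ _ → 0} (λ x → ≤-reflexive (cong (_^ suc c) (⊓-zeroʳ (a x)))))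
                                  (≤-trans (≤-reflexive (trans (∑-const l 0) (*-zeroʳ (length l)))) z≤n)
  layer-cake l a c K (suc B) tail = begin
      ∑ l (λ x → (a x ⊓ suc B) ^ suc c)
        ≤⟨ ∑-mono l step ⟩
      ∑ l (λ x → (a x ⊓ B) ^ suc c + ⟦ suc B ≤? a x ⟧ * (suc c * suc B ^ c))
        ≡⟨ ∑-+ l _ _ ⟩
      ∑ l (λ x → (a x ⊓ B) ^ suc c) + ∑ l (λ x → ⟦ suc B ≤? a x ⟧ * (suc c * suc B ^ c))
        ≡⟨ cong (∑ l (λ x → (a x ⊓ B) ^ suc c) +_) (∑-*ʳ l _ (suc c * suc B ^ c)) ⟩
      ∑ l (λ x → (a x ⊓ B) ^ suc c) + ∑ l (λ x → ⟦ suc B ≤? a x ⟧) * (suc c * suc B ^ c)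
        ≤⟨ +-mono-≤ (layer-cake l a c K B tail) tl ⟩
      suc c * K * B + suc c * K
        ≡⟨ lem (suc c * K) B ⟩
      suc c * K * suc B ∎
    where
    open ≤-Reasoning
    lem : ∀ p B → p * B + p ≡ p * suc B
    lem = solve-∀
    lem′ : ∀ N s p → N * (s * p) ≡ s * (N * p)
    lem′ = solve-∀
    tl : ∑ l (λ x → ⟦ suc B ≤? a x ⟧) * (suc c * suc B ^ c) ≤ suc c * K
    tl = begin
      ∑ l (λ x → ⟦ suc B ≤? a x ⟧) * (suc c * suc B ^ c)
        ≡⟨ cong (_* (suc c * suc B ^ c)) (length-filter (λ x → suc B ≤? a x) l) ⟨
      length (filter (λ x → suc B ≤? a x) l) * (suc c * suc B ^ c)
        ≡⟨ lem′ (length (filter (λ x → suc B ≤? a x) l)) (suc c) (suc B ^ c) ⟩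
      suc c * (length (filter (λ x → suc B ≤? a x) l) * suc B ^ c)
        ≤⟨ *-monoʳ-≤ (suc c) (tail (suc B) (s≤s z≤n)) ⟩
      suc c * K ∎
    step : ∀ x → (a x ⊓ suc B) ^ suc c ≤ (a x ⊓ B) ^ suc c + ⟦ suc B ≤? a x ⟧ * (suc c * suc B ^ c)
    step x with suc B ≤? a x
    ... | yes p = begin
      (a x ⊓ suc B) ^ suc c               ≡⟨ cong (_^ suc c) (m≥n⇒m⊓n≡n p) ⟩
      suc B ^ suc c                       ≤⟨ 1+B^-step B c ⟩
      B ^ suc c + suc c * suc B ^ c       ≡⟨ cong₂ _+_ (cong (_^ suc c) (sym (m≥n⇒m⊓n≡n (≤-trans (n≤1+n B) p)))) (sym (+-identityʳ _)) ⟩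
      (a x ⊓ B) ^ suc c + (suc c * suc B ^ c + 0) ∎
    ... | no ¬p = begin
      (a x ⊓ suc B) ^ suc c               ≡⟨ cong (_^ suc c) (trans (m≤n⇒m⊓n≡m (≤-trans ax≤B (n≤1+n B))) (sym (m≤n⇒m⊓n≡m ax≤B))) ⟩
      (a x ⊓ B) ^ suc c                   ≡⟨ +-identityʳ _ ⟨
      (a x ⊓ B) ^ suc c + 0               ∎
      where ax≤B = ≤-pred (≰⇒> ¬p)

  ∑-pow-bounded : ∀ (l : List A) (a : A → ℕ) c k d → (∀ {x} → x ∈ l → a x ≤ d) →
    ∑ l (λ x → a x ^ (c + k)) ≤ d ^ k * ∑ l (λ x → a x ^ c)
  ∑-pow-bounded l a c k d h = begin
      ∑ l (λ x → a x ^ (c + k))     ≤⟨ ∑-mono-∈ l (λ {x} p → ≤-trans (≤-reflexive (trans (^-distribˡ-+-* (a x) c k) (*-comm (a x ^ c) (a x ^ k))))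
                                                       (*-monoˡ-≤ (a x ^ c) (^-monoˡ-≤ k (h p)))) ⟩
      ∑ l (λ x → d ^ k * a x ^ c)   ≡⟨ ∑-*ˡ l (d ^ k) _ ⟩
      d ^ k * ∑ l (λ x → a x ^ c)   ∎
    where open ≤-Reasoning

  -- Once some `x` exceeds b/2, the pairwise bound keeps every other entry below `b ∸ a x`, so `k`
  -- of their factors can be pulled out of the sum.
  small-or-dominant : ∀ (l : List A) (a : A → ℕ) b c k → AllPairs (λ x y → a x + a y ≤ b) l →
    (∀ {x} → x ∈ l → 2 * a x ≤ b) ⊎
    ∃ λ x → x ∈ l × b < 2 * a x × (∑ l (λ y → a y ^ (c + k)) ≤ a x ^ (c + k) + (b ∸ a x) ^ k * ∑ l (λ y → a y ^ c))
  small-or-dominant [] a b c k _ = inj₁ λ ()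
  small-or-dominant (x ∷ l) a b c k (px ∷ ps) with 2 * a x ≤? b
  ... | no ¬p = inj₂ (x , here refl , ≰⇒> ¬p ,
          +-monoʳ-≤ (a x ^ (c + k)) (≤-trans (∑-pow-bounded l a c k (b ∸ a x) (λ {y} y∈ → m+n≤o⇒m≤o∸n (a y) (≤-trans (≤-reflexive (+-comm (a y) (a x))) (All.lookup px y∈))))
             (*-monoʳ-≤ ((b ∸ a x) ^ k) (m≤n+m _ (a x ^ c)))))
  ... | yes p with small-or-dominant l a b c k ps
  ...   | inj₁ h = inj₁ λ { (here refl) → p ; (there q) → h q }
  ...   | inj₂ (y , y∈ , y> , h) = inj₂ (y , there y∈ , y> , (begin
      a x ^ (c + k) + ∑ l (λ z → a z ^ (c + k))
        ≤⟨ +-mono-≤ (≤-trans (≤-reflexive (trans (^-distribˡ-+-* (a x) c k) (*-comm (a x ^ c) (a x ^ k)))) (*-monoˡ-≤ (a x ^ c) (^-monoˡ-≤ k (m+n≤o⇒m≤o∸n (a x) (All.lookup px y∈))))) h ⟩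
      (b ∸ a y) ^ k * a x ^ c + (a y ^ (c + k) + (b ∸ a y) ^ k * ∑ l (λ z → a z ^ c))
        ≡⟨ lem ((b ∸ a y) ^ k) (a x ^ c) (a y ^ (c + k)) (∑ l (λ z → a z ^ c)) ⟩
      a y ^ (c + k) + (b ∸ a y) ^ k * (a x ^ c + ∑ l (λ z → a z ^ c)) ∎))
    where
    open ≤-Reasoning
    lem : ∀ d p q r → d * p + (q + d * r) ≡ q + d * (p + r)
    lem = solve-∀

  ^-distribʳ-* : ∀ a b k → (a * b) ^ k ≡ a ^ k * b ^ k
  ^-distribʳ-* a b zero = refl
  ^-distribʳ-* a b (suc k) = trans (cong (a * b *_) (^-distribʳ-* a b k)) (lem a b (a ^ k) (b ^ k))
    where lem : ∀ a b p q → a * b * (p * q) ≡ a * p * (b * q)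
          lem = solve-∀

  -- If every term is at most b/2, the extra exponent e + 1 beats the constant of the tail bound.
  -- Otherwise one term x exceeds b/2; the rest are at most d = b - x, and b^C - x^C ≥ d b^(C-1).
  power-sum≤ : ∀ (l : List A) (a : A → ℕ) b c M e → suc c * M ≤ 2 ^ e →
    (∀ {x} → x ∈ l → a x ≤ b) → AllPairs (λ x y → a x + a y ≤ b) l →
    (∀ t → 1 ≤ t → length (filter (λ x → t ≤? a x) l) * t ^ c ≤ M * b ^ c) →
    ∑ l (λ x → a x ^ (suc c + suc e)) ≤ b ^ (suc c + suc e)
  power-sum≤ l a b c M e M≤ a≤b pairs tail = go (small-or-dominant l a b (suc c) (suc e) pairs)
    where
    open ≤-Reasoning
    C = suc c + suc e
    Q = ∑ l (λ x → a x ^ suc c)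
    Q≤ : Q ≤ 2 ^ e * b ^ suc c
    Q≤ = begin
      Q                                  ≤⟨ ∑-mono-∈ l (λ {x} p → ≤-reflexive (cong (_^ suc c) (sym (m≤n⇒m⊓n≡m (a≤b p))))) ⟩
      ∑ l (λ x → (a x ⊓ b) ^ suc c)      ≤⟨ layer-cake l a c (M * b ^ c) b tail ⟩
      suc c * (M * b ^ c) * b            ≡⟨ lem (suc c) M (b ^ c) b ⟩
      suc c * M * (b * b ^ c)            ≤⟨ *-monoˡ-≤ (b * b ^ c) M≤ ⟩
      2 ^ e * b ^ suc c                  ∎
      where lem : ∀ s M p b → s * (M * p) * b ≡ s * M * (b * p)
            lem = solve-∀
    scaled : ∀ d → 2 * d ≤ b → 2 ^ e * d ^ e ≤ b ^ e
    scaled d h = ≤-trans (≤-reflexive (sym (^-distribʳ-* 2 d e))) (^-monoˡ-≤ e h)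
    go : _ → _
    go (inj₁ small) = *-cancelˡ-≤ (2 ^ suc e) {{m^n≢0 2 (suc e)}} (begin
      2 ^ suc e * ∑ l (λ x → a x ^ C)    ≡⟨ ∑-*ˡ l (2 ^ suc e) _ ⟨
      ∑ l (λ x → 2 ^ suc e * a x ^ C)    ≤⟨ ∑-mono-∈ l (λ {x} p → begin
          2 ^ suc e * a x ^ (suc c + suc e)             ≡⟨ cong (2 ^ suc e *_) (^-distribˡ-+-* (a x) (suc c) (suc e)) ⟩
          2 ^ suc e * (a x ^ suc c * a x ^ suc e)       ≡⟨ lem₁ (2 ^ suc e) (a x ^ suc c) (a x ^ suc e) ⟩
          2 ^ suc e * a x ^ suc e * a x ^ suc c         ≡⟨ cong (_* a x ^ suc c) (^-distribʳ-* 2 (a x) (suc e)) ⟨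
          (2 * a x) ^ suc e * a x ^ suc c               ≤⟨ *-monoˡ-≤ (a x ^ suc c) (^-monoˡ-≤ (suc e) (small p)) ⟩
          b ^ suc e * a x ^ suc c                       ∎) ⟩
      ∑ l (λ x → b ^ suc e * a x ^ suc c) ≡⟨ ∑-*ˡ l (b ^ suc e) _ ⟩
      b ^ suc e * Q                      ≤⟨ *-monoʳ-≤ (b ^ suc e) Q≤ ⟩
      b ^ suc e * (2 ^ e * b ^ suc c)    ≡⟨ lem₂ (b ^ suc e) (2 ^ e) (b ^ suc c) ⟩
      2 ^ e * (b ^ suc c * b ^ suc e)    ≡⟨ cong (2 ^ e *_) (^-distribˡ-+-* b (suc c) (suc e)) ⟨
      2 ^ e * b ^ C                      ≤⟨ *-monoˡ-≤ (b ^ C) (m≤m+n (2 ^ e) (2 ^ e + 0)) ⟩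
      2 ^ suc e * b ^ C                  ∎)
      where
      lem₁ : ∀ p q r → p * (q * r) ≡ p * r * q
      lem₁ = solve-∀
      lem₂ : ∀ p q r → p * (q * r) ≡ q * (r * p)
      lem₂ = solve-∀
    go (inj₂ (x , x∈ , x> , h)) = begin
      ∑ l (λ y → a y ^ C)                            ≤⟨ h ⟩
      a x ^ C + d ^ suc e * Q                        ≤⟨ +-monoʳ-≤ (a x ^ C) (*-monoʳ-≤ (d ^ suc e) Q≤) ⟩
      a x ^ C + d * d ^ e * (2 ^ e * b ^ suc c)      ≡⟨ cong (a x ^ C +_) (lem₁ d (d ^ e) (2 ^ e) (b ^ suc c)) ⟩
      a x ^ C + d * (2 ^ e * d ^ e * b ^ suc c)      ≤⟨ +-mono-≤ (*-monoʳ-≤ (a x) (^-monoˡ-≤ (c + suc e) (a≤b x∈)))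
                                                          (*-monoʳ-≤ d (*-monoˡ-≤ (b ^ suc c) (scaled d 2d≤b))) ⟩
      a x * b ^ (c + suc e) + d * (b ^ e * b ^ suc c) ≡⟨ cong (λ z → a x * b ^ (c + suc e) + d * z) (^-distribˡ-+-* b e (suc c)) ⟨
      a x * b ^ (c + suc e) + d * b ^ (e + suc c)    ≡⟨ cong (λ z → a x * b ^ (c + suc e) + d * b ^ z) (lem₂ e c) ⟩
      a x * b ^ (c + suc e) + d * b ^ (c + suc e)    ≡⟨ *-distribʳ-+ (b ^ (c + suc e)) (a x) d ⟨
      (a x + d) * b ^ (c + suc e)                    ≡⟨ cong (_* b ^ (c + suc e)) ax+d ⟩
      b * b ^ (c + suc e)                            ∎
      where
      d = b ∸ a x
      ax+d : a x + d ≡ b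
      ax+d = m+[n∸m]≡n (a≤b x∈)
      2d≤b : 2 * d ≤ b
      2d≤b = +-cancelʳ-≤ b (2 * d) b (begin
        2 * d + b                ≤⟨ +-monoʳ-≤ (2 * d) (<⇒≤ x>) ⟩
        2 * d + 2 * a x          ≡⟨ lem₃ d (a x) ⟩
        (a x + d) + (a x + d)    ≡⟨ cong₂ _+_ ax+d ax+d ⟩
        b + b                    ∎)
        where lem₃ : ∀ d x → 2 * d + 2 * x ≡ (x + d) + (x + d)
              lem₃ = solve-∀
      lem₁ : ∀ d p q r → d * p * (q * r) ≡ d * (q * p * r)
      lem₁ = solve-∀
      lem₂ : ∀ e c → e + suc c ≡ c + suc e
      lem₂ = solve-∀

  -- Sums over the cube, coverings and maximal subfamilies

  ∑-cube-suc : ∀ n (f : Vec Bool (suc n) → ℕ) →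
    ∑ (cube (suc n)) f ≡ ∑ (cube n) (f ∘ (false ∷_)) + ∑ (cube n) (f ∘ (true ∷_))
  ∑-cube-suc n f = trans (∑-++ (map (false ∷_) (cube n)) _ f)
    (cong₂ _+_ (∑-map (false ∷_) (cube n) f)
      (trans (cong (λ l → ∑ l f) (Listₚ.++-identityʳ (map (true ∷_) (cube n)))) (∑-map (true ∷_) (cube n) f)))

  ∑-cube-const : ∀ n c → ∑ (cube n) (λ _ → c) ≡ 2 ^ n * c
  ∑-cube-const zero c = refl
  ∑-cube-const (suc n) c = trans (∑-cube-suc n (λ _ → c))
    (trans (cong₂ _+_ (∑-cube-const n c) (∑-cube-const n c)) (lem (2 ^ n) c))
    where lem : ∀ w c → w * c + w * c ≡ 2 * w * c
          lem = solve-∀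

  length-cube : ∀ n → length (cube n) ≡ 2 ^ n
  length-cube n = trans (length-as-∑ (cube n)) (trans (∑-cube-const n 1) (*-identityʳ _))

  ∑-cube-≤ : ∀ n (f : Vec Bool n → ℕ) → (∀ x → f x ≤ 1) → ∑ (cube n) f ≤ 2 ^ n
  ∑-cube-≤ n f h = ≤-trans (∑-mono (cube n) h) (≤-reflexive (trans (∑-cube-const n 1) (*-identityʳ _)))

  -- Every `u` is counted at least once on the right; overlaps between the sets only increase that
  -- side.
  ∑-cover : ∀ (D : List B) (U : List A) {R : A → B → Set} (R? : ∀ u d → Dec (R u d)) (f : A → ℕ) →
    (∀ {u} → u ∈ U → Any (R u) D) → ∑ U f ≤ ∑ D (λ d → ∑ (filter (λ u → R? u d) U) f)
  ∑-cover D U R? f cov = begin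
      ∑ U f                                              ≤⟨ ∑-mono-∈ U (λ u∈ → hits D (cov u∈)) ⟩
      ∑ U (λ u → ∑ D (λ d → ⟦ R? u d ⟧ * f u))           ≡⟨ ∑-swap U D (λ u d → ⟦ R? u d ⟧ * f u) ⟩
      ∑ D (λ d → ∑ U (λ u → ⟦ R? u d ⟧ * f u))           ≡⟨ ∑-cong D (λ d → ∑-filter (λ u → R? u d) U f) ⟨
      ∑ D (λ d → ∑ (filter (λ u → R? u d) U) f)          ∎
    where
    open ≤-Reasoning
    hits : ∀ E {u} → Any _ E → f u ≤ ∑ E (λ d → ⟦ R? u d ⟧ * f u)
    hits (d ∷ E) {u} (here r) with R? u d
    ... | yes _ = ≤-trans (≤-reflexive (sym (+-identityʳ (f u)))) (m≤m+n _ _)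
    ... | no ¬r = contradiction r ¬r
    hits (d ∷ E) {u} (there p) = ≤-trans (hits E p) (m≤n+m _ (⟦ R? u d ⟧ * f u))

  cover : ∀ (D : List B) (U : List A) {R : A → B → Set} (R? : ∀ u d → Dec (R u d)) T K →
    (∀ {u} → u ∈ U → Any (R u) D) →
    (∀ {d} → d ∈ D → length (filter (λ u → R? u d) U) * T ≤ K) →
    length U * T ≤ length D * K
  cover D U R? T K cov bound = begin
      length U * T                                       ≡⟨ ∑-const U T ⟨
      ∑ U (λ _ → T)                                      ≤⟨ ∑-cover D U R? (λ _ → T) cov ⟩
      ∑ D (λ d → ∑ (filter (λ u → R? u d) U) (λ _ → T))  ≤⟨ ∑-mono-∈ D (λ {d} d∈ → ≤-trans (≤-reflexive (∑-const (filter (λ u → R? u d) U) T)) (bound d∈)) ⟩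
      ∑ D (λ _ → K)                                      ≡⟨ ∑-const D K ⟩
      length D * K                                       ∎
    where open ≤-Reasoning

  all⊎any : {P Q : A → Set} (D : List A) → (∀ d → P d ⊎ Q d) → All P D ⊎ Any Q D
  all⊎any [] f = inj₁ []
  all⊎any (d ∷ D) f with f d | all⊎any D f
  ... | inj₂ q | _       = inj₂ (here q)
  ... | inj₁ p | inj₁ ps = inj₁ (p ∷ ps)
  ... | inj₁ p | inj₂ qs = inj₂ (there qs)

  -- Greedy choice: an element is kept if it is in relation `P` to everything kept so far, and
  -- otherwise some kept element witnesses `Q`. Reflexivity of `Q` lets the kept elements cover
  -- themselves. It yields far functions, disjoint supports and class representatives alike.
  maximal-subfamily : {P Q : A → A → Set} → (∀ u d → P u d ⊎ Q u d) → (U : List A) → (∀ {u} → u ∈ U → Q u u) →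
    ∃ λ D → (∀ {d} → d ∈ D → d ∈ U) × AllPairs P D × (∀ {u} → u ∈ U → Any (Q u) D)
  maximal-subfamily f [] r = [] , (λ ()) , [] , λ ()
  maximal-subfamily f (u ∷ U) r with maximal-subfamily f U (r ∘ there)
  ... | D , sub , pairs , cov with all⊎any D (f u)
  ...   | inj₁ ps = u ∷ D , (λ { (here refl) → here refl ; (there p) → there (sub p) }) , ps ∷ pairs ,
                    λ { (here refl) → here (r (here refl)) ; (there p) → there (cov p) }
  ...   | inj₂ qs = D , there ∘ sub , pairs , λ { (here refl) → qs ; (there p) → cov p }

  -- Linear functions on the cube and their zeros

  module _ (G : FinAbGroup) where

    abelianGroup : AbelianGroup 0ℓ 0ℓ
    abelianGroup = record { isAbelianGroup = isAbelianGroup G }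

  module Linear (Z : FinAbGroup) where

    open AbelianGroup (abelianGroup Z) public using ()
      renaming (_∙_ to _⊕_; ε to 𝟘; _⁻¹ to ⊖_; assoc to ⊕-assoc; comm to ⊕-comm; identityˡ to ⊕-identityˡ;
                identityʳ to ⊕-identityʳ; inverseˡ to ⊖-inverseˡ; inverseʳ to ⊖-inverseʳ)
    open AbelianGroupₚ (abelianGroup Z) public using ()
      renaming (⁻¹-∙-comm to ⊖-⊕-comm; ∙-cancelʳ to ⊕-cancelʳ; x∙y⁻¹≈ε⇒x≈y to x⊝y≡𝟘⇒x≡y;
                ⁻¹-involutive to ⊖-involutive; ε⁻¹≈ε to ⊖𝟘)

    infixl 6 _⊝_
    _⊝_ : Carrier Z → Carrier Z → Carrier Z
    a ⊝ b = a ⊕ (⊖ b)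

    infix 4 _≟_
    _≟_ : (a b : Carrier Z) → Dec (a ≡ b)
    _≟_ = deq Z

    ⊕-interchange : ∀ a b c d → (a ⊕ b) ⊕ (c ⊕ d) ≡ (a ⊕ c) ⊕ (b ⊕ d)
    ⊕-interchange a b c d = begin
      (a ⊕ b) ⊕ (c ⊕ d)   ≡⟨ ⊕-assoc a b _ ⟩
      a ⊕ (b ⊕ (c ⊕ d))   ≡⟨ cong (a ⊕_) (⊕-assoc b c d) ⟨
      a ⊕ ((b ⊕ c) ⊕ d)   ≡⟨ cong (λ z → a ⊕ (z ⊕ d)) (⊕-comm b c) ⟩
      a ⊕ ((c ⊕ b) ⊕ d)   ≡⟨ cong (a ⊕_) (⊕-assoc c b d) ⟩
      a ⊕ (c ⊕ (b ⊕ d))   ≡⟨ ⊕-assoc a c _ ⟨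
      (a ⊕ c) ⊕ (b ⊕ d)   ∎
      where open ≡-Reasoning

    ⊝-interchange : ∀ a b c d → (a ⊕ b) ⊝ (c ⊕ d) ≡ (a ⊝ c) ⊕ (b ⊝ d)
    ⊝-interchange a b c d = trans (cong ((a ⊕ b) ⊕_) (sym (⊖-⊕-comm c d))) (⊕-interchange a b (⊖ c) (⊖ d))

    ⊝-self : ∀ a → a ⊝ a ≡ 𝟘
    ⊝-self = ⊖-inverseʳ

    ⊝-telescope : ∀ a b c → (a ⊝ b) ⊕ (b ⊝ c) ≡ a ⊝ c
    ⊝-telescope a b c = begin
      (a ⊝ b) ⊕ (b ⊝ c)         ≡⟨ ⊕-assoc a (⊖ b) _ ⟩
      a ⊕ ((⊖ b) ⊕ (b ⊝ c))     ≡⟨ cong (a ⊕_) (⊕-assoc (⊖ b) b (⊖ c)) ⟨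
      a ⊕ (((⊖ b) ⊕ b) ⊕ (⊖ c)) ≡⟨ cong (λ z → a ⊕ (z ⊕ (⊖ c))) (⊖-inverseˡ b) ⟩
      a ⊕ (𝟘 ⊕ (⊖ c))           ≡⟨ cong (a ⊕_) (⊕-identityˡ (⊖ c)) ⟩
      a ⊝ c                     ∎
      where open ≡-Reasoning

    ⊖-⊝ : ∀ a b → ⊖ (a ⊝ b) ≡ b ⊝ a
    ⊖-⊝ a b = trans (sym (⊖-⊕-comm a (⊖ b))) (trans (⊕-comm (⊖ a) _) (cong (_⊕ (⊖ a)) (⊖-involutive b)))

    ⊝-𝟘 : ∀ a → a ⊝ 𝟘 ≡ a
    ⊝-𝟘 a = trans (cong (a ⊕_) ⊖𝟘) (⊕-identityʳ a)

    module _ {n : ℕ} where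

      infixl 6 _-ᵛ_ _-ᴸ_
      _-ᵛ_ : (as bs : Vec (Carrier Z) n) → Vec (Carrier Z) n
      _-ᵛ_ = zipWith _⊝_

      _-ᴸ_ : (L M : Lin Z n) → Lin Z n
      (a₀ , as) -ᴸ (b₀ , bs) = (a₀ ⊝ b₀) , (as -ᵛ bs)

      0ᵛ : Vec (Carrier Z) n
      0ᵛ = replicate n 𝟘

      0ᴸ : Lin Z n
      0ᴸ = 𝟘 , 0ᵛ

      const : Carrier Z → Lin Z n
      const c = c , 0ᵛ

    evalLin-shift : ∀ {n} c a₀ (as : Vec (Carrier Z) n) x → evalLin Z (c ⊕ a₀) as x ≡ c ⊕ evalLin Z a₀ as x
    evalLin-shift c a₀ [] [] = refl
    evalLin-shift c a₀ (a ∷ as) (false ∷ x) = evalLin-shift c a₀ as x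
    evalLin-shift c a₀ (a ∷ as) (true ∷ x) = begin
      a ⊕ evalLin Z (c ⊕ a₀) as x      ≡⟨ cong (a ⊕_) (evalLin-shift c a₀ as x) ⟩
      a ⊕ (c ⊕ evalLin Z a₀ as x)      ≡⟨ ⊕-assoc a c _ ⟨
      (a ⊕ c) ⊕ evalLin Z a₀ as x      ≡⟨ cong (_⊕ evalLin Z a₀ as x) (⊕-comm a c) ⟩
      (c ⊕ a) ⊕ evalLin Z a₀ as x      ≡⟨ ⊕-assoc c a _ ⟩
      c ⊕ (a ⊕ evalLin Z a₀ as x)      ∎
      where open ≡-Reasoning

    evalLin-0ᵛ : ∀ {n} a₀ (x : Vec Bool n) → evalLin Z a₀ 0ᵛ x ≡ a₀
    evalLin-0ᵛ a₀ [] = refl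
    evalLin-0ᵛ a₀ (false ∷ x) = evalLin-0ᵛ a₀ x
    evalLin-0ᵛ a₀ (true ∷ x) = trans (⊕-identityˡ _) (evalLin-0ᵛ a₀ x)

    evalP-⊝ : ∀ {n} (L M : Lin Z n) x → evalP Z (L -ᴸ M) x ≡ evalP Z L x ⊝ evalP Z M x
    evalP-⊝ (a₀ , []) (b₀ , []) [] = refl
    evalP-⊝ (a₀ , a ∷ as) (b₀ , b ∷ bs) (false ∷ x) = evalP-⊝ (a₀ , as) (b₀ , bs) x
    evalP-⊝ (a₀ , a ∷ as) (b₀ , b ∷ bs) (true ∷ x) = trans (cong ((a ⊝ b) ⊕_) (evalP-⊝ (a₀ , as) (b₀ , bs) x))
      (sym (⊝-interchange a _ b _))

    -ᵛ≡0⇒≡ : ∀ {n} (as bs : Vec (Carrier Z) n) → as -ᵛ bs ≡ 0ᵛ → as ≡ bs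
    -ᵛ≡0⇒≡ [] [] _ = refl
    -ᵛ≡0⇒≡ (a ∷ as) (b ∷ bs) eq = cong₂ _∷_ (x⊝y≡𝟘⇒x≡y a b (Vecₚ.∷-injectiveˡ eq)) (-ᵛ≡0⇒≡ as bs (Vecₚ.∷-injectiveʳ eq))

    -ᴸ≡0⇒≡ : ∀ {n} (L M : Lin Z n) → L -ᴸ M ≡ 0ᴸ → L ≡ M
    -ᴸ≡0⇒≡ (a₀ , as) (b₀ , bs) eq = cong₂ _,_ (x⊝y≡𝟘⇒x≡y a₀ b₀ (cong proj₁ eq)) (-ᵛ≡0⇒≡ as bs (cong proj₂ eq))

    ⊝-cancelʳ : ∀ {a b} c → a ⊝ c ≡ b ⊝ c → a ≡ b
    ⊝-cancelʳ c eq = ⊕-cancelʳ (⊖ c) _ _ eq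

    -ᵛ-cancelʳ : ∀ {n} {as bs : Vec (Carrier Z) n} cs → as -ᵛ cs ≡ bs -ᵛ cs → as ≡ bs
    -ᵛ-cancelʳ {as = []} {[]} [] _ = refl
    -ᵛ-cancelʳ {as = a ∷ as} {b ∷ bs} (c ∷ cs) eq =
      cong₂ _∷_ (⊝-cancelʳ c (Vecₚ.∷-injectiveˡ eq)) (-ᵛ-cancelʳ cs (Vecₚ.∷-injectiveʳ eq))

    -ᴸ-cancelʳ : ∀ {n} {L M : Lin Z n} N → L -ᴸ N ≡ M -ᴸ N → L ≡ M
    -ᴸ-cancelʳ (c₀ , cs) eq = cong₂ _,_ (⊝-cancelʳ c₀ (cong proj₁ eq)) (-ᵛ-cancelʳ cs (cong proj₂ eq))

    module _ {n : ℕ} where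

      points : (Lin Z n) → Carrier Z → ℕ
      points L v = ∑ (cube n) (λ x → ⟦ evalP Z L x ≟ v ⟧)

      points≤W : ∀ L v → points L v ≤ 2 ^ n
      points≤W L v = ∑-cube-≤ n _ (λ x → ⟦⟧≤1 (evalP Z L x ≟ v))

    points-suc : ∀ {n} a₀ a (as : Vec (Carrier Z) n) v →
      points (a₀ , a ∷ as) v ≡ points (a₀ , as) v + points (a ⊕ a₀ , as) v
    points-suc {n} a₀ a as v = trans (∑-cube-suc n _)
      (cong (points (a₀ , as) v +_) (∑-cong (cube n) (λ x → cong (λ z → ⟦ z ≟ v ⟧) (sym (evalLin-shift a a₀ as x)))))

    points-const : ∀ {n} a₀ → a₀ ≢ 𝟘 → points {n} (const a₀) 𝟘 ≡ 0
    points-const {n} a₀ a₀≢0 = trans (∑-cong (cube n) pt) (trans (∑-cube-const n 0) (*-zeroʳ (2 ^ n)))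
      where pt : ∀ x → ⟦ evalLin Z a₀ 0ᵛ x ≟ 𝟘 ⟧ ≡ 0
            pt x with evalLin Z a₀ 0ᵛ x ≟ 𝟘
            ... | yes p = contradiction (trans (sym (evalLin-0ᵛ a₀ x)) p) a₀≢0
            ... | no _ = refl

    -- Split along the first variable. If a later coefficient is nonzero, both halves fall under the
    -- induction hypothesis. Otherwise the function is constant on each half, and the constants `a₀`
    -- and `a ⊕ a₀` cannot both vanish.
    2*zeros≤W : ∀ {n} (L : Lin Z n) → L ≢ 0ᴸ → 2 * points L 𝟘 ≤ 2 ^ n
    2*zeros≤W {zero} (a₀ , []) ne with a₀ ≟ 𝟘
    ... | yes p = contradiction (cong (_, []) p) ne
    ... | no _  = z≤n
    2*zeros≤W {suc n} (a₀ , a ∷ as) ne rewrite points-suc a₀ a as 𝟘 with Vecₚ.≡-dec _≟_ as 0ᵛ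
    ... | no ¬p = ≤-trans (≤-reflexive (*-distribˡ-+ 2 (points (a₀ , as) 𝟘) _))
                  (≤-trans (+-mono-≤ (2*zeros≤W (a₀ , as) (¬p ∘ cong proj₂)) (2*zeros≤W (a ⊕ a₀ , as) (¬p ∘ cong proj₂)))
                    (≤-reflexive (cong (2 ^ n +_) (sym (+-identityʳ (2 ^ n))))))
    ... | yes refl with a₀ ≟ 𝟘
    ...   | yes refl = *-monoʳ-≤ 2 (≤-trans (≤-reflexive (cong (points {n} (𝟘 , 0ᵛ) 𝟘 +_) (points-const {n} (a ⊕ 𝟘) a⊕𝟘≢𝟘)))
                          (≤-trans (≤-reflexive (+-identityʳ _)) (points≤W {n} (𝟘 , 0ᵛ) 𝟘)))
      where a⊕𝟘≢𝟘 : a ⊕ 𝟘 ≢ 𝟘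
            a⊕𝟘≢𝟘 p = ne (cong (λ z → 𝟘 , z ∷ 0ᵛ) (trans (sym (⊕-identityʳ a)) p))
    ...   | no a₀≢ = *-monoʳ-≤ 2 (≤-trans (≤-reflexive (cong (_+ points {n} (a ⊕ a₀ , 0ᵛ) 𝟘) (points-const {n} a₀ a₀≢)))
                          (points≤W {n} (a ⊕ a₀ , 0ᵛ) 𝟘))

    2*points≤W : ∀ {n} (L : Lin Z n) v → L ≢ const v → 2 * points L v ≤ 2 ^ n
    2*points≤W {n} L v ne = ≤-trans (*-monoʳ-≤ 2 (∑-mono (cube n) pt)) (2*zeros≤W (L -ᴸ const v) (ne ∘ -ᴸ≡0⇒≡ L (const v)))
      where
      pt : ∀ x → ⟦ evalP Z L x ≟ v ⟧ ≤ ⟦ evalP Z (L -ᴸ const v) x ≟ 𝟘 ⟧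
      pt x = ⟦⟧-mono (evalP Z L x ≟ v) (evalP Z (L -ᴸ const v) x ≟ 𝟘)
        (λ eq → trans (evalP-⊝ L (const v) x) (trans (cong₂ _⊝_ eq (evalLin-0ᵛ v x)) (⊝-self v)))

    module _ {n : ℕ} where

      collisions : Lin Z n → Lin Z n → ℕ
      collisions L M = ∑ (cube n) (λ x → ⟦ evalP Z L x ≟ evalP Z M x ⟧)

      collisions≤zeros : ∀ L M → collisions L M ≤ points (L -ᴸ M) 𝟘
      collisions≤zeros L M = ∑-mono (cube n) λ x → ⟦⟧-mono (evalP Z L x ≟ evalP Z M x) (evalP Z (L -ᴸ M) x ≟ 𝟘)
        (λ eq → trans (evalP-⊝ L M x) (trans (cong (_⊝ evalP Z M x) eq) (⊝-self (evalP Z M x))))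

      2*collisions≤W : ∀ L M → L ≢ M → 2 * collisions L M ≤ 2 ^ n
      2*collisions≤W L M ne = ≤-trans (*-monoʳ-≤ 2 (collisions≤zeros L M)) (2*zeros≤W (L -ᴸ M) (ne ∘ -ᴸ≡0⇒≡ L M))

      collisions-self : ∀ L → collisions L L ≤ 2 ^ n
      collisions-self L = ∑-cube-≤ n _ (λ x → ⟦⟧≤1 (evalP Z L x ≟ evalP Z L x))

    -- Agreement with partial functions and advantages

    PartialFun : ℕ → Set
    PartialFun n = Vec Bool n → Maybe (Carrier Z)

    hit : Maybe (Carrier Z) → Carrier Z → ℕ
    hit nothing  v = 0
    hit (just u) v = ⟦ v ≟ u ⟧

    defined : Maybe (Carrier Z) → ℕ
    defined nothing  = 0
    defined (just _) = 1

    module _ {n : ℕ} where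

      agreement : PartialFun n → Lin Z n → ℕ
      agreement F L = ∑ (cube n) (λ x → hit (F x) (evalP Z L x))

      domain : PartialFun n → ℕ
      domain F = ∑ (cube n) (λ x → defined (F x))

    hit≤defined : ∀ u v → hit u v ≤ defined u
    hit≤defined nothing  v = z≤n
    hit≤defined (just u) v = ⟦⟧≤1 (v ≟ u)

    defined≤1 : ∀ u → defined u ≤ 1
    defined≤1 nothing  = z≤n
    defined≤1 (just _) = ≤-refl

    shift : ∀ {n} → PartialFun n → Lin Z n → PartialFun n
    shift F M x = Data.Maybe.map (_⊝ evalP Z M x) (F x)

    hit-shift : ∀ u v w → hit u v ≤ hit (Data.Maybe.map (_⊝ w) u) (v ⊝ w)
    hit-shift nothing  v w = z≤n
    hit-shift (just u) v w = ⟦⟧-mono (v ≟ u) (v ⊝ w ≟ u ⊝ w) (cong (_⊝ w))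

    agreement-shift : ∀ {n} (F : PartialFun n) L M → agreement F L ≤ agreement (shift F M) (L -ᴸ M)
    agreement-shift {n} F L M = ∑-mono (cube n) (λ x → ≤-trans (hit-shift (F x) (evalP Z L x) (evalP Z M x))
      (≤-reflexive (cong (hit (shift F M x)) (sym (evalP-⊝ L M x)))))

    module _ {n : ℕ} (F : PartialFun n) where

      adv : Lin Z n → ℕ
      adv L = 2 * agreement F L ∸ 2 ^ n

      domain-adv : ℕ
      domain-adv = 2 * domain F ∸ 2 ^ n

      agreement≤domain : ∀ L → agreement F L ≤ domain F
      agreement≤domain L = ∑-mono (cube n) (λ x → hit≤defined (F x) (evalP Z L x))

      domain≤W : domain F ≤ 2 ^ n
      domain≤W = ∑-cube-≤ n _ (λ x → defined≤1 (F x))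

      adv≤domain-adv : ∀ L → adv L ≤ domain-adv
      adv≤domain-adv L = ∸-monoˡ-≤ (2 ^ n) (*-monoʳ-≤ 2 (agreement≤domain L))

      adv≥⇒ : ∀ {L t} → 1 ≤ t → t ≤ adv L → 2 ^ n + t ≤ 2 * agreement F L
      adv≥⇒ {L} {t} 1≤t t≤ = ≤-trans (+-monoʳ-≤ (2 ^ n) t≤) (≤-reflexive (m+[n∸m]≡n {2 ^ n} {2 * agreement F L}
         (<⇒≤ (m∸n≢0⇒n<m (λ eq → contradiction (≤-trans 1≤t (≤-trans t≤ (≤-reflexive eq))) λ ())))))

      ⇒adv≥ : ∀ {L t} → 2 ^ n + t ≤ 2 * agreement F L → t ≤ adv L
      ⇒adv≥ {L} {t} h = m+n≤o⇒m≤o∸n t (≤-trans (≤-reflexive (+-comm t (2 ^ n))) h)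

      hit₂ : ∀ u v w → hit u v + hit u w ≤ defined u + ⟦ v ≟ w ⟧
      hit₂ nothing v w = z≤n
      hit₂ (just u) v w with v ≟ u | w ≟ u | v ≟ w
      ... | yes _    | yes _    | yes _ = ≤-refl
      ... | yes refl | yes refl | no ¬p = contradiction refl ¬p
      ... | yes _    | no _     | _     = s≤s z≤n
      ... | no _     | yes _    | _     = s≤s z≤n
      ... | no _     | no _     | _     = z≤n

      -- Inclusion-exclusion inside the domain of `F`: a point where both functions agree with `F`
      -- is a collision.
      agreement-pair : ∀ L M → agreement F L + agreement F M ≤ domain F + collisions L M
      agreement-pair L M = begin
        agreement F L + agreement F M              ≡⟨ ∑-+ (cube n) _ _ ⟨
        ∑ (cube n) (λ x → hit (F x) (evalP Z L x) + hit (F x) (evalP Z M x))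
          ≤⟨ ∑-mono (cube n) (λ x → hit₂ (F x) (evalP Z L x) (evalP Z M x)) ⟩
        ∑ (cube n) (λ x → defined (F x) + ⟦ evalP Z L x ≟ evalP Z M x ⟧)
          ≡⟨ ∑-+ (cube n) _ _ ⟩
        domain F + collisions L M                  ∎
        where open ≤-Reasoning

      -- On the left 2ⁿ is subtracted twice, on the right once. The difference is absorbed by the
      -- collisions, which fill at most half of the cube.
      adv-pair : ∀ L M → L ≢ M → adv L + adv M ≤ domain-adv
      adv-pair L M ne = excess-pair (2 ^ n) (2 * agreement F L) (2 * agreement F M) (2 * domain F)
          (*-monoʳ-≤ 2 (agreement≤domain L)) (*-monoʳ-≤ 2 (agreement≤domain M)) (begin
        2 * agreement F L + 2 * agreement F M      ≡⟨ *-distribˡ-+ 2 (agreement F L) (agreement F M) ⟨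
        2 * (agreement F L + agreement F M)        ≤⟨ *-monoʳ-≤ 2 (agreement-pair L M) ⟩
        2 * (domain F + collisions L M)            ≡⟨ *-distribˡ-+ 2 (domain F) (collisions L M) ⟩
        2 * domain F + 2 * collisions L M          ≤⟨ +-monoʳ-≤ (2 * domain F) (2*collisions≤W L M ne) ⟩
        2 * domain F + 2 ^ n                       ∎)
        where
        open ≤-Reasoning
        excess-pair : ∀ w a b d → a ≤ d → b ≤ d → a + b ≤ d + w → (a ∸ w) + (b ∸ w) ≤ d ∸ w
        excess-pair w a b d a≤d b≤d h with ≤-total a w | ≤-total b w
        -- If one excess is truncated to zero, the collision bound says nothing; the other excess is
        -- then compared with that of the domain directly.
        ... | inj₁ p | _ = ≤-trans (≤-reflexive (cong (_+ (b ∸ w)) (m≤n⇒m∸n≡0 p))) (∸-monoˡ-≤ w b≤d)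
        ... | inj₂ _ | inj₁ p = ≤-trans (≤-reflexive (trans (cong ((a ∸ w) +_) (m≤n⇒m∸n≡0 p)) (+-identityʳ _))) (∸-monoˡ-≤ w a≤d)
        ... | inj₂ p | inj₂ q = m+n≤o⇒m≤o∸n ((a ∸ w) + (b ∸ w)) (+-cancelʳ-≤ w _ d (≤-trans (≤-reflexive eq) h))
          where eq : (a ∸ w) + (b ∸ w) + w + w ≡ a + b
                eq = trans (lem (a ∸ w) (b ∸ w) w) (cong₂ _+_ (m∸n+n≡m p) (m∸n+n≡m q))
                  where lem : ∀ p q w → p + q + w + w ≡ (p + w) + (q + w)
                        lem = solve-∀

  -- Tail bounds: small and large domains

  module Bounds (Z : FinAbGroup) where
    open Linear Z

    TailBound : ℕ → Set
    TailBound M = ∀ {n} (F : PartialFun n) Ls → Unique Ls → ∀ t → 1 ≤ t →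
      (∀ {L} → L ∈ Ls → 2 ^ n + t ≤ 2 * agreement F L) → length Ls * t ^ 8 ≤ M * domain-adv F ^ 8

    -- The exponent consists of 8 from the tail bound, 1 for summation by layers, and `suc e` to
    -- beat the constant.
    adv-power-sum : ∀ {M} e → TailBound M → 9 * M ≤ 2 ^ e → ∀ {n} (F : PartialFun n) Ls → Unique Ls →
      ∑ Ls (λ L → adv F L ^ (9 + suc e)) ≤ domain-adv F ^ (9 + suc e)
    adv-power-sum {M} e tail M≤ {n} F Ls uniq =
        power-sum≤ Ls (adv F) (domain-adv F) 8 M e M≤ (λ {L} _ → adv≤domain-adv F L)
          (AllPairs.map (λ {L} {L′} → adv-pair F L L′) uniq)
          (λ t 1≤t → tail F (filter (λ L → t ≤? adv F L) Ls) (AllPairsₚ.filter⁺ (λ L → t ≤? adv F L) uniq) t 1≤t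
            (λ {L} L∈ → adv≥⇒ F {L} 1≤t (proj₂ (∈-filter⁻ (λ L → t ≤? adv F L) {xs = Ls} L∈))))

    triple : ∀ {n} (L₁ L₂ L₃ : Lin Z n) → ℕ
    triple {n} L₁ L₂ L₃ = ∑ (cube n) (λ x → ⟦ evalP Z L₁ x ≟ evalP Z L₂ x ⟧ * ⟦ evalP Z L₁ x ≟ evalP Z L₃ x ⟧)

    -- A third hit at the same point forces all three values to coincide, and the product of
    -- indicators pays for it.
    hit₃ : ∀ u v₁ v₂ v₃ → hit u v₁ + hit u v₂ + hit u v₃ ≤ 2 * defined u + ⟦ v₁ ≟ v₂ ⟧ * ⟦ v₁ ≟ v₃ ⟧
    hit₃ nothing v₁ v₂ v₃ = z≤n
    hit₃ (just u) v₁ v₂ v₃ with v₁ ≟ u | v₂ ≟ u | v₃ ≟ u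
    ... | no _ | b | c = ≤-trans (+-mono-≤ (⟦⟧≤1 b) (⟦⟧≤1 c)) (m≤m+n 2 _)
    ... | yes _ | no _ | c = ≤-trans (s≤s (⟦⟧≤1 c)) (m≤m+n 2 _)
    ... | yes _ | yes _ | no _ = m≤m+n 2 _
    ... | yes refl | yes refl | yes refl with u ≟ u
    ...   | yes _ = ≤-refl
    ...   | no ¬p = contradiction refl ¬p

    -- The three agreements add up to more than 3W/2, while two hits per point of the domain account
    -- for at most 2 · `domain F` ≤ W + W/6. More than W/3 is left for simultaneous coincidences.
    -- The factor 6 is what makes this threshold 1/3, the largest triple probability in general
    -- position for q = 3.
    W<3*triple : ∀ {n} (F : PartialFun n) → 6 * domain-adv F ≤ 2 ^ n → ∀ L₁ L₂ L₃ →
      2 ^ n < 2 * agreement F L₁ → 2 ^ n < 2 * agreement F L₂ → 2 ^ n < 2 * agreement F L₃ →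
      2 ^ n < 3 * triple L₁ L₂ L₃
    W<3*triple {n} F small L₁ L₂ L₃ h₁ h₂ h₃ = *-cancelˡ-< 2 _ _ (+-cancelʳ-< (7 * w) _ _ (begin-strict
        2 * w + 7 * w                       ≡⟨ lem₁ w ⟩
        3 * (w + w + w)                     <⟨ *-monoʳ-< 3 (+-mono-< (+-mono-< h₁ h₂) h₃) ⟩
        3 * (2 * a₁ + 2 * a₂ + 2 * a₃)      ≡⟨ lem₂ a₁ a₂ a₃ ⟩
        6 * (a₁ + a₂ + a₃)                  ≤⟨ *-monoʳ-≤ 6 sum₃ ⟩
        6 * (2 * D + p)                     ≡⟨ lem₃ D p ⟩
        6 * (2 * D) + 6 * p                 ≤⟨ +-monoˡ-≤ (6 * p) (*-monoʳ-≤ 6 (m≤n+m∸n (2 * D) w)) ⟩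
        6 * (w + b) + 6 * p                 ≡⟨ lem₄ w b p ⟩
        6 * b + (6 * w + 6 * p)             ≤⟨ +-monoˡ-≤ (6 * w + 6 * p) small ⟩
        w + (6 * w + 6 * p)                 ≡⟨ lem₅ w p ⟩
        2 * (3 * p) + 7 * w                 ∎))
      where
      open ≤-Reasoning
      w = 2 ^ n
      a₁ = agreement F L₁
      a₂ = agreement F L₂
      a₃ = agreement F L₃
      D = domain F
      b = domain-adv F
      p = triple L₁ L₂ L₃
      lem₁ : ∀ w → 2 * w + 7 * w ≡ 3 * (w + w + w)
      lem₁ = solve-∀
      lem₂ : ∀ a₁ a₂ a₃ → 3 * (2 * a₁ + 2 * a₂ + 2 * a₃) ≡ 6 * (a₁ + a₂ + a₃)
      lem₂ = solve-∀
      lem₃ : ∀ D p → 6 * (2 * D + p) ≡ 6 * (2 * D) + 6 * p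
      lem₃ = solve-∀
      lem₄ : ∀ w b p → 6 * (w + b) + 6 * p ≡ 6 * b + (6 * w + 6 * p)
      lem₄ = solve-∀
      lem₅ : ∀ w p → w + (6 * w + 6 * p) ≡ 2 * (3 * p) + 7 * w
      lem₅ = solve-∀
      sum₃ : a₁ + a₂ + a₃ ≤ 2 * D + p
      sum₃ = begin
        a₁ + a₂ + a₃
          ≡⟨ cong (_+ a₃) (∑-+ (cube n) _ _) ⟨
        ∑ (cube n) (λ x → hit (F x) (evalP Z L₁ x) + hit (F x) (evalP Z L₂ x)) + a₃
          ≡⟨ ∑-+ (cube n) _ _ ⟨
        ∑ (cube n) (λ x → hit (F x) (evalP Z L₁ x) + hit (F x) (evalP Z L₂ x) + hit (F x) (evalP Z L₃ x))
          ≤⟨ ∑-mono (cube n) (λ x → hit₃ (F x) (evalP Z L₁ x) (evalP Z L₂ x) (evalP Z L₃ x)) ⟩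
        ∑ (cube n) (λ x → 2 * defined (F x) + ⟦ evalP Z L₁ x ≟ evalP Z L₂ x ⟧ * ⟦ evalP Z L₁ x ≟ evalP Z L₃ x ⟧)
          ≡⟨ ∑-+ (cube n) _ _ ⟩
        ∑ (cube n) (λ x → 2 * defined (F x)) + p
          ≡⟨ cong (_+ p) (∑-*ˡ (cube n) 2 (λ x → defined (F x))) ⟩
        2 * D + p ∎

    SmallDomainBound : Set
    SmallDomainBound = ∀ {n} (F : PartialFun n) Ls → Unique Ls → 6 * domain-adv F ≤ 2 ^ n →
      (∀ {L} → L ∈ Ls → 2 ^ n < 2 * agreement F L) → length Ls ≤ 3

    CoarseBound : ℕ → Set
    CoarseBound M = ∀ {n} (F : PartialFun n) Ls → Unique Ls → ∀ t → 1 ≤ t →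
      (∀ {L} → L ∈ Ls → 2 ^ n + t ≤ 2 * agreement F L) → length Ls * t ^ 8 ≤ M * (2 ^ n) ^ 8

    -- When 6b > W, replacing W by 6b costs 6⁸. When 6b ≤ W there are at most three functions, and t
    -- ≤ b because t is at most the advantage of any of them.
    tail-bound : ∀ M → SmallDomainBound → CoarseBound M → TailBound (3 + M * 6 ^ 8)
    tail-bound M small coarse F [] uniq t 1≤t h = z≤n
    tail-bound M small coarse {n} F Ls@(L ∷ _) uniq t 1≤t h with 6 * domain-adv F ≤? 2 ^ n
    ... | yes p = ≤-trans (*-mono-≤ (small F Ls uniq p (λ L∈ → <-≤-trans (m<m+n (2 ^ n) 1≤t) (h L∈)))
                                    (^-monoˡ-≤ 8 (≤-trans (⇒adv≥ F {L} (h (here refl))) (adv≤domain-adv F L))))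
                          (*-monoˡ-≤ (domain-adv F ^ 8) (m≤m+n 3 (M * 6 ^ 8)))
    ... | no ¬p = begin
        length Ls * t ^ 8                        ≤⟨ coarse F Ls uniq t 1≤t h ⟩
        M * (2 ^ n) ^ 8                          ≤⟨ *-monoʳ-≤ M (^-monoˡ-≤ 8 (<⇒≤ (≰⇒> ¬p))) ⟩
        M * (6 * b) ^ 8                          ≡⟨ cong (M *_) (^-distribʳ-* 6 b 8) ⟩
        M * (6 ^ 8 * b ^ 8)                      ≡⟨ *-assoc M (6 ^ 8) (b ^ 8) ⟨
        M * 6 ^ 8 * b ^ 8                        ≤⟨ *-monoˡ-≤ (b ^ 8) (m≤n+m (M * 6 ^ 8) 3) ⟩
        (3 + M * 6 ^ 8) * b ^ 8                  ∎
      where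
      open ≤-Reasoning
      b = domain-adv F

    agreement≤W : ∀ {n} (F : PartialFun n) L → agreement F L ≤ 2 ^ n
    agreement≤W F L = ≤-trans (agreement≤domain F L) (domain≤W F)

    t≤W : ∀ {n} (F : PartialFun n) L {t} → 2 ^ n + t ≤ 2 * agreement F L → t ≤ 2 ^ n
    t≤W {n} F L {t} h = +-cancelˡ-≤ (2 ^ n) t (2 ^ n) (≤-trans h (≤-trans (*-monoʳ-≤ 2 (agreement≤W F L))
      (≤-reflexive (cong (2 ^ n +_) (+-identityʳ (2 ^ n))))))

    count : ∀ {n} → List (Lin Z n) → Carrier Z → Vec Bool n → ℕ
    count Ls v x = ∑ Ls (λ L → ⟦ evalP Z L x ≟ v ⟧)

    ∑-collisions : ∀ {n} (Ls : List (Lin Z n)) →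
      ∑ Ls (λ L → ∑ Ls (collisions L)) ≡ ∑ (cube n) (λ x → ∑ Ls (λ L → ∑ Ls (λ M → ⟦ evalP Z L x ≟ evalP Z M x ⟧)))
    ∑-collisions {n} Ls = trans (∑-cong Ls (λ L → sym (∑-swap (cube n) Ls (λ x M → ⟦ evalP Z L x ≟ evalP Z M x ⟧))))
      (sym (∑-swap (cube n) Ls (λ x L → ∑ Ls (λ M → ⟦ evalP Z L x ≟ evalP Z M x ⟧))))

    ∑-agreement : ∀ {n} (F : PartialFun n) (Ls : List (Lin Z n)) →
      ∑ Ls (agreement F) ≡ ∑ (cube n) (λ x → ∑ Ls (λ L → hit (F x) (evalP Z L x)))
    ∑-agreement {n} F Ls = sym (∑-swap (cube n) Ls (λ x L → hit (F x) (evalP Z L x)))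

    ∑-hit-nothing : ∀ {n} (Ls : List (Lin Z n)) x → ∑ Ls (λ L → hit nothing (evalP Z L x)) ≡ 0
    ∑-hit-nothing Ls x = trans (∑-const Ls 0) (*-zeroʳ (length Ls))

    ∑-agreement≥ : ∀ {n} (F : PartialFun n) Ls t → (∀ {L} → L ∈ Ls → 2 ^ n + t ≤ 2 * agreement F L) →
      length Ls * (2 ^ n + t) ≤ 2 * ∑ Ls (agreement F)
    ∑-agreement≥ {n} F Ls t h = ≤-trans (≤-reflexive (sym (∑-const Ls (2 ^ n + t))))
      (≤-trans (∑-mono-∈ Ls h) (≤-reflexive (∑-*ˡ Ls 2 (agreement F))))

    module Values (vs : List (Carrier Z))
                  (separates : ∀ a b → ⟦ a ≟ b ⟧ ≡ ∑ vs (λ v → ⟦ a ≟ v ⟧ * ⟦ b ≟ v ⟧))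
                  (exhausts : ∀ a → ∑ vs (λ v → ⟦ a ≟ v ⟧) ≡ 1) where

      -- Pairs colliding at `x` are sorted by their common value, which turns collisions into a
      -- second moment of the value counts.
      ∑-count² : ∀ {n} (Ls : List (Lin Z n)) x →
        ∑ Ls (λ L → ∑ Ls (λ M → ⟦ evalP Z L x ≟ evalP Z M x ⟧)) ≡ ∑ vs (λ v → count Ls v x * count Ls v x)
      ∑-count² Ls x = begin
        ∑ Ls (λ L → ∑ Ls (λ M → ⟦ ev L ≟ ev M ⟧))
          ≡⟨ ∑-cong Ls (λ L → trans (∑-cong Ls (λ M → separates (ev L) (ev M)))
               (∑-swap Ls vs (λ M v → ⟦ ev L ≟ v ⟧ * ⟦ ev M ≟ v ⟧))) ⟩
        ∑ Ls (λ L → ∑ vs (λ v → ∑ Ls (λ M → ⟦ ev L ≟ v ⟧ * ⟦ ev M ≟ v ⟧)))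
          ≡⟨ ∑-swap Ls vs (λ L v → ∑ Ls (λ M → ⟦ ev L ≟ v ⟧ * ⟦ ev M ≟ v ⟧)) ⟩
        ∑ vs (λ v → ∑ Ls (λ L → ∑ Ls (λ M → ⟦ ev L ≟ v ⟧ * ⟦ ev M ≟ v ⟧)))
          ≡⟨ ∑-cong vs (λ v → ∑-square Ls (λ L → ⟦ ev L ≟ v ⟧)) ⟨
        ∑ vs (λ v → count Ls v x * count Ls v x) ∎
        where
        open ≡-Reasoning
        ev : Lin Z _ → Carrier Z
        ev L = evalP Z L x

      ∑-count : ∀ {n} (Ls : List (Lin Z n)) x → ∑ vs (λ v → count Ls v x) ≡ length Ls
      ∑-count Ls x = trans (∑-swap vs Ls (λ v L → ⟦ evalP Z L x ≟ v ⟧))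
        (trans (∑-cong Ls (λ L → exhausts (evalP Z L x))) (sym (length-as-∑ Ls)))

  distinct-triple : {A : Set} {x y z : A} {l : List A} → Unique (x ∷ y ∷ z ∷ l) → x ≢ y × x ≢ z × y ≢ z
  distinct-triple ((xy ∷ xz ∷ _) ∷ (yz ∷ _) ∷ _) = xy , xz , yz

  cancel-length : ∀ N {a b} → N * (N * a) ≤ N * b → N * a ≤ b
  cancel-length zero    h = z≤n
  cancel-length (suc N) h = *-cancelˡ-≤ (suc N) h

  -- A quadratic bound is stronger than one of degree 8: as t ≤ w, the six further factors t are at
  -- most w.
  ^8-from-² : ∀ N t w M → t ≤ w → N * (t * t) ≤ M * (w * w) → N * t ^ 8 ≤ M * w ^ 8
  ^8-from-² N t w M t≤w h = begin
      N * t ^ 8                 ≡⟨ lem N t ⟩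
      N * (t * t) * t ^ 6       ≤⟨ *-mono-≤ h (^-monoˡ-≤ 6 t≤w) ⟩
      M * (w * w) * w ^ 6       ≡⟨ lem M w ⟨
      M * w ^ 8                 ∎
    where
    open ≤-Reasoning
    lem : ∀ N t → N * t ^ 8 ≡ N * (t * t) * t ^ 6
    lem N t = trans (cong (N *_) (^-distribˡ-+-* t 2 6)) (trans (sym (*-assoc N (t ^ 2) (t ^ 6))) (cong (λ z → N * (t * z) * t ^ 6) (*-identityʳ t)))

  -- The case q = 2

  module Two where

    _+₂_ : Fin 2 → Fin 2 → Fin 2
    zero     +₂ b        = b
    suc zero +₂ zero     = suc zero
    suc zero +₂ suc zero = zero

    ℤ₂ : FinAbGroup
    ℤ₂ = record
      { m = 2 ; _+_ = _+₂_ ; 0g = zero ; neg = λ a → a ; _≟_ = Finₚ._≟_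
      ; isAbelianGroup = record
        { isGroup = record
          { isMonoid = record
            { isSemigroup = record
              { isMagma = isMagma _+₂_
              ; assoc = from-yes (Finₚ.all? λ a → Finₚ.all? λ b → Finₚ.all? λ c → (a +₂ b) +₂ c Finₚ.≟ a +₂ (b +₂ c)) }
            ; identity = (λ _ → refl) , from-yes (Finₚ.all? λ a → a +₂ zero Finₚ.≟ a) }
          ; inverse = from-yes (Finₚ.all? λ a → a +₂ a Finₚ.≟ zero) , from-yes (Finₚ.all? λ a → a +₂ a Finₚ.≟ zero)
          ; ⁻¹-cong = cong (λ a → a) }
        ; comm = from-yes (Finₚ.all? λ a → Finₚ.all? λ b → a +₂ b Finₚ.≟ b +₂ a) } }
      where open import Relation.Binary.PropositionalEquality.Algebra using (isMagma)

    open Linear ℤ₂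
    open Bounds ℤ₂

    -- Three bits have either exactly one equal pair or three, so both sides are in fact equal.
    pigeonhole₂ : ∀ (u v w : Fin 2) → 1 + 2 * (⟦ u ≟ v ⟧ * ⟦ u ≟ w ⟧) ≤ ⟦ u ≟ v ⟧ + ⟦ u ≟ w ⟧ + ⟦ v ≟ w ⟧
    pigeonhole₂ = from-yes (Finₚ.all? λ u → Finₚ.all? λ v → Finₚ.all? λ w →
      1 + 2 * (⟦ u ≟ v ⟧ * ⟦ u ≟ w ⟧) ≤? ⟦ u ≟ v ⟧ + ⟦ u ≟ w ⟧ + ⟦ v ≟ w ⟧)

    -- The three pairs collide on at most 3W/2 in total, and the pigeonhole principle uses up W of
    -- this, leaving 2p ≤ W/2. The resulting 1/4 lies below the threshold 1/3 of `W<3*triple`.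
    4*triple≤W : ∀ {n} (L₁ L₂ L₃ : Lin ℤ₂ n) → L₁ ≢ L₂ → L₁ ≢ L₃ → L₂ ≢ L₃ → 4 * triple L₁ L₂ L₃ ≤ 2 ^ n
    4*triple≤W {n} L₁ L₂ L₃ ne₁₂ ne₁₃ ne₂₃ = +-cancelˡ-≤ (2 * w) _ _ (begin
        2 * w + 4 * p                        ≡⟨ lem₁ w p ⟩
        2 * (w * 1 + 2 * p)                  ≡⟨ cong (2 *_) (cong₂ _+_ (∑-cube-const n 1) (∑-*ˡ (cube n) 2 _)) ⟨
        2 * (∑ (cube n) (λ _ → 1) + ∑ (cube n) (λ x → 2 * (⟦ ev L₁ x ≟ ev L₂ x ⟧ * ⟦ ev L₁ x ≟ ev L₃ x ⟧)))
                                             ≡⟨ cong (2 *_) (∑-+ (cube n) _ _) ⟨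
        2 * ∑ (cube n) (λ x → 1 + 2 * (⟦ ev L₁ x ≟ ev L₂ x ⟧ * ⟦ ev L₁ x ≟ ev L₃ x ⟧))
                                             ≤⟨ *-monoʳ-≤ 2 (∑-mono (cube n) (λ x → pigeonhole₂ (ev L₁ x) (ev L₂ x) (ev L₃ x))) ⟩
        2 * ∑ (cube n) (λ x → ⟦ ev L₁ x ≟ ev L₂ x ⟧ + ⟦ ev L₁ x ≟ ev L₃ x ⟧ + ⟦ ev L₂ x ≟ ev L₃ x ⟧)
                                             ≡⟨ cong (2 *_) (trans (∑-+ (cube n) _ _) (cong (_+ collisions L₂ L₃) (∑-+ (cube n) _ _))) ⟩
        2 * (collisions L₁ L₂ + collisions L₁ L₃ + collisions L₂ L₃)
                                             ≡⟨ lem₂ (collisions L₁ L₂) (collisions L₁ L₃) (collisions L₂ L₃) ⟩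
        2 * collisions L₁ L₂ + 2 * collisions L₁ L₃ + 2 * collisions L₂ L₃
                                             ≤⟨ +-mono-≤ (+-mono-≤ (2*collisions≤W L₁ L₂ ne₁₂) (2*collisions≤W L₁ L₃ ne₁₃)) (2*collisions≤W L₂ L₃ ne₂₃) ⟩
        w + w + w                            ≡⟨ lem₃ w ⟩
        2 * w + w                            ∎)
      where
      open ≤-Reasoning
      w = 2 ^ n
      p = triple L₁ L₂ L₃
      ev = evalP ℤ₂ {n}
      lem₁ : ∀ w p → 2 * w + 4 * p ≡ 2 * (w * 1 + 2 * p)
      lem₁ = solve-∀
      lem₂ : ∀ a b c → 2 * (a + b + c) ≡ 2 * a + 2 * b + 2 * c
      lem₂ = solve-∀
      lem₃ : ∀ w → w + w + w ≡ 2 * w + w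
      lem₃ = solve-∀

    small-domain : SmallDomainBound
    small-domain F [] uniq small h = z≤n
    small-domain F (_ ∷ []) uniq small h = s≤s z≤n
    small-domain F (_ ∷ _ ∷ []) uniq small h = s≤s (s≤s z≤n)
    small-domain {n} F (L₁ ∷ L₂ ∷ L₃ ∷ Ls) uniq small h with distinct-triple uniq
    ... | ne₁₂ , ne₁₃ , ne₂₃ = contradiction
      (<-≤-trans (W<3*triple F small L₁ L₂ L₃ (h (here refl)) (h (there (here refl))) (h (there (there (here refl)))))
        (≤-trans (*-monoˡ-≤ (triple L₁ L₂ L₃) (n≤1+n 3)) (4*triple≤W L₁ L₂ L₃ ne₁₂ ne₁₃ ne₂₃))) (<-irrefl refl)

    values : List (Fin 2)
    values = zero ∷ suc zero ∷ []

    open Values values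
      (from-yes (Finₚ.all? λ a → Finₚ.all? λ b → ⟦ a ≟ b ⟧ Data.Nat.≟ ∑ values (λ v → ⟦ a ≟ v ⟧ * ⟦ b ≟ v ⟧)))
      (from-yes (Finₚ.all? λ a → ∑ values (λ v → ⟦ a ≟ v ⟧) Data.Nat.≟ 1))

    -- Second moment: X = |N₀ - N₁| satisfies 2(N₀² + N₁²) = N² + X², and the left side counts collisions.
    coarse² : ∀ {n} (F : PartialFun n) Ls → Unique Ls → ∀ t →
      (∀ {L} → L ∈ Ls → 2 ^ n + t ≤ 2 * agreement F L) → length Ls * (t * t) ≤ 2 * (2 ^ n * 2 ^ n)
    coarse² {n} F Ls uniq t h = cancel-length N (begin
        N * (N * (t * t))                    ≡⟨ lem₁ N t ⟩
        (N * t) * (N * t)                    ≤⟨ *-mono-≤ Nt≤ Nt≤ ⟩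
        ∑ (cube n) X * ∑ (cube n) X          ≤⟨ cauchy-schwarz (cube n) X ⟩
        length (cube n) * ∑ (cube n) (λ x → X x * X x)
                                             ≤⟨ *-mono-≤ (≤-reflexive (length-cube n)) ∑X²≤ ⟩
        w * (N * (2 * w))                    ≡⟨ lem₂ w N ⟩
        N * (2 * (w * w))                    ∎)
      where
      open ≤-Reasoning
      N = length Ls
      w = 2 ^ n
      n₀ n₁ X : Vec Bool n → ℕ
      n₀ x = count Ls zero x
      n₁ x = count Ls (suc zero) x
      X x = ∣ n₀ x - n₁ x ∣
      lem₁ : ∀ N t → N * (N * (t * t)) ≡ (N * t) * (N * t)
      lem₁ = solve-∀
      lem₂ : ∀ w N → w * (N * (2 * w)) ≡ N * (2 * (w * w))
      lem₂ = solve-∀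
      total : ∀ x → n₀ x + n₁ x ≡ N
      total x = trans (cong (n₀ x +_) (sym (+-identityʳ (n₁ x)))) (∑-count Ls x)
      diff : ∀ a b → 2 * (a * a + b * b) ≡ (a + b) * (a + b) + ∣ a - b ∣ * ∣ a - b ∣
      diff a b with ≤-total a b
      ... | inj₁ a≤b with m≤n⇒∃[o]m+o≡n a≤b
      ...   | k , refl rewrite ∣m-m+n∣≡n a k = lem a k
        where lem : ∀ a k → 2 * (a * a + (a + k) * (a + k)) ≡ (a + (a + k)) * (a + (a + k)) + k * k
              lem = solve-∀
      diff a b | inj₂ b≤a with m≤n⇒∃[o]m+o≡n b≤a
      ...   | k , refl rewrite ∣-∣-comm (b + k) b | ∣m-m+n∣≡n b k = lem b k
        where lem : ∀ b k → 2 * ((b + k) * (b + k) + b * b) ≡ ((b + k) + b) * ((b + k) + b) + k * k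
              lem = solve-∀
      2a≤ : ∀ a b → 2 * a ≤ (a + b) + ∣ a - b ∣
      2a≤ a b = ≤-trans (≤-reflexive (cong (a +_) (+-identityʳ a)))
        (≤-trans (+-monoʳ-≤ a (m≤n+∣m-n∣ a b)) (≤-reflexive (sym (+-assoc a b _))))
      pointwise : ∀ x u → 2 * ∑ Ls (λ L → hit u (evalP ℤ₂ L x)) ≤ N + X x
      pointwise x nothing = ≤-trans (≤-reflexive (cong (2 *_) (∑-hit-nothing Ls x))) z≤n
      pointwise x (just zero) = ≤-trans (2a≤ (n₀ x) (n₁ x)) (≤-reflexive (cong (_+ X x) (total x)))
      pointwise x (just (suc zero)) = ≤-trans (2a≤ (n₁ x) (n₀ x))
        (≤-reflexive (cong₂ _+_ (trans (+-comm (n₁ x) (n₀ x)) (total x)) (∣-∣-comm (n₁ x) (n₀ x))))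
      Nt≤ : N * t ≤ ∑ (cube n) X
      Nt≤ = +-cancelˡ-≤ (w * N) _ _ (begin
        w * N + N * t                        ≡⟨ lem w N t ⟩
        N * (w + t)                          ≤⟨ ∑-agreement≥ F Ls t h ⟩
        2 * ∑ Ls (agreement F)               ≡⟨ cong (2 *_) (∑-agreement F Ls) ⟩
        2 * ∑ (cube n) (λ x → ∑ Ls (λ L → hit (F x) (evalP ℤ₂ L x)))
                                             ≡⟨ ∑-*ˡ (cube n) 2 _ ⟨
        ∑ (cube n) (λ x → 2 * ∑ Ls (λ L → hit (F x) (evalP ℤ₂ L x)))
                                             ≤⟨ ∑-mono (cube n) (λ x → pointwise x (F x)) ⟩
        ∑ (cube n) (λ x → N + X x)           ≡⟨ ∑-+ (cube n) _ _ ⟩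
        ∑ (cube n) (λ _ → N) + ∑ (cube n) X  ≡⟨ cong (_+ ∑ (cube n) X) (∑-cube-const n N) ⟩
        w * N + ∑ (cube n) X                 ∎)
        where lem : ∀ w N t → w * N + N * t ≡ N * (w + t)
              lem = solve-∀
      ∑X²≤ : ∑ (cube n) (λ x → X x * X x) ≤ N * (2 * w)
      ∑X²≤ = +-cancelˡ-≤ (w * (N * N)) _ _ (begin
        w * (N * N) + ∑ (cube n) (λ x → X x * X x)
          ≡⟨ cong (_+ ∑ (cube n) (λ x → X x * X x)) (∑-cube-const n (N * N)) ⟨
        ∑ (cube n) (λ _ → N * N) + ∑ (cube n) (λ x → X x * X x)
          ≡⟨ ∑-+ (cube n) _ _ ⟨
        ∑ (cube n) (λ x → N * N + X x * X x)
          ≡⟨ ∑-cong (cube n) (λ x → trans (cong (λ z → z * z + X x * X x) (sym (total x)))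
               (trans (sym (diff (n₀ x) (n₁ x)))
                 (cong (2 *_) (trans (cong (n₀ x * n₀ x +_) (sym (+-identityʳ (n₁ x * n₁ x)))) (sym (∑-count² Ls x)))))) ⟩
        ∑ (cube n) (λ x → 2 * ∑ Ls (λ L → ∑ Ls (λ M → ⟦ evalP ℤ₂ L x ≟ evalP ℤ₂ M x ⟧)))
          ≡⟨ trans (∑-*ˡ (cube n) 2 _) (cong (2 *_) (sym (∑-collisions Ls))) ⟩
        2 * ∑ Ls (λ L → ∑ Ls (collisions L))
          ≤⟨ ∑∑-scaled Ls collisions 2 w w collisions-self
               (AllPairs.map (λ {L} {M} ne → 2*collisions≤W L M ne , 2*collisions≤W M L (ne ∘ sym)) uniq) ⟩
        N * (2 * w) + N * (N * w)
          ≡⟨ lem N w ⟩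
        w * (N * N) + N * (2 * w) ∎)
        where lem : ∀ N w → N * (2 * w) + N * (N * w) ≡ w * (N * N) + N * (2 * w)
              lem = solve-∀

    coarse : CoarseBound 2
    coarse F [] uniq t 1≤t h = z≤n
    coarse {n} F Ls@(L ∷ _) uniq t 1≤t h = ^8-from-² (length Ls) t (2 ^ n) 2 (t≤W F L (h (here refl))) (coarse² F Ls uniq t h)

  -- The case q = 3: small domains

  module Three where

    _+₃_ : Fin 3 → Fin 3 → Fin 3
    zero           +₃ b              = b
    suc zero       +₃ zero           = suc zero
    suc zero       +₃ suc zero       = suc (suc zero)
    suc zero       +₃ suc (suc zero) = zero
    suc (suc zero) +₃ zero           = suc (suc zero)
    suc (suc zero) +₃ suc b          = Data.Fin.inject₁ b

    -₃_ : Fin 3 → Fin 3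
    -₃ a = a +₃ a

    ℤ₃ : FinAbGroup
    ℤ₃ = record
      { m = 3 ; _+_ = _+₃_ ; 0g = zero ; neg = -₃_ ; _≟_ = Finₚ._≟_
      ; isAbelianGroup = record
        { isGroup = record
          { isMonoid = record
            { isSemigroup = record
              { isMagma = isMagma _+₃_
              ; assoc = from-yes (Finₚ.all? λ a → Finₚ.all? λ b → Finₚ.all? λ c → (a +₃ b) +₃ c Finₚ.≟ a +₃ (b +₃ c)) }
            ; identity = (λ _ → refl) , from-yes (Finₚ.all? λ a → a +₃ zero Finₚ.≟ a) }
          ; inverse = from-yes (Finₚ.all? λ a → (-₃ a) +₃ a Finₚ.≟ zero) , from-yes (Finₚ.all? λ a → a +₃ (-₃ a) Finₚ.≟ zero)
          ; ⁻¹-cong = cong -₃_ }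
        ; comm = from-yes (Finₚ.all? λ a → Finₚ.all? λ b → a +₃ b Finₚ.≟ b +₃ a) } }
      where open import Relation.Binary.PropositionalEquality.Algebra using (isMagma)

    open Linear ℤ₃
    open Bounds ℤ₃

    -- Of the four lines through the origin of 𝔽₃², one contains a given nonzero vector and all contain 0.
    lines₃ : ∀ (u v w : Fin 3) → 1 + 3 * (⟦ u ≟ v ⟧ * ⟦ u ≟ w ⟧) ≤ ⟦ u ≟ v ⟧ + ⟦ u ≟ w ⟧ + ⟦ v ≟ w ⟧ + ⟦ w ≟ (zero ⊝ u) ⊝ v ⟧
    lines₃ = from-yes (Finₚ.all? λ u → Finₚ.all? λ v → Finₚ.all? λ w →
      1 + 3 * (⟦ u ≟ v ⟧ * ⟦ u ≟ w ⟧) ≤? ⟦ u ≟ v ⟧ + ⟦ u ≟ w ⟧ + ⟦ v ≟ w ⟧ + ⟦ w ≟ (zero ⊝ u) ⊝ v ⟧)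

    -- The third point of the affine line over 𝔽₃ through the two functions: three elements of ℤ/3
    -- sum to zero exactly when they are all equal or all distinct.
    third : ∀ {n} (L₁ L₂ : Lin ℤ₃ n) → Lin ℤ₃ n
    third L₁ L₂ = (0ᴸ -ᴸ L₁) -ᴸ L₂

    evalP-third : ∀ {n} (L₁ L₂ : Lin ℤ₃ n) x → evalP ℤ₃ (third L₁ L₂) x ≡ (zero ⊝ evalP ℤ₃ L₁ x) ⊝ evalP ℤ₃ L₂ x
    evalP-third L₁ L₂ x = trans (evalP-⊝ (0ᴸ -ᴸ L₁) L₂ x)
      (cong (_⊝ evalP ℤ₃ L₂ x) (trans (evalP-⊝ 0ᴸ L₁ x) (cong (_⊝ evalP ℤ₃ L₁ x) (evalLin-0ᵛ zero x))))

    -- The three pairwise collisions do not suffice, because three values may all differ; the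
    -- collision of `L₃` with `third L₁ L₂` catches that case. Four events of probability at most
    -- 1/2 then give 1 + 3p ≤ 2.
    3*triple≤W : ∀ {n} (L₁ L₂ L₃ : Lin ℤ₃ n) → L₁ ≢ L₂ → L₁ ≢ L₃ → L₂ ≢ L₃ → L₃ ≢ third L₁ L₂ → 3 * triple L₁ L₂ L₃ ≤ 2 ^ n
    3*triple≤W {n} L₁ L₂ L₃ ne₁₂ ne₁₃ ne₂₃ ne = *-cancelˡ-≤ 2 (+-cancelˡ-≤ (2 * w) _ _ (begin
        2 * w + 2 * (3 * p)                  ≡⟨ lem₁ w p ⟩
        2 * (w * 1 + 3 * p)                  ≡⟨ cong (2 *_) (cong₂ _+_ (∑-cube-const n 1) (∑-*ˡ (cube n) 3 _)) ⟨
        2 * (∑ (cube n) (λ _ → 1) + ∑ (cube n) (λ x → 3 * (⟦ ev L₁ x ≟ ev L₂ x ⟧ * ⟦ ev L₁ x ≟ ev L₃ x ⟧)))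
                                             ≡⟨ cong (2 *_) (∑-+ (cube n) _ _) ⟨
        2 * ∑ (cube n) (λ x → 1 + 3 * (⟦ ev L₁ x ≟ ev L₂ x ⟧ * ⟦ ev L₁ x ≟ ev L₃ x ⟧))
                                             ≤⟨ *-monoʳ-≤ 2 (∑-mono (cube n) (λ x → ≤-trans (lines₃ (ev L₁ x) (ev L₂ x) (ev L₃ x))
                                                  (≤-reflexive (cong (λ z → ⟦ ev L₁ x ≟ ev L₂ x ⟧ + ⟦ ev L₁ x ≟ ev L₃ x ⟧ + ⟦ ev L₂ x ≟ ev L₃ x ⟧ + ⟦ ev L₃ x ≟ z ⟧) (sym (evalP-third L₁ L₂ x)))))) ⟩
        2 * ∑ (cube n) (λ x → ⟦ ev L₁ x ≟ ev L₂ x ⟧ + ⟦ ev L₁ x ≟ ev L₃ x ⟧ + ⟦ ev L₂ x ≟ ev L₃ x ⟧ + ⟦ ev L₃ x ≟ ev L₄ x ⟧)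
                                             ≡⟨ cong (2 *_) (trans (∑-+ (cube n) _ _) (cong (_+ c₃₄) (trans (∑-+ (cube n) _ _)
                                                  (cong (_+ c₂₃) (∑-+ (cube n) _ _))))) ⟩
        2 * (c₁₂ + c₁₃ + c₂₃ + c₃₄)          ≡⟨ lem₂ c₁₂ c₁₃ c₂₃ c₃₄ ⟩
        2 * c₁₂ + 2 * c₁₃ + 2 * c₂₃ + 2 * c₃₄
                                             ≤⟨ +-mono-≤ (+-mono-≤ (+-mono-≤ (2*collisions≤W L₁ L₂ ne₁₂) (2*collisions≤W L₁ L₃ ne₁₃))
                                                  (2*collisions≤W L₂ L₃ ne₂₃)) (2*collisions≤W L₃ L₄ ne) ⟩
        w + w + w + w                        ≡⟨ lem₃ w ⟩
        2 * w + 2 * w                        ∎))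
      where
      open ≤-Reasoning
      w = 2 ^ n
      p = triple L₁ L₂ L₃
      ev = evalP ℤ₃ {n}
      L₄ = third L₁ L₂
      c₁₂ = collisions L₁ L₂
      c₁₃ = collisions L₁ L₃
      c₂₃ = collisions L₂ L₃
      c₃₄ = collisions L₃ L₄
      lem₁ : ∀ w p → 2 * w + 2 * (3 * p) ≡ 2 * (w * 1 + 3 * p)
      lem₁ = solve-∀
      lem₂ : ∀ a b c d → 2 * (a + b + c + d) ≡ 2 * a + 2 * b + 2 * c + 2 * d
      lem₂ = solve-∀
      lem₃ : ∀ w → w + w + w + w ≡ 2 * w + 2 * w
      lem₃ = solve-∀

    -- Any further function has to be the third point of the line through the first two, so there is
    -- room for only one.
    small-domain : SmallDomainBound
    small-domain F [] uniq small h = z≤n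
    small-domain F (_ ∷ []) uniq small h = s≤s z≤n
    small-domain F (_ ∷ _ ∷ []) uniq small h = s≤s (s≤s z≤n)
    small-domain F (_ ∷ _ ∷ _ ∷ []) uniq small h = s≤s (s≤s (s≤s z≤n))
    small-domain {n} F (L₁ ∷ L₂ ∷ L₃ ∷ L₄ ∷ Ls) ((ne₁₂ ∷ ne₁₃ ∷ ne₁₄ ∷ _) ∷ (ne₂₃ ∷ ne₂₄ ∷ _) ∷ (ne₃₄ ∷ _) ∷ _) small h =
      contradiction (trans L₃≡ (sym L₄≡)) ne₃₄
      where
      collinear : ∀ L → L₁ ≢ L → L₂ ≢ L → 2 ^ n < 2 * agreement F L → L ≡ third L₁ L₂
      collinear L ne₁ ne₂ hL with Data.Product.Properties.≡-dec _≟_ (Vecₚ.≡-dec _≟_) L (third L₁ L₂)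
      ... | yes p = p
      ... | no ¬p = contradiction (<-≤-trans (W<3*triple F small L₁ L₂ L (h (here refl)) (h (there (here refl))) hL)
                                             (3*triple≤W L₁ L₂ L ne₁₂ ne₁ ne₂ ¬p)) (<-irrefl refl)
      L₃≡ = collinear L₃ ne₁₃ ne₂₃ (h (there (there (here refl))))
      L₄≡ = collinear L₄ ne₁₄ ne₂₄ (h (there (there (there (here refl)))))

    -- Collisions of distant functions over 𝔽₃

    wt : ∀ {n} → Vec (Fin 3) n → ℕ
    wt []           = 0
    wt (zero ∷ as)  = wt as
    wt (suc _ ∷ as) = suc (wt as)

    -- The discrepancies 3 · points - 2ⁿ of the three shifts of a form sum to zero, so a nonzero coefficient
    -- permutes them up to sign, while a zero coefficient doubles them.
    err : ∀ {n} → Vec (Fin 3) n → ℕ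
    err []           = 2
    err (zero ∷ as)  = 2 * err as
    err (suc _ ∷ as) = err as

    2^wt*err : ∀ {n} (as : Vec (Fin 3) n) → 2 ^ wt as * err as ≡ 2 * 2 ^ n
    2^wt*err [] = refl
    2^wt*err {suc n} (zero ∷ as) = trans (lem (2 ^ wt as) (err as)) (cong (2 *_) (2^wt*err as))
      where lem : ∀ p e → p * (2 * e) ≡ 2 * (p * e)
            lem = solve-∀
    2^wt*err {suc n} (suc _ ∷ as) = trans (*-assoc 2 (2 ^ wt as) (err as)) (cong (2 *_) (2^wt*err as))

    -- Steps by a nonzero element run through all of ℤ/3, so at every point of the cube exactly one
    -- of the three shifted forms vanishes.
    three-shifts : ∀ {n} a₀ d (as : Vec (Fin 3) n) → let s = suc d in
      points (a₀ , as) 𝟘 + points (s ⊕ a₀ , as) 𝟘 + points (s ⊕ (s ⊕ a₀) , as) 𝟘 ≡ 2 ^ n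
    three-shifts {n} a₀ d as = begin
        points (a₀ , as) 𝟘 + points (s ⊕ a₀ , as) 𝟘 + points (s ⊕ (s ⊕ a₀) , as) 𝟘
          ≡⟨ trans (∑-+ (cube n) _ _) (cong (_+ points (s ⊕ (s ⊕ a₀) , as) 𝟘) (∑-+ (cube n) _ _)) ⟨
        ∑ (cube n) (λ x → ⟦ ev a₀ x ≟ 𝟘 ⟧ + ⟦ ev (s ⊕ a₀) x ≟ 𝟘 ⟧ + ⟦ ev (s ⊕ (s ⊕ a₀)) x ≟ 𝟘 ⟧)
          ≡⟨ ∑-cong (cube n) pt ⟩
        ∑ (cube n) (λ _ → 1)
          ≡⟨ trans (∑-cube-const n 1) (*-identityʳ _) ⟩
        2 ^ n ∎
      where
      open ≡-Reasoning
      s : Fin 3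
      s = suc d
      ev : Fin 3 → Vec Bool n → Fin 3
      ev c x = evalLin ℤ₃ c as x
      cycle : ∀ (d : Fin 2) u → ⟦ u ≟ 𝟘 ⟧ + ⟦ suc d ⊕ u ≟ 𝟘 ⟧ + ⟦ suc d ⊕ (suc d ⊕ u) ≟ 𝟘 ⟧ ≡ 1
      cycle = from-yes (Finₚ.all? λ d → Finₚ.all? λ u →
        ⟦ u ≟ 𝟘 ⟧ + ⟦ suc d ⊕ u ≟ 𝟘 ⟧ + ⟦ suc d ⊕ (suc d ⊕ u) ≟ 𝟘 ⟧ Data.Nat.≟ 1)
      pt : ∀ x → ⟦ ev a₀ x ≟ 𝟘 ⟧ + ⟦ ev (s ⊕ a₀) x ≟ 𝟘 ⟧ + ⟦ ev (s ⊕ (s ⊕ a₀)) x ≟ 𝟘 ⟧ ≡ 1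
      pt x = trans (cong₂ (λ p q → ⟦ ev a₀ x ≟ 𝟘 ⟧ + ⟦ p ≟ 𝟘 ⟧ + ⟦ q ≟ 𝟘 ⟧) (evalLin-shift s a₀ as x)
        (trans (evalLin-shift s (s ⊕ a₀) as x) (cong (s ⊕_) (evalLin-shift s a₀ as x)))) (cycle d (ev a₀ x))

    -- Both directions are carried through the induction together: with a nonzero coefficient the
    -- new count is the full 2ⁿ minus the count of the remaining shift, so each bound comes from the
    -- opposite one. The value 2 of `err []` is the case 3 · 1 = 1 + 2 of the zero function in no
    -- variables.
    near-uniform : ∀ {n} a₀ (as : Vec (Fin 3) n) →
      3 * points (a₀ , as) 𝟘 ≤ 2 ^ n + err as × 2 ^ n ≤ 3 * points (a₀ , as) 𝟘 + err as
    near-uniform zero             [] = ≤-refl , s≤s z≤n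
    near-uniform (suc zero)       [] = z≤n , s≤s z≤n
    near-uniform (suc (suc zero)) [] = z≤n , s≤s z≤n
    near-uniform {suc n} a₀ (zero ∷ as) rewrite points-suc a₀ zero as 𝟘 with near-uniform a₀ as
    ... | lo , hi = ≤-trans (≤-reflexive (lem₁ p)) (≤-trans (*-monoʳ-≤ 2 lo) (≤-reflexive (lem₂ w e))) ,
                    ≤-trans (*-monoʳ-≤ 2 hi) (≤-reflexive (lem₃ p e))
      where
      p = points (a₀ , as) 𝟘
      w = 2 ^ n
      e = err as
      lem₁ : ∀ p → 3 * (p + p) ≡ 2 * (3 * p)
      lem₁ = solve-∀
      lem₂ : ∀ w e → 2 * (w + e) ≡ 2 * w + 2 * e
      lem₂ = solve-∀
      lem₃ : ∀ p e → 2 * (3 * p + e) ≡ 3 * (p + p) + 2 * e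
      lem₃ = solve-∀
    near-uniform {suc n} a₀ (suc d ∷ as) rewrite points-suc a₀ (suc d) as 𝟘
      with near-uniform (suc d ⊕ (suc d ⊕ a₀)) as | three-shifts a₀ d as
    ... | lo , hi | eq = +-cancelʳ-≤ (3 * c) _ _ (begin
        3 * P + 3 * c                ≡⟨ *-distribˡ-+ 3 P c ⟨
        3 * (P + c)                  ≡⟨ cong (3 *_) eq ⟩
        3 * w                        ≡⟨ lem₁ w ⟩
        2 * w + w                    ≤⟨ +-monoʳ-≤ (2 * w) hi ⟩
        2 * w + (3 * c + e)          ≡⟨ lem₂ w c e ⟩
        2 * w + e + 3 * c            ∎) ,
      +-cancelʳ-≤ (3 * c) _ _ (begin
        2 * w + 3 * c                ≤⟨ +-monoʳ-≤ (2 * w) lo ⟩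
        2 * w + (w + e)              ≡⟨ lem₃ w e ⟩
        3 * w + e                    ≡⟨ cong (λ z → 3 * z + e) eq ⟨
        3 * (P + c) + e              ≡⟨ lem₄ P c e ⟩
        3 * P + e + 3 * c            ∎)
      where
      open ≤-Reasoning
      P = points (a₀ , as) 𝟘 + points (suc d ⊕ a₀ , as) 𝟘
      c = points (suc d ⊕ (suc d ⊕ a₀) , as) 𝟘
      w = 2 ^ n
      e = err as
      lem₁ : ∀ w → 3 * w ≡ 2 * w + w
      lem₁ = solve-∀
      lem₂ : ∀ w c e → 2 * w + (3 * c + e) ≡ 2 * w + e + 3 * c
      lem₂ = solve-∀
      lem₃ : ∀ w e → 2 * w + (w + e) ≡ 3 * w + e
      lem₃ = solve-∀
      lem₄ : ∀ P c e → 3 * (P + c) + e ≡ 3 * P + e + 3 * c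
      lem₄ = solve-∀

    dist : ∀ {n} → Lin ℤ₃ n → Lin ℤ₃ n → ℕ
    dist L M = wt (proj₂ (L -ᴸ M))

    -- Weight at least 5 brings `err` down to at most 2ⁿ/16, and (1 + 1/16)/3 = 17/48.
    far-collisions : ∀ {n} (L M : Lin ℤ₃ n) → 5 ≤ dist L M → 48 * collisions L M ≤ 17 * 2 ^ n
    far-collisions {n} L M far = begin
        48 * collisions L M            ≤⟨ *-monoʳ-≤ 48 (collisions≤zeros L M) ⟩
        48 * points (L -ᴸ M) 𝟘         ≡⟨ lem₄₈ (points (L -ᴸ M) 𝟘) ⟩
        16 * (3 * points (L -ᴸ M) 𝟘)   ≤⟨ *-monoʳ-≤ 16 (proj₁ (near-uniform (proj₁ (L -ᴸ M)) ds)) ⟩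
        16 * (w + err ds)              ≡⟨ *-distribˡ-+ 16 w (err ds) ⟩
        16 * w + 16 * err ds           ≤⟨ +-monoʳ-≤ (16 * w) 16e≤w ⟩
        16 * w + w                     ≡⟨ +-comm (16 * w) w ⟩
        17 * w                         ∎
      where
      open ≤-Reasoning
      w = 2 ^ n
      ds = proj₂ (L -ᴸ M)
      lem₄₈ : ∀ p → 48 * p ≡ 16 * (3 * p)
      lem₄₈ = solve-∀
      lem₃₂ : ∀ p → 2 * (16 * p) ≡ 32 * p
      lem₃₂ = solve-∀
      16e≤w : 16 * err ds ≤ w
      16e≤w = *-cancelˡ-≤ 2 (begin
        2 * (16 * err ds)              ≡⟨ lem₃₂ (err ds) ⟩
        2 ^ 5 * err ds                 ≤⟨ *-monoˡ-≤ (err ds) (^-monoʳ-≤ 2 far) ⟩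
        2 ^ wt ds * err ds             ≡⟨ 2^wt*err ds ⟩
        2 * w                          ∎)

    far-collisions′ : ∀ {n} (L M : Lin ℤ₃ n) → 5 ≤ dist L M → 48 * collisions M L ≤ 17 * 2 ^ n
    far-collisions′ {n} L M far = ≤-trans (*-monoʳ-≤ 48 {collisions M L} {collisions L M} (∑-mono (cube n) (λ x →
      ⟦⟧-mono (evalP ℤ₃ M x ≟ evalP ℤ₃ L x) (evalP ℤ₃ L x ≟ evalP ℤ₃ M x) sym))) (far-collisions L M far)

    values : List (Fin 3)
    values = zero ∷ suc zero ∷ suc (suc zero) ∷ []

    open Values values
      (from-yes (Finₚ.all? λ a → Finₚ.all? λ b → ⟦ a ≟ b ⟧ Data.Nat.≟ ∑ values (λ v → ⟦ a ≟ v ⟧ * ⟦ b ≟ v ⟧)))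
      (from-yes (Finₚ.all? λ a → ∑ values (λ v → ⟦ a ≟ v ⟧) Data.Nat.≟ 1))

    -- With N = a + b + c, the least value of 8(a² + b² + c²) for given a has b = c and exceeds the
    -- left side by 3(2a - N)². The left side is thus the tangent at a = N/2, linear in a and
    -- therefore easy to average over the cube.
    plurality : ∀ a b c → (a + (b + c)) * (a + (b + c)) + 4 * (a + (b + c)) * a ≤ 8 * (a * a + (b * b + c * c))
    plurality a b c = begin
        (a + (b + c)) * (a + (b + c)) + 4 * (a + (b + c)) * a
          ≡⟨ lem₁ a b c ⟩
        5 * (a * a) + 3 * (2 * (a * (b + c))) + (b + c) * (b + c)
          ≤⟨ +-monoˡ-≤ ((b + c) * (b + c)) (+-monoʳ-≤ (5 * (a * a)) (*-monoʳ-≤ 3 (2ab≤a²+b² a (b + c)))) ⟩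
        5 * (a * a) + 3 * (a * a + (b + c) * (b + c)) + (b + c) * (b + c)
          ≡⟨ lem₂ a b c ⟩
        8 * (a * a) + 4 * (b * b + c * c) + 4 * (2 * (b * c))
          ≤⟨ +-monoʳ-≤ (8 * (a * a) + 4 * (b * b + c * c)) (*-monoʳ-≤ 4 (2ab≤a²+b² b c)) ⟩
        8 * (a * a) + 4 * (b * b + c * c) + 4 * (b * b + c * c)
          ≡⟨ lem₃ a b c ⟩
        8 * (a * a + (b * b + c * c)) ∎
      where
      open ≤-Reasoning
      lem₁ : ∀ a b c → (a + (b + c)) * (a + (b + c)) + 4 * (a + (b + c)) * a ≡ 5 * (a * a) + 3 * (2 * (a * (b + c))) + (b + c) * (b + c)
      lem₁ = solve-∀
      lem₂ : ∀ a b c → 5 * (a * a) + 3 * (a * a + (b + c) * (b + c)) + (b + c) * (b + c) ≡ 8 * (a * a) + 4 * (b * b + c * c) + 4 * (2 * (b * c))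
      lem₂ = solve-∀
      lem₃ : ∀ a b c → 8 * (a * a) + 4 * (b * b + c * c) + 4 * (b * b + c * c) ≡ 8 * (a * a + (b * b + c * c))
      lem₃ = solve-∀

    -- The hypotheses put 48Q between 18N²w, where 18 = 6 + 12, and 17N²w + 48Nw. The surplus N²w
    -- yields the claim.
    johnson : ∀ N w S Q → N * w ≤ 2 * S → w * (N * N) + 4 * N * S ≤ 8 * Q →
      48 * Q ≤ N * (48 * w) + N * (N * (17 * w)) → N * w ≤ 48 * w
    johnson N w S Q h₁ h₂ h₃ = cancel-length N {w} {48 * w} (+-cancelˡ-≤ (17 * (N * (N * w))) (N * (N * w)) (N * (48 * w)) (begin
        17 * (N * (N * w)) + N * (N * w)                 ≡⟨ lem₁ N w ⟩
        6 * (w * (N * N)) + 12 * N * (N * w)             ≤⟨ +-monoʳ-≤ (6 * (w * (N * N))) (*-monoʳ-≤ (12 * N) h₁) ⟩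
        6 * (w * (N * N)) + 12 * N * (2 * S)             ≡⟨ lem₂ (w * (N * N)) N S ⟩
        6 * (w * (N * N) + 4 * N * S)                    ≤⟨ *-monoʳ-≤ 6 h₂ ⟩
        6 * (8 * Q)                                      ≡⟨ lem₄ Q ⟩
        48 * Q                                           ≤⟨ h₃ ⟩
        N * (48 * w) + N * (N * (17 * w))                ≡⟨ lem₃ N w ⟩
        17 * (N * (N * w)) + N * (48 * w)                ∎))
      where
      open ≤-Reasoning
      lem₁ : ∀ N w → 17 * (N * (N * w)) + N * (N * w) ≡ 6 * (w * (N * N)) + 12 * N * (N * w)
      lem₁ = solve-∀
      lem₂ : ∀ p N a → 6 * p + 12 * N * (2 * a) ≡ 6 * (p + 4 * N * a)
      lem₂ = solve-∀
      lem₃ : ∀ N w → N * (48 * w) + N * (N * (17 * w)) ≡ 17 * (N * (N * w)) + N * (48 * w)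
      lem₃ = solve-∀
      lem₄ : ∀ p → 6 * (8 * p) ≡ 48 * p
      lem₄ = solve-∀

    -- Johnson-type count: agreement above 1/2 forces 3/8 N² collisions per point on average,
    -- while forms at distance ≥ 5 collide with probability at most 17/48 < 3/8.
    far-family : ∀ {n} (F : PartialFun n) Ls → AllPairs (λ L M → 5 ≤ dist L M) Ls →
      (∀ {L} → L ∈ Ls → 2 ^ n ≤ 2 * agreement F L) → length Ls ≤ 48
    far-family {n} F Ls far h = *-cancelʳ-≤ N 48 w {{m^n≢0 2 n}} (johnson N w (∑ Ls (agreement F)) (∑ Ls (λ L → ∑ Ls (collisions L)))
        (≤-trans (≤-reflexive (cong (N *_) (sym (+-identityʳ w))))
          (∑-agreement≥ F Ls 0 (λ L∈ → ≤-trans (≤-reflexive (+-identityʳ w)) (h L∈))))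
        lower
        (∑∑-scaled Ls collisions 48 (17 * w) w collisions-self (AllPairs.map (λ {L} {M} → far-both {L} {M}) far)))
      where
      open ≤-Reasoning
      N = length Ls
      w = 2 ^ n
      far-both : ∀ {L M : Lin ℤ₃ n} → 5 ≤ dist L M → 48 * collisions L M ≤ 17 * w × 48 * collisions M L ≤ 17 * w
      far-both {L} {M} d = far-collisions L M d , far-collisions′ L M d
      n₀ n₁ n₂ : Vec Bool n → ℕ
      n₀ = count Ls zero
      n₁ = count Ls (suc zero)
      n₂ = count Ls (suc (suc zero))
      sq : Vec Bool n → ℕ
      sq x = ∑ values (λ v → count Ls v x * count Ls v x)
      from-plurality : ∀ x a b c → a + (b + c) ≡ N → a * a + (b * b + c * c) ≡ sq x → N * N + 4 * N * a ≤ 8 * sq x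
      from-plurality x a b c eq eq′ = subst₂ (λ M s → M * M + 4 * M * a ≤ 8 * s) eq eq′ (plurality a b c)
      p₀ : ∀ a b c → a + (b + c) ≡ a + (b + (c + 0))
      p₀ = solve-∀
      p₁ : ∀ a b c → b + (a + c) ≡ a + (b + (c + 0))
      p₁ = solve-∀
      p₂ : ∀ a b c → c + (a + b) ≡ a + (b + (c + 0))
      p₂ = solve-∀
      pointwise : ∀ x u → N * N + 4 * N * ∑ Ls (λ L → hit u (evalP ℤ₃ L x)) ≤ 8 * sq x
      pointwise x nothing rewrite ∑-hit-nothing Ls x | *-zeroʳ (4 * N) =
        ≤-trans (+-monoʳ-≤ (N * N) z≤n) (pointwise x (just zero))
      pointwise x (just zero) = from-plurality x (n₀ x) (n₁ x) (n₂ x)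
        (trans (p₀ (n₀ x) (n₁ x) (n₂ x)) (∑-count Ls x)) (p₀ (n₀ x * n₀ x) (n₁ x * n₁ x) (n₂ x * n₂ x))
      pointwise x (just (suc zero)) = from-plurality x (n₁ x) (n₀ x) (n₂ x)
        (trans (p₁ (n₀ x) (n₁ x) (n₂ x)) (∑-count Ls x)) (p₁ (n₀ x * n₀ x) (n₁ x * n₁ x) (n₂ x * n₂ x))
      pointwise x (just (suc (suc zero))) = from-plurality x (n₂ x) (n₀ x) (n₁ x)
        (trans (p₂ (n₀ x) (n₁ x) (n₂ x)) (∑-count Ls x)) (p₂ (n₀ x * n₀ x) (n₁ x * n₁ x) (n₂ x * n₂ x))
      lower : w * (N * N) + 4 * N * ∑ Ls (agreement F) ≤ 8 * ∑ Ls (λ L → ∑ Ls (collisions L))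
      lower = begin
        w * (N * N) + 4 * N * ∑ Ls (agreement F)
          ≡⟨ cong₂ _+_ (sym (∑-cube-const n (N * N))) (trans (cong (4 * N *_) (∑-agreement F Ls)) (sym (∑-*ˡ (cube n) (4 * N) _))) ⟩
        ∑ (cube n) (λ _ → N * N) + ∑ (cube n) (λ x → 4 * N * ∑ Ls (λ L → hit (F x) (evalP ℤ₃ L x)))
          ≡⟨ ∑-+ (cube n) _ _ ⟨
        ∑ (cube n) (λ x → N * N + 4 * N * ∑ Ls (λ L → hit (F x) (evalP ℤ₃ L x)))
          ≤⟨ ∑-mono (cube n) (λ x → pointwise x (F x)) ⟩
        ∑ (cube n) (λ x → 8 * sq x)
          ≡⟨ ∑-*ˡ (cube n) 8 sq ⟩
        8 * ∑ (cube n) sq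
          ≡⟨ cong (8 *_) (trans (∑-cong (cube n) (λ x → sym (∑-count² Ls x))) (sym (∑-collisions Ls))) ⟩
        8 * ∑ Ls (λ L → ∑ Ls (collisions L)) ∎

    -- Independence of forms with disjoint supports

    Disjoint : ∀ {n} → Vec (Fin 3) n → Vec (Fin 3) n → Set
    Disjoint []       []       = ⊤
    Disjoint (a ∷ as) (b ∷ bs) = (a ≡ 𝟘 ⊎ b ≡ 𝟘) × Disjoint as bs

    Disjoint-sym : ∀ {n} (as bs : Vec (Fin 3) n) → Disjoint as bs → Disjoint bs as
    Disjoint-sym []       []       _              = tt
    Disjoint-sym (a ∷ as) (b ∷ bs) (inj₁ p , ds) = inj₂ p , Disjoint-sym as bs ds
    Disjoint-sym (a ∷ as) (b ∷ bs) (inj₂ p , ds) = inj₁ p , Disjoint-sym as bs ds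

    joint : ∀ {n} → Fin 3 → Lin ℤ₃ n → Lin ℤ₃ n → ℕ
    joint {n} v L M = ∑ (cube n) (λ x → ⟦ evalP ℤ₃ L x ≟ v ⟧ * ⟦ evalP ℤ₃ M x ≟ v ⟧)

    joint-suc : ∀ {n} v a₀ a (as : Vec (Fin 3) n) b₀ b bs →
      joint v (a₀ , a ∷ as) (b₀ , b ∷ bs) ≡ joint v (a₀ , as) (b₀ , bs) + joint v (a ⊕ a₀ , as) (b ⊕ b₀ , bs)
    joint-suc {n} v a₀ a as b₀ b bs = trans (∑-cube-suc n _) (cong (joint v (a₀ , as) (b₀ , bs) +_)
      (∑-cong (cube n) (λ x → cong₂ (λ p q → ⟦ p ≟ v ⟧ * ⟦ q ≟ v ⟧) (sym (evalLin-shift a a₀ as x)) (sym (evalLin-shift b b₀ bs x)))))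

    -- Induction on the variables: at most one of the two forms involves the first variable, and the
    -- other has the same count on both halves.
    independent : ∀ {n} v a₀ (as : Vec (Fin 3) n) b₀ bs → Disjoint as bs →
      2 ^ n * joint v (a₀ , as) (b₀ , bs) ≡ points (a₀ , as) v * points (b₀ , bs) v
    independent v a₀ [] b₀ [] _ = lem ⟦ a₀ ≟ v ⟧ ⟦ b₀ ≟ v ⟧
      where lem : ∀ p q → 1 * (p * q + 0) ≡ (p + 0) * (q + 0)
            lem = solve-∀
    independent {suc n} v a₀ (a ∷ as) b₀ (b ∷ bs) (d , ds)
      rewrite joint-suc v a₀ a as b₀ b bs | points-suc a₀ a as v | points-suc b₀ b bs v = go d
      where
      open ≡-Reasoning
      j₁ = joint v (a₀ , as) (b₀ , bs)
      j₂ = joint v (a ⊕ a₀ , as) (b ⊕ b₀ , bs)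
      p₁ = points (a₀ , as) v
      p₂ = points (a ⊕ a₀ , as) v
      r₁ = points (b₀ , bs) v
      r₂ = points (b ⊕ b₀ , bs) v
      step : 2 * 2 ^ n * (j₁ + j₂) ≡ 2 * (p₁ * r₁ + p₂ * r₂)
      step = trans (lem (2 ^ n) j₁ j₂) (cong (2 *_) (cong₂ _+_ (independent v a₀ as b₀ bs ds) (independent v (a ⊕ a₀) as (b ⊕ b₀) bs ds)))
        where lem : ∀ w j k → 2 * w * (j + k) ≡ 2 * (w * j + w * k)
              lem = solve-∀
      go : a ≡ 𝟘 ⊎ b ≡ 𝟘 → 2 * 2 ^ n * (j₁ + j₂) ≡ (p₁ + p₂) * (r₁ + r₂)
      -- With `a` equal to `𝟘`, `a ⊕ a₀` reduces to `a₀`, so `p₂` is `p₁`.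
      go (inj₁ refl) = trans step (lem p₁ r₁ r₂)
        where lem : ∀ p r s → 2 * (p * r + p * s) ≡ (p + p) * (r + s)
              lem = solve-∀
      go (inj₂ refl) = trans step (lem p₁ p₂ r₁)
        where lem : ∀ p q r → 2 * (p * r + q * r) ≡ (p + q) * (r + r)
              lem = solve-∀

    wt-0ᵛ : ∀ n → wt (0ᵛ {n}) ≡ 0
    wt-0ᵛ zero    = refl
    wt-0ᵛ (suc n) = wt-0ᵛ n

    wt≡0⇒0ᵛ : ∀ {n} (as : Vec (Fin 3) n) → wt as ≡ 0 → as ≡ 0ᵛ
    wt≡0⇒0ᵛ []          _ = refl
    wt≡0⇒0ᵛ (zero ∷ as) p = cong (zero ∷_) (wt≡0⇒0ᵛ as p)

    ∣-∣² : ∀ a b → ∣ a - b ∣ * ∣ a - b ∣ + 2 * (a * b) ≡ a * a + b * b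
    ∣-∣² a b with ≤-total a b
    ... | inj₁ a≤b with m≤n⇒∃[o]m+o≡n a≤b
    ...   | k , refl rewrite ∣m-m+n∣≡n a k = lem a k
      where lem : ∀ a k → k * k + 2 * (a * (a + k)) ≡ a * a + (a + k) * (a + k)
            lem = solve-∀
    ∣-∣² a b | inj₂ b≤a with m≤n⇒∃[o]m+o≡n b≤a
    ...   | k , refl rewrite ∣-∣-comm (b + k) b | ∣m-m+n∣≡n b k = lem b k
      where lem : ∀ b k → k * k + 2 * ((b + k) * b) ≡ (b + k) * (b + k) + b * b
            lem = solve-∀

    -- At a random point, the number of forms with value `v` is a sum of pairwise independent
    -- indicators with mean Q/w, so its variance is at most N. `D` is the deviation from the mean
    -- multiplied by w, which avoids division.
    module Deviation {n} (Ls : List (Lin ℤ₃ n)) (disj : AllPairs (λ L M → Disjoint (proj₂ L) (proj₂ M)) Ls) (v : Fin 3) where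
      N = length Ls
      w = 2 ^ n
      Q = ∑ Ls (λ L → points L v)
      D : Vec Bool n → ℕ
      D x = ∣ w * count Ls v x - Q ∣

      ∑-count≡Q : ∑ (cube n) (count Ls v) ≡ Q
      ∑-count≡Q = ∑-swap (cube n) Ls (λ x L → ⟦ evalP ℤ₃ L x ≟ v ⟧)

      w*∑-count²≤ : w * ∑ (cube n) (λ x → count Ls v x * count Ls v x) ≤ N * (w * w) + Q * Q
      w*∑-count²≤ = begin
        w * ∑ (cube n) (λ x → count Ls v x * count Ls v x)
          ≡⟨ cong (w *_) (trans (∑-cong (cube n) (λ x → ∑-square Ls (λ L → ⟦ evalP ℤ₃ L x ≟ v ⟧)))
               (trans (∑-swap (cube n) Ls _) (∑-cong Ls (λ L → ∑-swap (cube n) Ls _)))) ⟩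
        w * ∑ Ls (λ L → ∑ Ls (joint v L))
          ≡⟨ ∑∑-*ˡ Ls w (joint v) ⟩
        ∑ Ls (λ L → ∑ Ls (λ M → w * joint v L M))
          ≤⟨ ∑∑-offDiagonal Ls (λ L M → w * joint v L M) (λ L M → points L v * points M v) (w * w)
               (λ L → *-monoʳ-≤ w (∑-cube-≤ n _ (λ x → *-mono-≤ (⟦⟧≤1 (evalP ℤ₃ L x ≟ v)) (⟦⟧≤1 (evalP ℤ₃ L x ≟ v)))))
               (AllPairs.map (λ {L} {M} → uncorrelated {L} {M}) disj) ⟩
        N * (w * w) + ∑ Ls (λ L → ∑ Ls (λ M → points L v * points M v))
          ≡⟨ cong (N * (w * w) +_) (∑-square Ls (λ L → points L v)) ⟨
        N * (w * w) + Q * Q ∎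
        where
        open ≤-Reasoning
        uncorrelated : ∀ {L M : Lin ℤ₃ n} → Disjoint (proj₂ L) (proj₂ M) →
          w * joint v L M ≤ points L v * points M v × w * joint v M L ≤ points M v * points L v
        uncorrelated {a₀ , as} {b₀ , bs} d = ≤-reflexive (independent v a₀ as b₀ bs d) ,
          ≤-reflexive (independent v b₀ bs a₀ as (Disjoint-sym as bs d))

      -- The square is expanded with its cross term kept on the left. As the counts sum to `Q`, the
      -- cross term is 2wQ², which matches the two copies of wQ² on the right.
      ∑D²≤ : ∑ (cube n) (λ x → D x * D x) ≤ N * (w * w * w)
      ∑D²≤ = +-cancelʳ-≤ (2 * (w * Q * Q)) _ _ (begin
        ∑ (cube n) (λ x → D x * D x) + 2 * (w * Q * Q)
          ≡⟨ cong (∑ (cube n) (λ x → D x * D x) +_) (trans (lem₁ w Q) (trans (cong (2 * w * Q *_) (sym ∑-count≡Q)) (sym (∑-*ˡ (cube n) (2 * w * Q) (count Ls v))))) ⟩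
        ∑ (cube n) (λ x → D x * D x) + ∑ (cube n) (λ x → 2 * w * Q * count Ls v x)
          ≡⟨ ∑-+ (cube n) _ _ ⟨
        ∑ (cube n) (λ x → D x * D x + 2 * w * Q * count Ls v x)
          ≡⟨ ∑-cong (cube n) (λ x → trans (cong (D x * D x +_) (lem₂ w Q (count Ls v x)))
               (trans (∣-∣² (w * count Ls v x) Q) (cong (_+ Q * Q) (lem₃ w (count Ls v x))))) ⟩
        ∑ (cube n) (λ x → w * w * (count Ls v x * count Ls v x) + Q * Q)
          ≡⟨ trans (∑-+ (cube n) _ _) (cong₂ _+_ (∑-*ˡ (cube n) (w * w) (λ x → count Ls v x * count Ls v x)) (∑-cube-const n (Q * Q))) ⟩
        w * w * S + w * (Q * Q)
          ≡⟨ cong (_+ w * (Q * Q)) (*-assoc w w S) ⟩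
        w * (w * S) + w * (Q * Q)
          ≤⟨ +-monoˡ-≤ (w * (Q * Q)) (*-monoʳ-≤ w w*∑-count²≤) ⟩
        w * (N * (w * w) + Q * Q) + w * (Q * Q)
          ≡⟨ lem₄ w N Q ⟩
        N * (w * w * w) + 2 * (w * Q * Q) ∎)
        where
        open ≤-Reasoning
        S = ∑ (cube n) (λ x → count Ls v x * count Ls v x)
        lem₁ : ∀ w Q → 2 * (w * Q * Q) ≡ 2 * w * Q * Q
        lem₁ = solve-∀
        lem₂ : ∀ w Q c → 2 * w * Q * c ≡ 2 * (w * c * Q)
        lem₂ = solve-∀
        lem₃ : ∀ w c → w * c * (w * c) ≡ w * w * (c * c)
        lem₃ = solve-∀
        lem₄ : ∀ w N Q → w * (N * (w * w) + Q * Q) + w * (Q * Q) ≡ N * (w * w * w) + 2 * (w * Q * Q)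
        lem₄ = solve-∀

      T : ℕ
      T = ∑ (cube n) D

      T²≤ : T * T ≤ N * (w * w * (w * w))
      T²≤ = ≤-trans (cauchy-schwarz (cube n) D) (≤-trans (*-mono-≤ (≤-reflexive (length-cube n)) ∑D²≤) (≤-reflexive (lem w N)))
        where lem : ∀ w N → w * (N * (w * w * w)) ≡ N * (w * w * (w * w))
              lem = solve-∀

    square-of-sum₃≤ : ∀ a b c → (a + b + c) * (a + b + c) ≤ 3 * (a * a + b * b + c * c)
    square-of-sum₃≤ a b c = begin
        (a + b + c) * (a + b + c)
          ≡⟨ lem₁ a b c ⟩
        (a * a + b * b + c * c) + (2 * (a * b) + 2 * (b * c) + 2 * (a * c))
          ≤⟨ +-monoʳ-≤ (a * a + b * b + c * c) (+-mono-≤ (+-mono-≤ (2ab≤a²+b² a b) (2ab≤a²+b² b c)) (2ab≤a²+b² a c)) ⟩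
        (a * a + b * b + c * c) + ((a * a + b * b) + (b * b + c * c) + (a * a + c * c))
          ≡⟨ lem₂ a b c ⟩
        3 * (a * a + b * b + c * c) ∎
      where
      open ≤-Reasoning
      lem₁ : ∀ a b c → (a + b + c) * (a + b + c) ≡ (a * a + b * b + c * c) + (2 * (a * b) + 2 * (b * c) + 2 * (a * c))
      lem₁ = solve-∀
      lem₂ : ∀ a b c → (a * a + b * b + c * c) + ((a * a + b * b) + (b * b + c * c) + (a * a + c * c)) ≡ 3 * (a * a + b * b + c * c)
      lem₂ = solve-∀

    -- Forms with disjoint supports are independent, so for each v the number of forms equal to v
    -- concentrates around its mean, which is at most N/2.
    disjoint-family : ∀ {n} (F : PartialFun n) Ls → AllPairs (λ L M → Disjoint (proj₂ L) (proj₂ M)) Ls →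
      (∀ {L} → L ∈ Ls → wt (proj₂ L) ≢ 0) → ∀ t → (∀ {L} → L ∈ Ls → 2 ^ n + t ≤ 2 * agreement F L) →
      length Ls * (t * t) ≤ 36 * (2 ^ n * 2 ^ n)
    disjoint-family {n} F Ls disj nonconst t h =
      cancel-length N (*-cancelʳ-≤ _ _ (w * w) {{m*n≢0 w w {{m^n≢0 2 n}} {{m^n≢0 2 n}}}} (begin
        N * (N * (t * t)) * (w * w)                      ≡⟨ lem₁ N t w ⟩
        (N * w * t) * (N * w * t)                        ≤⟨ *-mono-≤ Nwt≤ Nwt≤ ⟩
        (2 * (T₀ + T₁ + T₂)) * (2 * (T₀ + T₁ + T₂))      ≡⟨ lem₂ (T₀ + T₁ + T₂) ⟩
        4 * ((T₀ + T₁ + T₂) * (T₀ + T₁ + T₂))            ≤⟨ *-monoʳ-≤ 4 (square-of-sum₃≤ T₀ T₁ T₂) ⟩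
        4 * (3 * (T₀ * T₀ + T₁ * T₁ + T₂ * T₂))          ≤⟨ *-monoʳ-≤ 4 (*-monoʳ-≤ 3 (+-mono-≤ (+-mono-≤ (T²≤ zero) (T²≤ (suc zero))) (T²≤ (suc (suc zero))))) ⟩
        4 * (3 * (X + X + X))                            ≡⟨ lem₃ N w ⟩
        N * (36 * (w * w)) * (w * w)                     ∎))
      where
      open ≤-Reasoning
      open Deviation Ls disj using (D; Q; T; T²≤)
      N = length Ls
      w = 2 ^ n
      X = N * (w * w * (w * w))
      T₀ = T zero
      T₁ = T (suc zero)
      T₂ = T (suc (suc zero))
      D₀ = D zero
      D₁ = D (suc zero)
      D₂ = D (suc (suc zero))
      lem₁ : ∀ N t w → N * (N * (t * t)) * (w * w) ≡ (N * w * t) * (N * w * t)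
      lem₁ = solve-∀
      lem₂ : ∀ s → (2 * s) * (2 * s) ≡ 4 * (s * s)
      lem₂ = solve-∀
      lem₃ : ∀ N w → let X = N * (w * w * (w * w)) in 4 * (3 * (X + X + X)) ≡ N * (36 * (w * w)) * (w * w)
      lem₃ = solve-∀
      2Q≤ : ∀ v → 2 * Q v ≤ N * w
      2Q≤ v = ≤-trans (≤-reflexive (sym (∑-*ˡ Ls 2 _))) (≤-trans (∑-mono-∈ Ls (λ {L} L∈ → 2*points≤W L v
        (λ eq → nonconst L∈ (trans (cong (wt ∘ proj₂) eq) (wt-0ᵛ n))))) (≤-reflexive (∑-const Ls w)))
      at : ∀ v x → 2 * (w * count Ls v x) ≤ N * w + 2 * D v x
      at v x = ≤-trans (*-monoʳ-≤ 2 (m≤n+∣m-n∣ (w * count Ls v x) (Q v)))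
        (≤-trans (≤-reflexive (*-distribˡ-+ 2 (Q v) (D v x))) (+-monoˡ-≤ (2 * D v x) (2Q≤ v)))
      pointwise : ∀ x u → 2 * (w * ∑ Ls (λ L → hit u (evalP ℤ₃ L x))) ≤ N * w + 2 * (D₀ x + D₁ x + D₂ x)
      pointwise x nothing rewrite ∑-hit-nothing Ls x | *-zeroʳ w = z≤n
      pointwise x (just zero) = ≤-trans (at zero x) (+-monoʳ-≤ (N * w) (*-monoʳ-≤ 2
        (≤-trans (m≤m+n (D₀ x) (D₁ x)) (m≤m+n (D₀ x + D₁ x) (D₂ x)))))
      pointwise x (just (suc zero)) = ≤-trans (at (suc zero) x) (+-monoʳ-≤ (N * w) (*-monoʳ-≤ 2
        (≤-trans (m≤n+m (D₁ x) (D₀ x)) (m≤m+n (D₀ x + D₁ x) (D₂ x)))))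
      pointwise x (just (suc (suc zero))) = ≤-trans (at (suc (suc zero)) x) (+-monoʳ-≤ (N * w) (*-monoʳ-≤ 2
        (m≤n+m (D₂ x) (D₀ x + D₁ x))))
      Nwt≤ : N * w * t ≤ 2 * (T₀ + T₁ + T₂)
      Nwt≤ = +-cancelˡ-≤ (w * (N * w)) _ _ (begin
        w * (N * w) + N * w * t                          ≡⟨ lem₄ w N t ⟩
        w * (N * (w + t))                                ≤⟨ *-monoʳ-≤ w (∑-agreement≥ F Ls t h) ⟩
        w * (2 * ∑ Ls (agreement F))                     ≡⟨ trans (cong (λ z → w * (2 * z)) (∑-agreement F Ls)) (lem₅ w _) ⟩
        2 * w * ∑ (cube n) (λ x → ∑ Ls (λ L → hit (F x) (evalP ℤ₃ L x)))
                                                         ≡⟨ ∑-*ˡ (cube n) (2 * w) _ ⟨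
        ∑ (cube n) (λ x → 2 * w * ∑ Ls (λ L → hit (F x) (evalP ℤ₃ L x)))
                                                         ≤⟨ ∑-mono (cube n) (λ x → ≤-trans (≤-reflexive (*-assoc 2 w _)) (pointwise x (F x))) ⟩
        ∑ (cube n) (λ x → N * w + 2 * (D₀ x + D₁ x + D₂ x))
                                                         ≡⟨ ∑-+ (cube n) _ _ ⟩
        ∑ (cube n) (λ _ → N * w) + ∑ (cube n) (λ x → 2 * (D₀ x + D₁ x + D₂ x))
                                                         ≡⟨ cong₂ _+_ (∑-cube-const n (N * w)) (trans (∑-*ˡ (cube n) 2 _) (cong (2 *_)
                                                              (trans (∑-+ (cube n) _ _) (cong (_+ T₂) (∑-+ (cube n) _ _))))) ⟩
        w * (N * w) + 2 * (T₀ + T₁ + T₂)                 ∎)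
        where
        lem₄ : ∀ w N t → w * (N * w) + N * w * t ≡ w * (N * (w + t))
        lem₄ = solve-∀
        lem₅ : ∀ w a → w * (2 * a) ≡ 2 * w * a
        lem₅ = solve-∀

    -- Sparse forms and the degree 8 bound for q = 3

    units : ∀ {n} → Vec (Fin 3) n → List (Vec (Fin 3) n)
    units []           = []
    units (zero ∷ as)  = map (zero ∷_) (units as)
    units (suc _ ∷ as) = (suc zero ∷ 0ᵛ) ∷ (suc (suc zero) ∷ 0ᵛ) ∷ map (zero ∷_) (units as)

    length-units : ∀ {n} (as : Vec (Fin 3) n) → length (units as) ≡ 2 * wt as
    length-units []           = refl
    length-units (zero ∷ as)  = trans (Listₚ.length-map (zero ∷_) (units as)) (length-units as)
    length-units (suc _ ∷ as) = trans (cong (2 +_) (trans (Listₚ.length-map (zero ∷_) (units as)) (length-units as)))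
      (sym (*-suc 2 (wt as)))

    -ᵛ-0ᵛ : ∀ {n} (as : Vec (Fin 3) n) → as -ᵛ 0ᵛ ≡ as
    -ᵛ-0ᵛ []       = refl
    -ᵛ-0ᵛ (a ∷ as) = cong₂ _∷_ (⊝-𝟘 a) (-ᵛ-0ᵛ as)

    Reduces : ∀ {n} → Vec (Fin 3) n → Vec (Fin 3) n → Set
    Reduces u e = wt (u -ᵛ e) < wt u

    -- At a common index, subtracting the unit with the coefficient of `u` clears that entry of `u`.
    -- It occurs in `units d` because both nonzero coefficients are listed at every index of the
    -- support of `d`.
    disjoint⊎reduces : ∀ {n} (u d : Vec (Fin 3) n) → Disjoint u d ⊎ Any (Reduces u) (units d)
    disjoint⊎reduces [] [] = inj₁ tt
    disjoint⊎reduces (zero ∷ u) (zero ∷ d) with disjoint⊎reduces u d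
    ... | inj₁ p = inj₁ (inj₁ refl , p)
    ... | inj₂ p = inj₂ (Anyₚ.map⁺ p)
    disjoint⊎reduces (zero ∷ u) (suc c ∷ d) with disjoint⊎reduces u d
    ... | inj₁ p = inj₁ (inj₁ refl , p)
    ... | inj₂ p = inj₂ (there (there (Anyₚ.map⁺ p)))
    disjoint⊎reduces (suc zero ∷ u) (zero ∷ d) with disjoint⊎reduces u d
    ... | inj₁ p = inj₁ (inj₂ refl , p)
    ... | inj₂ p = inj₂ (Anyₚ.map⁺ (Any.map s≤s p))
    disjoint⊎reduces (suc (suc zero) ∷ u) (zero ∷ d) with disjoint⊎reduces u d
    ... | inj₁ p = inj₁ (inj₂ refl , p)
    ... | inj₂ p = inj₂ (Anyₚ.map⁺ (Any.map s≤s p))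
    disjoint⊎reduces (suc zero ∷ u) (suc c ∷ d) = inj₂ (here (s≤s (≤-reflexive (cong wt (-ᵛ-0ᵛ u)))))
    disjoint⊎reduces (suc (suc zero) ∷ u) (suc c ∷ d) = inj₂ (there (here (s≤s (≤-reflexive (cong wt (-ᵛ-0ᵛ u))))))

    Disjoint-self : ∀ {n} (u : Vec (Fin 3) n) → Disjoint u u → wt u ≡ 0
    Disjoint-self []           _              = refl
    Disjoint-self (zero ∷ u)   (_ , d)       = Disjoint-self u d
    Disjoint-self (suc _ ∷ u)  (inj₁ () , _)
    Disjoint-self (suc _ ∷ u)  (inj₂ () , _)

    length-concatMap≤ : ∀ {A B : Set} (f : A → List B) (l : List A) k → (∀ {x} → x ∈ l → length (f x) ≤ k) →
      length (concatMap f l) ≤ length l * k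
    length-concatMap≤ f []      k h = z≤n
    length-concatMap≤ f (x ∷ l) k h = ≤-trans (≤-reflexive (Listₚ.length-++ (f x)))
      (+-mono-≤ (h (here refl)) (length-concatMap≤ f l k (λ p → h (there p))))

    -- Subtracting `M` from the functions and from `F` alike preserves distinctness and agreement.
    -- This moves a centre or a unit to the origin, where the sparsity bound applies.
    shifted-family : ∀ {n} (F : PartialFun n) Ls M s → Unique Ls → (∀ {L} → L ∈ Ls → s ≤ 2 * agreement F L) →
      (Q : Lin ℤ₃ n → Set) → (∀ {L} → L ∈ Ls → Q (L -ᴸ M)) →
      let Ls′ = map (_-ᴸ M) Ls in
      Unique Ls′ × (∀ {L} → L ∈ Ls′ → s ≤ 2 * agreement (shift F M) L) × (∀ {L} → L ∈ Ls′ → Q L)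
    shifted-family F Ls M s uniq h Q q = Uniqueₚ.map⁺ (-ᴸ-cancelʳ M) uniq ,
      (λ L∈ → let (L₀ , L₀∈ , eq) = ∈-map⁻ (_-ᴸ M) L∈ in
        subst (λ L → s ≤ 2 * agreement (shift F M) L) (sym eq) (≤-trans (h L₀∈) (*-monoʳ-≤ 2 (agreement-shift F L₀ M)))) ,
      (λ L∈ → let (L₀ , L₀∈ , eq) = ∈-map⁻ (_-ᴸ M) L∈ in subst Q (sym eq) (q L₀∈))

    -- Distinct constants never collide, so the sets where they agree with `F` are disjoint and
    -- cannot both fill more than half of the cube.
    constants : ∀ {n} (F : PartialFun n) Ls → Unique Ls → (∀ {L} → L ∈ Ls → 2 ^ n < 2 * agreement F L) →
      (∀ {L} → L ∈ Ls → wt (proj₂ L) ≡ 0) → length Ls ≤ 1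
    constants F []       uniq h c = z≤n
    constants F (_ ∷ []) uniq h c = s≤s z≤n
    constants {n} F ((a , as) ∷ (b , bs) ∷ Ls) ((ne ∷ _) ∷ _) h c
      with wt≡0⇒0ᵛ as (c (here refl)) | wt≡0⇒0ᵛ bs (c (there (here refl)))
    ... | refl | refl = contradiction (begin-strict
        2 ^ n + 2 ^ n                                            <⟨ +-mono-< (h (here refl)) (h (there (here refl))) ⟩
        2 * agreement F (const a) + 2 * agreement F (const b)    ≡⟨ *-distribˡ-+ 2 (agreement F (const a)) (agreement F (const b)) ⟨
        2 * (agreement F (const a) + agreement F (const b))      ≤⟨ *-monoʳ-≤ 2 (agreement-pair F (const a) (const b)) ⟩
        2 * (domain F + collisions {n} (const a) (const b))      ≡⟨ cong (λ z → 2 * (domain F + z)) no-collisions ⟩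
        2 * (domain F + 0)                                       ≤⟨ *-monoʳ-≤ 2 (≤-trans (≤-reflexive (+-identityʳ (domain F))) (domain≤W F)) ⟩
        2 * 2 ^ n                                                ≡⟨ cong (2 ^ n +_) (+-identityʳ (2 ^ n)) ⟩
        2 ^ n + 2 ^ n                                            ∎) (<-irrefl refl)
      where
      open ≤-Reasoning
      pt : ∀ x → ⟦ evalP ℤ₃ (const {n} a) x ≟ evalP ℤ₃ (const {n} b) x ⟧ ≡ 0
      pt x with evalP ℤ₃ (const {n} a) x ≟ evalP ℤ₃ (const {n} b) x
      ... | yes p = contradiction (cong const (trans (sym (evalLin-0ᵛ a x)) (trans p (evalLin-0ᵛ b x)))) ne
      ... | no _  = refl
      no-collisions : collisions {n} (const a) (const b) ≡ 0
      no-collisions = trans (∑-cong (cube n) pt) (trans (∑-cube-const n 0) (*-zeroʳ (2 ^ n)))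

    -- The summand 1 pays for the constants. The factor 72(k + 1) is 36, from `disjoint-family`,
    -- times the at most 2(k + 1) units of a form of weight at most k + 1.
    K : ℕ → ℕ
    K zero    = 1
    K (suc k) = 1 + 72 * suc k * K k

    -- The arithmetic of the induction step: `C` constants, `U` other forms, `N` forms with disjoint
    -- supports having `E` units altogether, and the bound `κ` for sparsity k. `T` and `V` stand for
    -- the k-th powers of `t²` and `w²`.
    combine : ∀ C U N E k κ t² w² T V → C * (t² * T) ≤ w² * V → U * T ≤ E * (κ * V) → E ≤ N * (2 * suc k) → N * t² ≤ 36 * w² →
      (C + U) * (t² * T) ≤ (1 + 72 * suc k * κ) * (w² * V)
    combine C U N E k κ t² w² T V hC hU hE hN = begin
        (C + U) * (t² * T)                            ≡⟨ lem₁ C U t² T ⟩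
        C * (t² * T) + t² * (U * T)                   ≤⟨ +-mono-≤ hC (*-monoʳ-≤ t² (≤-trans hU (*-monoˡ-≤ (κ * V) hE))) ⟩
        w² * V + t² * (N * (2 * suc k) * (κ * V))     ≡⟨ cong (w² * V +_) (lem₂ t² N (suc k) κ V) ⟩
        w² * V + N * t² * (2 * suc k * (κ * V))       ≤⟨ +-monoʳ-≤ (w² * V) (*-monoˡ-≤ (2 * suc k * (κ * V)) hN) ⟩
        w² * V + 36 * w² * (2 * suc k * (κ * V))      ≡⟨ lem₃ w² (suc k) κ V ⟩
        (1 + 72 * suc k * κ) * (w² * V)               ∎
      where
      open ≤-Reasoning
      lem₁ : ∀ C U t² T → (C + U) * (t² * T) ≡ C * (t² * T) + t² * (U * T)
      lem₁ = solve-∀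
      lem₂ : ∀ t² N s κ V → t² * (N * (2 * s) * (κ * V)) ≡ N * t² * (2 * s * (κ * V))
      lem₂ = solve-∀
      lem₃ : ∀ w² s κ V → w² * V + 36 * w² * (2 * s * (κ * V)) ≡ (1 + 72 * s * κ) * (w² * V)
      lem₃ = solve-∀

    SparseBound : ℕ → ℕ → Set
    SparseBound k κ = ∀ {n} (F : PartialFun n) Ls → Unique Ls → ∀ t → 1 ≤ t →
      (∀ {L} → L ∈ Ls → 2 ^ n + t ≤ 2 * agreement F L) → (∀ {L} → L ∈ Ls → wt (proj₂ L) ≤ k) →
      length Ls * (t * t) ^ k ≤ κ * (2 ^ n * 2 ^ n) ^ k

    -- Any form meeting a maximal disjoint subfamily loses a monomial after subtracting some unit c xᵢ from it,
    -- where i ranges over the supports of that subfamily.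
    sparse-family : ∀ k → SparseBound k (K k)
    sparse-family zero {n} F Ls uniq t 1≤t h sp =
      *-monoˡ-≤ 1 (constants F Ls uniq (λ L∈ → <-≤-trans (m<m+n (2 ^ n) 1≤t) (h L∈)) (λ L∈ → n≤0⇒n≡0 (sp L∈)))
    sparse-family (suc k) F [] uniq t 1≤t h sp = z≤n
    sparse-family (suc k) {n} F Ls@(L ∷ _) uniq t 1≤t h sp =
      subst (λ N → N * (t * t) ^ suc k ≤ K (suc k) * (w * w) ^ suc k) (sym split)
        (combine (length Cs) (length Us) (length D) (length E) k (K k) (t * t) (w * w) ((t * t) ^ k) ((w * w) ^ k)
          (≤-trans (*-mono-≤ Cs≤1 (^-monoˡ-≤ (suc k) (*-mono-≤ t≤w t≤w))) (≤-reflexive (*-identityˡ ((w * w) ^ suc k))))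
          (cover E Us (λ u e → wt (proj₂ u -ᵛ e) ≤? k) ((t * t) ^ k) (K k * (w * w) ^ k) covered part)
          (length-concatMap≤ (units ∘ proj₂) D (2 * suc k) (λ {d} d∈ → ≤-trans (≤-reflexive (length-units (proj₂ d)))
            (*-monoʳ-≤ 2 (sp (Us⊆ (D⊆ d∈))))))
          (disjoint-family F D D-disjoint (λ d∈ → Us-nonconst (D⊆ d∈)) t (λ d∈ → h (Us⊆ (D⊆ d∈)))))
      where
      w = 2 ^ n
      const? : (u : Lin ℤ₃ n) → Dec (wt (proj₂ u) ≡ 0)
      const? u = wt (proj₂ u) Data.Nat.≟ 0
      Cs Us : List (Lin ℤ₃ n)
      Cs = filter const? Ls
      Us = filter (λ u → ¬? (const? u)) Ls
      split : length Ls ≡ length Cs + length Us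
      split = trans (length-as-∑ Ls) (trans (∑-filter-split const? Ls (λ _ → 1))
        (cong₂ _+_ (sym (length-as-∑ Cs)) (sym (length-as-∑ Us))))
      t≤w : t ≤ w
      t≤w = t≤W F L (h (here refl))
      Cs⊆ : ∀ {u} → u ∈ Cs → u ∈ Ls × wt (proj₂ u) ≡ 0
      Cs⊆ = ∈-filter⁻ const?
      Us⊆ : ∀ {u} → u ∈ Us → u ∈ Ls
      Us⊆ = proj₁ ∘ ∈-filter⁻ (λ u → ¬? (const? u))
      Us-nonconst : ∀ {u} → u ∈ Us → wt (proj₂ u) ≢ 0
      Us-nonconst = proj₂ ∘ ∈-filter⁻ (λ u → ¬? (const? u)) {xs = Ls}
      Cs≤1 : length Cs ≤ 1
      Cs≤1 = constants F Cs (AllPairsₚ.filter⁺ const? uniq) (λ L∈ → <-≤-trans (m<m+n w 1≤t) (h (proj₁ (Cs⊆ L∈)))) (proj₂ ∘ Cs⊆)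
      self : ∀ {u} → u ∈ Us → Any (Reduces (proj₂ u)) (units (proj₂ u))
      self {u} u∈ with disjoint⊎reduces (proj₂ u) (proj₂ u)
      ... | inj₁ d = contradiction (Disjoint-self (proj₂ u) d) (Us-nonconst u∈)
      ... | inj₂ p = p
      maximal = maximal-subfamily {P = λ u d → Disjoint (proj₂ u) (proj₂ d)} {Q = λ u d → Any (Reduces (proj₂ u)) (units (proj₂ d))}
        (λ u d → disjoint⊎reduces (proj₂ u) (proj₂ d)) Us self
      D = proj₁ maximal
      D⊆ : ∀ {d} → d ∈ D → d ∈ Us
      D⊆ = proj₁ (proj₂ maximal)
      D-disjoint = proj₁ (proj₂ (proj₂ maximal))
      E : List (Vec (Fin 3) n)
      E = concatMap (units ∘ proj₂) D
      covered : ∀ {u} → u ∈ Us → Any (λ e → wt (proj₂ u -ᵛ e) ≤ k) E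
      covered {u} u∈ = Any.map (λ r → ≤-pred (≤-trans r (sp (Us⊆ u∈))))
        (Anyₚ.concatMap⁺ (units ∘ proj₂) (proj₂ (proj₂ (proj₂ maximal)) u∈))
      part : ∀ {e} → e ∈ E → length (filter (λ u → wt (proj₂ u -ᵛ e) ≤? k) Us) * (t * t) ^ k ≤ K k * (w * w) ^ k
      part {e} _ = subst (λ N → N * (t * t) ^ k ≤ K k * (w * w) ^ k) (Listₚ.length-map (_-ᴸ (𝟘 , e)) Ve)
          (sparse-family k (shift F (𝟘 , e)) (map (_-ᴸ (𝟘 , e)) Ve) (proj₁ sh) t 1≤t (proj₁ (proj₂ sh)) (proj₂ (proj₂ sh)))
        where
        e? : (u : Lin ℤ₃ n) → Dec (wt (proj₂ u -ᵛ e) ≤ k)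
        e? u = wt (proj₂ u -ᵛ e) ≤? k
        Ve = filter e? Us
        sh = shifted-family F Ve (𝟘 , e) (w + t) (AllPairsₚ.filter⁺ e? (AllPairsₚ.filter⁺ (λ u → ¬? (const? u)) uniq))
               (λ u∈ → h (Us⊆ (proj₁ (∈-filter⁻ e? u∈)))) (λ u → wt (proj₂ u) ≤ k) (λ u∈ → proj₂ (∈-filter⁻ e? {xs = Us} u∈))

    wt-self : ∀ {n} (as : Vec (Fin 3) n) → wt (as -ᵛ as) ≡ 0
    wt-self []       = refl
    wt-self (a ∷ as) rewrite ⊝-self a = wt-self as

    -- The exponent 8 originates here: after subtraction of a centre at most four monomials remain,
    -- and each costs two powers of W/t.
    coarse-from-sparse : ∀ c κ → (∀ {n} (F : PartialFun n) Ls → AllPairs (λ L M → 5 ≤ dist L M) Ls →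
        (∀ {L} → L ∈ Ls → 2 ^ n ≤ 2 * agreement F L) → length Ls ≤ c) →
      SparseBound 4 κ → CoarseBound (c * κ)
    coarse-from-sparse c κ far-family sparse {n} F Ls uniq t 1≤t h = begin
        length Ls * t ^ 8             ≡⟨ cong (length Ls *_) (pow t) ⟩
        length Ls * (t * t) ^ 4       ≤⟨ cover D Ls (λ u d → dist u d ≤? 4) ((t * t) ^ 4) (κ * (w * w) ^ 4) covered part ⟩
        length D * (κ * (w * w) ^ 4) ≤⟨ *-monoˡ-≤ (κ * (w * w) ^ 4) (far-family F D D-far (λ d∈ → ≤-trans (m≤m+n w t) (h (D⊆ d∈)))) ⟩
        c * (κ * (w * w) ^ 4)      ≡⟨ *-assoc c (κ) ((w * w) ^ 4) ⟨
        c * κ * (w * w) ^ 4        ≡⟨ cong (c * κ *_) (pow w) ⟨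
        c * κ * w ^ 8              ∎
      where
      open ≤-Reasoning
      w = 2 ^ n
      pow : ∀ a → a ^ 8 ≡ (a * a) ^ 4
      pow a = trans (sym (^-*-assoc a 2 4)) (cong (λ z → (a * z) ^ 4) (*-identityʳ a))
      far⊎near : ∀ (u d : Lin ℤ₃ n) → 5 ≤ dist u d ⊎ dist u d ≤ 4
      far⊎near u d with dist u d ≤? 4
      ... | yes p = inj₂ p
      ... | no ¬p = inj₁ (≰⇒> ¬p)
      maximal = maximal-subfamily {P = λ u d → 5 ≤ dist u d} {Q = λ u d → dist u d ≤ 4} far⊎near Ls
        (λ {u} _ → ≤-trans (≤-reflexive (wt-self (proj₂ u))) z≤n)
      D = proj₁ maximal
      D⊆ : ∀ {d} → d ∈ D → d ∈ Ls
      D⊆ = proj₁ (proj₂ maximal)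
      D-far = proj₁ (proj₂ (proj₂ maximal))
      covered : ∀ {u} → u ∈ Ls → Any (λ d → dist u d ≤ 4) D
      covered = proj₂ (proj₂ (proj₂ maximal))
      part : ∀ {d} → d ∈ D → length (filter (λ u → dist u d ≤? 4) Ls) * (t * t) ^ 4 ≤ κ * (w * w) ^ 4
      part {d} _ = subst (λ N → N * (t * t) ^ 4 ≤ κ * (w * w) ^ 4) (Listₚ.length-map (_-ᴸ d) Vd)
          (sparse (shift F d) (map (_-ᴸ d) Vd) (proj₁ sh) t 1≤t (proj₁ (proj₂ sh)) (proj₂ (proj₂ sh)))
        where
        d? : (u : Lin ℤ₃ n) → Dec (dist u d ≤ 4)
        d? u = dist u d ≤? 4
        Vd = filter d? Ls
        sh = shifted-family F Vd d (w + t) (AllPairsₚ.filter⁺ d? uniq) (λ u∈ → h (proj₁ (∈-filter⁻ d? u∈)))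
               (λ u → wt (proj₂ u) ≤ 4) (λ u∈ → proj₂ (∈-filter⁻ d? {xs = Ls} u∈))

    coarse : CoarseBound (48 * K 4)
    coarse = coarse-from-sparse 48 (K 4) far-family (sparse-family 4)

  -- Subgroups, congruence and the descent

  ∑-strict : ∀ {A : Set} (l : List A) {f g : A → ℕ} → (∀ x → f x ≤ g x) → ∀ {x} → x ∈ l → f x < g x → ∑ l f < ∑ l g
  ∑-strict (_ ∷ l) h (here refl) lt = +-mono-<-≤ lt (∑-mono l h)
  ∑-strict (y ∷ l) h (there x∈)  lt = +-mono-≤-< (h y) (∑-strict l h x∈ lt)

  AllPairs-restrict : ∀ {A : Set} {Q : A → Set} {R S : A → A → Set} → (∀ {x y} → Q x → Q y → R x y → S x y) →
    ∀ {l} → (∀ {x} → x ∈ l → Q x) → AllPairs R l → AllPairs S l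
  AllPairs-restrict f q []       = []
  AllPairs-restrict f q (r ∷ rs) =
    All.tabulate (λ y∈ → f (q (here refl)) (q (there y∈)) (All.lookup r y∈)) ∷ AllPairs-restrict f (q ∘ there) rs

  -- No quotient group is formed: working modulo a subgroup means testing differences for
  -- membership, coefficient by coefficient or value by value.
  record Subgroup (G : FinAbGroup) : Set₁ where
    open Linear G
    field
      mem  : Carrier G → Set
      mem? : ∀ a → Dec (mem a)
      mem-𝟘 : mem 𝟘
      mem-⊕ : ∀ {a b} → mem a → mem b → mem (a ⊕ b)
      mem-⊖ : ∀ {a} → mem a → mem (⊖ a)

    mem-⊝ : ∀ {a b} → mem a → mem b → mem (a ⊝ b)
    mem-⊝ p q = mem-⊕ p (mem-⊖ q)

    mem-flip : ∀ {a b} → mem (a ⊝ b) → mem (b ⊝ a)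
    mem-flip {a} {b} p = subst mem (⊖-⊝ a b) (mem-⊖ p)

    mem-trans : ∀ {a} b {c} → mem (a ⊝ b) → mem (b ⊝ c) → mem (a ⊝ c)
    mem-trans {a} b {c} p q = subst mem (⊝-telescope a b c) (mem-⊕ p q)

    memᴸ : ∀ {n} → Lin G n → Set
    memᴸ (a₀ , as) = mem a₀ × VAll mem as

    Congruent : ∀ {n} → Lin G n → Lin G n → Set
    Congruent P Q = memᴸ (P -ᴸ Q)

    congruent? : ∀ {n} (P Q : Lin G n) → Dec (Congruent P Q)
    congruent? P Q = mem? _ ×-dec VAll.all? mem? _

    mem-self : ∀ a → mem (a ⊝ a)
    mem-self a = subst mem (sym (⊝-self a)) mem-𝟘

    congruent-refl : ∀ {n} (P : Lin G n) → Congruent P P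
    congruent-refl (a₀ , as) = mem-self a₀ , go as
      where go : ∀ {n} (as : Vec (Carrier G) n) → VAll mem (as -ᵛ as)
            go []       = []
            go (a ∷ as) = mem-self a ∷ go as

    agreement-mod : ∀ {n} → (Vec Bool n → Carrier G) → Lin G n → ℕ
    agreement-mod {n} f P = ∑ (cube n) (λ x → ⟦ mem? (f x ⊝ evalP G P x) ⟧)

    adv-mod : ∀ {n} → (Vec Bool n → Carrier G) → Lin G n → ℕ
    adv-mod {n} f P = 2 * agreement-mod f P ∸ 2 ^ n

    nonmembers : ℕ
    nonmembers = ∑ (allFinList (order G)) (λ a → ⟦ ¬? (mem? a) ⟧)

  module _ (G : FinAbGroup) where
    open Linear G

    mulN-+ : ∀ a b g → mulN G (a + b) g ≡ mulN G a g ⊕ mulN G b g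
    mulN-+ zero    b g = sym (⊕-identityˡ _)
    mulN-+ (suc a) b g = trans (cong (g ⊕_) (mulN-+ a b g)) (sym (⊕-assoc g _ _))

    mulN-* : ∀ a b g → mulN G (a * b) g ≡ mulN G a (mulN G b g)
    mulN-* zero    b g = refl
    mulN-* (suc a) b g = trans (mulN-+ b (a * b) g) (cong (mulN G b g ⊕_) (mulN-* a b g))

    mulN-1 : ∀ g → mulN G 1 g ≡ g
    mulN-1 = ⊕-identityʳ

  PowerSumBound : ℕ → FinAbGroup → Set
  PowerSumBound C Z = ∀ {n} (F : Linear.PartialFun Z n) Ls → Unique Ls →
    ∑ Ls (λ L → Linear.adv Z F L ^ C) ≤ Linear.domain-adv Z F ^ C

  -- Adjoins `g` to `S`. `carry` says that addition in `Z` is addition of indices modulo q, and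
  -- `kernel` that only the neutral index takes `g` into `S`; so the cosets of the multiples of `g`
  -- form a copy of `Z`.
  module Extension (G : FinAbGroup) (S : Subgroup G) (Z : FinAbGroup) (q : ℕ) (g : Carrier G)
    (carry : ∀ i j → ∃ λ c → toℕ i + toℕ j ≡ toℕ (Linear._⊕_ Z i j) + c * q)
    (qg∈S : Subgroup.mem S (mulN G q g))
    (kernel : ∀ i → Subgroup.mem S (mulN G (toℕ i) g) → i ≡ Linear.𝟘 Z)
    where
    open Subgroup S
    open Linear G
    module ℤ = Linear Z

    ι : Carrier Z → Carrier G
    ι i = mulN G (toℕ i) g

    mem-multiple : ∀ c {a} → mem a → mem (mulN G c a)
    mem-multiple zero    p = mem-𝟘
    mem-multiple (suc c) p = mem-⊕ p (mem-multiple c p)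

    -- The carry of i + j contributes a multiple of `mulN G q g`, which lies in `S`.
    ι-hom : ∀ i j → mem ((ι i ⊕ ι j) ⊝ ι (i ℤ.⊕ j))
    ι-hom i j with carry i j
    ... | c , eq = subst mem (sym calc) (mem-multiple c qg∈S)
      where
      open ≡-Reasoning
      k = i ℤ.⊕ j
      calc : (ι i ⊕ ι j) ⊝ ι k ≡ mulN G c (mulN G q g)
      calc = begin
        (ι i ⊕ ι j) ⊝ ι k                      ≡⟨ cong (_⊝ ι k) (mulN-+ G (toℕ i) (toℕ j) g) ⟨
        mulN G (toℕ i + toℕ j) g ⊝ ι k         ≡⟨ cong (λ z → mulN G z g ⊝ ι k) (trans eq (+-comm (toℕ k) (c * q))) ⟩
        mulN G (c * q + toℕ k) g ⊝ ι k         ≡⟨ cong (_⊝ ι k) (trans (mulN-+ G (c * q) (toℕ k) g) (cong (_⊕ ι k) (mulN-* G c q g))) ⟩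
        (mulN G c (mulN G q g) ⊕ ι k) ⊝ ι k    ≡⟨ ⊕-assoc _ (ι k) (⊖ ι k) ⟩
        mulN G c (mulN G q g) ⊕ (ι k ⊝ ι k)    ≡⟨ trans (cong (mulN G c (mulN G q g) ⊕_) (⊝-self (ι k))) (⊕-identityʳ _) ⟩
        mulN G c (mulN G q g)                  ∎

    -- By `ι-hom`, ι(i - j) + ι j - ι i lies in `S`. Adding ι i - ι j leaves ι(i - j), and `kernel`
    -- applies.
    ι-injective : ∀ i j → mem (ι i ⊝ ι j) → i ≡ j
    ι-injective i j p = ℤ.x⊝y≡𝟘⇒x≡y i j (kernel (i ℤ.⊝ j) (subst mem calc (mem-⊕ (mem-trans (ι ((i ℤ.⊝ j) ℤ.⊕ j)) (ι-hom (i ℤ.⊝ j) j)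
        (subst (λ z → mem (ι z ⊝ ι i)) (sym i≡) (mem-self (ι i)))) p)))
      where
      open ≡-Reasoning
      i≡ : (i ℤ.⊝ j) ℤ.⊕ j ≡ i
      i≡ = trans (ℤ.⊕-assoc i (ℤ.⊖ j) j) (trans (cong (i ℤ.⊕_) (ℤ.⊖-inverseˡ j)) (ℤ.⊕-identityʳ i))
      d = ι (i ℤ.⊝ j)
      calc : ((d ⊕ ι j) ⊝ ι i) ⊕ (ι i ⊝ ι j) ≡ d
      calc = trans (⊝-telescope (d ⊕ ι j) (ι i) (ι j)) (trans (⊕-assoc d (ι j) (⊖ ι j))
        (trans (cong (d ⊕_) (⊝-self (ι j))) (⊕-identityʳ d)))

    Rep : Carrier G → Carrier Z → Set
    Rep a i = mem (a ⊝ ι i)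

    rep-⊕ : ∀ {a b i j} → Rep a i → Rep b j → Rep (a ⊕ b) (i ℤ.⊕ j)
    rep-⊕ {a} {b} {i} {j} p r = mem-trans (ι i ⊕ ι j) (subst mem (sym (⊝-interchange a b (ι i) (ι j))) (mem-⊕ p r)) (ι-hom i j)

    rep-unique : ∀ {a i j} → Rep a i → Rep a j → i ≡ j
    rep-unique {a} {i} {j} p r = ι-injective i j (mem-trans a (mem-flip p) r)

    -- The neutral element of `Z` is not assumed to have index 0; applying `ι-hom` to it twice
    -- yields the claim.
    mem-ι-𝟘 : mem (ι ℤ.𝟘)
    mem-ι-𝟘 = subst mem calc (ι-hom ℤ.𝟘 ℤ.𝟘)
      where calc : (ι ℤ.𝟘 ⊕ ι ℤ.𝟘) ⊝ ι (ℤ.𝟘 ℤ.⊕ ℤ.𝟘) ≡ ι ℤ.𝟘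
            calc = trans (cong (λ z → (ι ℤ.𝟘 ⊕ ι ℤ.𝟘) ⊝ ι z) (ℤ.⊕-identityˡ ℤ.𝟘))
              (trans (⊕-assoc _ _ _) (trans (cong (ι ℤ.𝟘 ⊕_) (⊝-self _)) (⊕-identityʳ _)))

    rep-⊖ : ∀ {a i} → Rep a i → Rep (⊖ a) (ℤ.⊖ i)
    rep-⊖ {a} {i} p = subst mem calc (mem-⊖ (mem-⊕ sum mem-ι-𝟘))
      where
      sum : mem ((a ⊕ ι (ℤ.⊖ i)) ⊝ ι ℤ.𝟘)
      sum = mem-trans (ι i ⊕ ι (ℤ.⊖ i))
        (subst mem (sym (trans (⊝-interchange a _ (ι i) _) (trans (cong ((a ⊝ ι i) ⊕_) (⊝-self _)) (⊕-identityʳ _)))) p)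
        (subst (λ z → mem ((ι i ⊕ ι (ℤ.⊖ i)) ⊝ ι z)) (ℤ.⊖-inverseʳ i) (ι-hom i (ℤ.⊖ i)))
      b = a ⊕ ι (ℤ.⊖ i)
      calc : ⊖ ((b ⊝ ι ℤ.𝟘) ⊕ ι ℤ.𝟘) ≡ (⊖ a) ⊝ ι (ℤ.⊖ i)
      calc = trans (cong ⊖_ (trans (⊕-assoc b _ _) (trans (cong (b ⊕_) (⊖-inverseˡ _)) (⊕-identityʳ b)))) (sym (⊖-⊕-comm a _))

    extension : Subgroup G
    extension = record
      { mem   = λ a → ∃ λ i → Rep a i
      ; mem?  = λ a → Finₚ.any? (λ i → mem? (a ⊝ ι i))
      ; mem-𝟘 = ℤ.𝟘 , mem-⊝ mem-𝟘 mem-ι-𝟘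
      ; mem-⊕ = λ (i , p) (j , r) → i ℤ.⊕ j , rep-⊕ p r
      ; mem-⊖ = λ (i , p) → ℤ.⊖ i , rep-⊖ p
      }

    module S⁺ = Subgroup extension

    mem⇒mem⁺ : ∀ {a} → mem a → S⁺.mem a
    mem⇒mem⁺ p = ℤ.𝟘 , mem-⊝ p mem-ι-𝟘

    coefficient : Carrier G → Carrier Z
    coefficient a with S⁺.mem? a
    ... | yes (i , _) = i
    -- A default outside S⁺; `rep-coefficient` gives the value its meaning on members only.
    ... | no _        = ℤ.𝟘

    rep-coefficient : ∀ {a} → S⁺.mem a → Rep a (coefficient a)
    rep-coefficient {a} p with S⁺.mem? a
    ... | yes (_ , r) = r
    ... | no ¬p       = ⊥-elim (¬p p)

    coordinates : ∀ {n} → Lin G n → Lin Z n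
    coordinates (a₀ , as) = coefficient a₀ , Vec.map coefficient as

    rep-evalP : ∀ {n} (L : Lin G n) → S⁺.memᴸ L → ∀ x → Rep (evalP G L x) (evalP Z (coordinates L) x)
    rep-evalP (a₀ , [])     (p , [])     []          = rep-coefficient p
    rep-evalP (a₀ , a ∷ as) (p , r ∷ rs) (false ∷ x) = rep-evalP (a₀ , as) (p , rs) x
    rep-evalP (a₀ , a ∷ as) (p , r ∷ rs) (true ∷ x)  = rep-⊕ (rep-coefficient r) (rep-evalP (a₀ , as) (p , rs) x)

    coefficient≡⇒mem : ∀ r a b → S⁺.mem (a ⊝ r) → S⁺.mem (b ⊝ r) → coefficient (a ⊝ r) ≡ coefficient (b ⊝ r) → mem (a ⊝ b)
    coefficient≡⇒mem r a b p p′ eq = subst mem calc (mem-trans (ι (coefficient (b ⊝ r)))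
        (subst (Rep (a ⊝ r)) eq (rep-coefficient p)) (mem-flip (rep-coefficient p′)))
      where calc : (a ⊝ r) ⊝ (b ⊝ r) ≡ a ⊝ b
            calc = trans (⊝-interchange a (⊖ r) b (⊖ r)) (trans (cong ((a ⊝ b) ⊕_) (⊝-self (⊖ r))) (⊕-identityʳ _))

    coordinates≡⇒congruent : ∀ {n} (R P Q : Lin G n) → S⁺.Congruent P R → S⁺.Congruent Q R →
      coordinates (P -ᴸ R) ≡ coordinates (Q -ᴸ R) → Congruent P Q
    coordinates≡⇒congruent (r₀ , rs) (a₀ , as) (b₀ , bs) (p , ps) (p′ , ps′) eq =
      coefficient≡⇒mem r₀ a₀ b₀ p p′ (cong proj₁ eq) , go rs as bs ps ps′ (cong proj₂ eq)
      where
      go : ∀ {n} (rs as bs : Vec (Carrier G) n) → VAll S⁺.mem (as -ᵛ rs) → VAll S⁺.mem (bs -ᵛ rs) →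
           Vec.map coefficient (as -ᵛ rs) ≡ Vec.map coefficient (bs -ᵛ rs) → VAll mem (as -ᵛ bs)
      go [] [] [] _ _ _ = []
      go (r ∷ rs) (a ∷ as) (b ∷ bs) (p ∷ ps) (p′ ∷ ps′) eq =
        coefficient≡⇒mem r a b p p′ (Vecₚ.∷-injectiveˡ eq) ∷ go rs as bs ps ps′ (Vecₚ.∷-injectiveʳ eq)

    module _ {n : ℕ} (f : Vec Bool n → Carrier G) (R : Lin G n) where

      -- The difference f - R read in S⁺/S, and undefined where `f` and `R` differ even modulo S⁺.
      -- The domain thus encodes agreement one level up.
      residual : ℤ.PartialFun n
      residual x with S⁺.mem? (f x ⊝ evalP G R x)
      ... | yes (i , _) = just i
      ... | no _        = nothing

      domain-residual : ℤ.domain residual ≤ S⁺.agreement-mod f R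
      domain-residual = ∑-mono (cube n) pt
        where pt : ∀ x → ℤ.defined (residual x) ≤ ⟦ S⁺.mem? (f x ⊝ evalP G R x) ⟧
              pt x with S⁺.mem? (f x ⊝ evalP G R x)
              ... | yes _ = ≤-refl
              ... | no _  = z≤n

      -- Where f ≡ P modulo `S`, also f - R ≡ P - R. The latter is represented by the coordinates of
      -- P - R, and representatives are unique.
      agreement-residual : ∀ P → S⁺.Congruent P R → agreement-mod f P ≤ ℤ.agreement residual (coordinates (P -ᴸ R))
      agreement-residual P c = ∑-mono (cube n) pt
        where
        rep : ∀ x → mem (f x ⊝ evalP G P x) → Rep (f x ⊝ evalP G R x) (evalP Z (coordinates (P -ᴸ R)) x)
        rep x m = mem-trans (evalP G P x ⊝ evalP G R x)
          (subst mem (sym (trans (⊝-interchange (f x) _ (evalP G P x) _) (trans (cong ((f x ⊝ evalP G P x) ⊕_) (⊝-self _)) (⊕-identityʳ _)))) m)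
          (subst (λ z → Rep z (evalP Z (coordinates (P -ᴸ R)) x)) (evalP-⊝ P R x) (rep-evalP (P -ᴸ R) c x))
        pt : ∀ x → ⟦ mem? (f x ⊝ evalP G P x) ⟧ ≤ ℤ.hit (residual x) (evalP Z (coordinates (P -ᴸ R)) x)
        pt x with mem? (f x ⊝ evalP G P x)
        ... | no _ = z≤n
        ... | yes m with S⁺.mem? (f x ⊝ evalP G R x)
        ...   | no ¬p = ⊥-elim (¬p (evalP Z (coordinates (P -ᴸ R)) x , rep x m))
        ...   | yes (i , r) with evalP Z (coordinates (P -ᴸ R)) x ℤ.≟ i
        ...     | yes _ = ≤-refl
        ...     | no ¬e = ⊥-elim (¬e (rep-unique (rep x m) r))

    block-bound : ∀ {C} → PowerSumBound C Z → ∀ {n} (f : Vec Bool n → Carrier G) R Ps →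
      (∀ {P} → P ∈ Ps → S⁺.Congruent P R) → AllPairs (λ P Q → ¬ Congruent P Q) Ps →
      ∑ Ps (λ P → adv-mod f P ^ C) ≤ S⁺.adv-mod f R ^ C
    block-bound {C} bound {n} f R Ps cong-R incong = begin
        ∑ Ps (λ P → adv-mod f P ^ C)
          ≤⟨ ∑-mono-∈ Ps (λ {P} P∈ → ^-monoˡ-≤ C (∸-monoˡ-≤ (2 ^ n) (*-monoʳ-≤ 2 (agreement-residual f R P (cong-R P∈))))) ⟩
        ∑ Ps (λ P → ℤ.adv (residual f R) (coord P) ^ C)
          ≡⟨ ∑-map coord Ps (λ L → ℤ.adv (residual f R) L ^ C) ⟨
        ∑ (map coord Ps) (λ L → ℤ.adv (residual f R) L ^ C)
          ≤⟨ bound (residual f R) (map coord Ps) (AllPairsₚ.map⁺ (AllPairs-restrict distinct cong-R incong)) ⟩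
        ℤ.domain-adv (residual f R) ^ C
          ≤⟨ ^-monoˡ-≤ C (∸-monoˡ-≤ (2 ^ n) (*-monoʳ-≤ 2 (domain-residual f R))) ⟩
        S⁺.adv-mod f R ^ C ∎
      where
      open ≤-Reasoning
      coord : Lin G n → Lin Z n
      coord P = coordinates (P -ᴸ R)
      distinct : ∀ {P Q} → S⁺.Congruent P R → S⁺.Congruent Q R → ¬ Congruent P Q → coord P ≢ coord Q
      distinct {P} {Q} p p′ ne eq = ne (coordinates≡⇒congruent R P Q p p′ eq)

  PotentialBound : ℕ → (G : FinAbGroup) → Subgroup G → Set
  PotentialBound C G S = ∀ {n} (f : Vec Bool n → Carrier G) Ps → AllPairs (λ P Q → ¬ Subgroup.Congruent S P Q) Ps →
    ∑ Ps (λ P → Subgroup.adv-mod S f P ^ C) ≤ (2 ^ n) ^ C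

  module _ {C : ℕ} {G : FinAbGroup} (S T : Subgroup G) where
    private
      module S = Subgroup S
      module T = Subgroup T

    -- Each class modulo `T` is charged to one representative from a maximal incongruent family, and
    -- the charges sum to the potential one level up.
    refine : (∀ {n} (f : Vec Bool n → Carrier G) R Ps → (∀ {P} → P ∈ Ps → T.Congruent P R) →
        AllPairs (λ P Q → ¬ S.Congruent P Q) Ps → ∑ Ps (λ P → S.adv-mod f P ^ C) ≤ T.adv-mod f R ^ C) →
      PotentialBound C G T → PotentialBound C G S
    refine block T-bound {n} f Ps incong = begin
        ∑ Ps (λ P → S.adv-mod f P ^ C)
          ≤⟨ ∑-cover D Ps T.congruent? (λ P → S.adv-mod f P ^ C) covered ⟩
        ∑ D (λ R → ∑ (filter (λ P → T.congruent? P R) Ps) (λ P → S.adv-mod f P ^ C))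
          ≤⟨ ∑-mono D (λ R → block f R (filter (λ P → T.congruent? P R) Ps)
               (λ P∈ → proj₂ (∈-filter⁻ (λ P → T.congruent? P R) {xs = Ps} P∈)) (AllPairsₚ.filter⁺ (λ P → T.congruent? P R) incong)) ⟩
        ∑ D (λ R → T.adv-mod f R ^ C)
          ≤⟨ T-bound f D D-incong ⟩
        (2 ^ n) ^ C ∎
      where
      open ≤-Reasoning
      decide : ∀ (P Q : Lin G n) → (¬ T.Congruent P Q) ⊎ T.Congruent P Q
      decide P Q with T.congruent? P Q
      ... | yes p = inj₂ p
      ... | no ¬p = inj₁ ¬p
      maximal = maximal-subfamily {P = λ P Q → ¬ T.Congruent P Q} {Q = T.Congruent} decide Ps (λ {P} _ → T.congruent-refl P)
      D = proj₁ maximal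
      D-incong = proj₁ (proj₂ (proj₂ maximal))
      covered : ∀ {P} → P ∈ Ps → Any (T.Congruent P) D
      covered = proj₂ (proj₂ (proj₂ maximal))

  module Chain (G : FinAbGroup) (Z : FinAbGroup) (q C : ℕ)
    (q-power : ∀ a → ∃ λ j → mulN G (q ^ j) a ≡ Linear.𝟘 G)
    (carry : ∀ i j → ∃ λ c → toℕ i + toℕ j ≡ toℕ (Linear._⊕_ Z i j) + c * q)
    (kernel : ∀ (S : Subgroup G) g → ¬ Subgroup.mem S g → Subgroup.mem S (mulN G q g) →
      ∀ i → Subgroup.mem S (mulN G (toℕ i) g) → i ≡ Linear.𝟘 Z)
    (generator : ∃ λ (i : Carrier Z) → toℕ i ≡ 1)
    (bound : PowerSumBound C Z)
    where
    open Linear G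

    module _ (S : Subgroup G) where
      open Subgroup S

      -- Walks along a, qa, q²a, ... to the last element outside `S`.
      find-order-q : ∀ j a → ¬ mem a → mem (mulN G (q ^ j) a) → ∃ λ g → ¬ mem g × mem (mulN G q g)
      find-order-q zero    a a∉ p = ⊥-elim (a∉ (subst mem (mulN-1 G a) p))
      find-order-q (suc j) a a∉ p with mem? (mulN G q a)
      ... | yes r = a , a∉ , r
      ... | no ¬r = find-order-q j (mulN G q a) ¬r
        (subst mem (trans (cong (λ k → mulN G k a) (*-comm q (q ^ j))) (mulN-* G (q ^ j) q a)) p)

      -- Modulo the whole group all functions are congruent, so at most one is listed, and its
      -- advantage is at most 2W - W.
      top-bound : (∀ a → mem a) → PotentialBound C G S
      top-bound all-mem f []       _ = z≤n
      top-bound all-mem {n} f (P ∷ []) _ = ≤-trans (≤-reflexive (+-identityʳ _)) (^-monoˡ-≤ C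
        (≤-trans (∸-monoˡ-≤ (2 ^ n) (*-monoʳ-≤ 2 (∑-cube-≤ n _ (λ x → ⟦⟧≤1 (mem? (f x ⊝ evalP G P x))))))
          (≤-reflexive (trans (cong (_∸ 2 ^ n) (cong (2 ^ n +_) (+-identityʳ (2 ^ n)))) (m+n∸n≡m (2 ^ n) (2 ^ n))))))
      top-bound all-mem f (P ∷ Q ∷ _) ((ne ∷ _) ∷ _) = ⊥-elim (ne (all-mem _ , VAll.universal all-mem _))

    -- The recursion climbs: the bound for `S` is derived from that for the extension by some `g`,
    -- which has fewer nonmembers, until the whole group is reached.
    potential-bound : ∀ fuel (S : Subgroup G) → Subgroup.nonmembers S ≤ fuel → PotentialBound C G S
    potential-bound fuel S fits with Finₚ.all? (Subgroup.mem? S)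
    ... | yes all-mem = top-bound S all-mem
    ... | no ¬all with Finₚ.¬∀⟶∃¬ (order G) (Subgroup.mem S) (Subgroup.mem? S) ¬all
    ...   | a , a∉ with q-power a
    ...     | j , eq with find-order-q S j a a∉ (subst (Subgroup.mem S) (sym eq) (Subgroup.mem-𝟘 S))
    ...       | g , g∉ , qg∈ = go fuel fits
      where
      open Subgroup S
      open Extension G S Z q g carry qg∈ (kernel S g g∉ qg∈)
      g∈⁺ : S⁺.mem g
      g∈⁺ = proj₁ generator , subst mem (sym (trans (cong (λ k → g ⊝ mulN G k g) (proj₂ generator))
        (trans (cong (g ⊝_) (mulN-1 G g)) (⊝-self g)))) mem-𝟘
      decreasing : S⁺.nonmembers < nonmembers
      decreasing = ∑-strict (allFinList (order G))
        (λ b → ⟦⟧-mono (¬? (S⁺.mem? b)) (¬? (mem? b)) (λ b∉⁺ b∈ → b∉⁺ (mem⇒mem⁺ b∈))) (∈-allFin g) strict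
        where
        strict : ⟦ ¬? (S⁺.mem? g) ⟧ < ⟦ ¬? (mem? g) ⟧
        strict with S⁺.mem? g | mem? g
        ... | yes _ | no _   = s≤s z≤n
        ... | yes _ | yes g∈ = ⊥-elim (g∉ g∈)
        ... | no ¬p | _      = ⊥-elim (¬p g∈⁺)
      go : ∀ fuel → nonmembers ≤ fuel → PotentialBound C G S
      go zero    fits = ⊥-elim (n≮0 (≤-trans decreasing fits))
      go (suc k) fits = refine {C} S extension (block-bound {C} bound) (potential-bound k extension (≤-pred (≤-trans decreasing fits)))

  -- From rational distances to natural numbers

  open import Data.Integer as ℤ using (+_; +[1+_]; -[1+_])
  import Data.Integer.Properties as ℤₚ
  open import Data.Rational as ℚ using (ℚ; mkℚ; 0ℚ; ½; 1/_; positive)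
  import Data.Rational.Properties as ℚₚ
  open import Data.Rational.Unnormalised as ℚᵘ using (mkℚᵘ)
  import Data.Rational.Unnormalised.Properties as ℚᵘₚ

  numerator denominator : ℚ → ℕ
  numerator p = ℤ.∣ ℚ.↥ p ∣
  denominator p = ℚ.↧ₙ p

  toℚᵘ-/ : ∀ b d → ℚ.toℚᵘ (+ b ℚ./ suc d) ℚᵘ.≃ mkℚᵘ (+ b) d
  toℚᵘ-/ b d = ℚₚ.toℚᵘ-fromℚᵘ (mkℚᵘ (+ b) d)

  /1-* : ∀ a b → + (a * b) ℚ./ 1 ≡ (+ a ℚ./ 1) ℚ.* (+ b ℚ./ 1)
  /1-* a b = ℚₚ.toℚᵘ-injective (begin
      ℚ.toℚᵘ (+ (a * b) ℚ./ 1)                          ≈⟨ toℚᵘ-/ (a * b) 0 ⟩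
      mkℚᵘ (+ (a * b)) 0                                ≈⟨ ℚᵘ.*≡* (cong (ℤ._* (+ 1)) (ℤₚ.pos-* a b)) ⟩
      mkℚᵘ (+ a) 0 ℚᵘ.* mkℚᵘ (+ b) 0                    ≈⟨ ℚᵘₚ.*-cong (toℚᵘ-/ a 0) (toℚᵘ-/ b 0) ⟨
      ℚ.toℚᵘ (+ a ℚ./ 1) ℚᵘ.* ℚ.toℚᵘ (+ b ℚ./ 1)        ≈⟨ ℚₚ.toℚᵘ-homo-* (+ a ℚ./ 1) (+ b ℚ./ 1) ⟨
      ℚ.toℚᵘ ((+ a ℚ./ 1) ℚ.* (+ b ℚ./ 1))              ∎)
    where open import Relation.Binary.Reasoning.Setoid ℚᵘₚ.≃-setoid

  /1-mono : ∀ {a b} → a ≤ b → + a ℚ./ 1 ℚ.≤ + b ℚ./ 1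
  /1-mono {a} {b} h = ℚₚ.toℚᵘ-cancel-≤ (ℚᵘₚ.≤-respˡ-≃ (ℚᵘₚ.≃-sym (toℚᵘ-/ a 0)) (ℚᵘₚ.≤-respʳ-≃ (ℚᵘₚ.≃-sym (toℚᵘ-/ b 0))
    (ℚᵘ.*≤* (ℤₚ.*-monoʳ-≤-nonNeg (+ 1) (ℤ.+≤+ h)))))

  numerator-*-1/ : ∀ ε → (ε>0 : 0ℚ ℚ.< ε) →
    (+ numerator ε ℚ./ 1) ℚ.* (1/ ε) {{ℚₚ.pos⇒nonZero ε {{positive ε>0}}}} ≡ + denominator ε ℚ./ 1
  numerator-*-1/ (mkℚ (+ 0) _ _)    (ℚ.*<* (ℤ.+<+ ()))
  numerator-*-1/ (mkℚ -[1+ _ ] _ _) (ℚ.*<* ())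
  numerator-*-1/ ε@(mkℚ +[1+ p ] r _) ε>0 = ℚₚ.toℚᵘ-injective (begin
      ℚ.toℚᵘ ((+ suc p ℚ./ 1) ℚ.* ε⁻¹)                  ≈⟨ ℚₚ.toℚᵘ-homo-* (+ suc p ℚ./ 1) ε⁻¹ ⟩
      ℚ.toℚᵘ (+ suc p ℚ./ 1) ℚᵘ.* ℚ.toℚᵘ ε⁻¹            ≈⟨ ℚᵘₚ.*-congʳ (toℚᵘ-/ (suc p) 0) ⟩
      mkℚᵘ (+ suc p) 0 ℚᵘ.* mkℚᵘ (+ suc r) p            ≈⟨ ℚᵘ.*≡* (cong +_ (lem p r)) ⟩
      mkℚᵘ (+ suc r) 0                                  ≈⟨ toℚᵘ-/ (suc r) 0 ⟨
      ℚ.toℚᵘ (+ suc r ℚ./ 1)                            ∎)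
    where
    open import Relation.Binary.Reasoning.Setoid ℚᵘₚ.≃-setoid
    ε⁻¹ = (1/ ε) {{ℚₚ.pos⇒nonZero ε {{positive ε>0}}}}
    lem : ∀ p r → suc p * suc r * 1 ≡ suc r * (1 * suc p)
    lem = solve-∀

  numerator-pos : ∀ ε → 0ℚ ℚ.< ε → 0 < numerator ε
  numerator-pos (mkℚ (+ 0) _ _)    (ℚ.*<* (ℤ.+<+ ()))
  numerator-pos (mkℚ -[1+ _ ] _ _) (ℚ.*<* ())
  numerator-pos (mkℚ +[1+ p ] r _) _ = s≤s z≤n

  -- Adding ε to both sides removes the subtraction before denominators are cleared; the factor 2 on
  -- the left is the denominator of 1/2.
  δ-bound : ∀ b W .{{_ : NonZero W}} ε → 0ℚ ℚ.< ε → + b ℚ./ W ℚ.≤ ½ ℚ.- ε →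
    (b * denominator ε + numerator ε * W) * 2 ≤ W * denominator ε
  δ-bound b W (mkℚ -[1+ _ ] _ _) (ℚ.*<* ()) h
  δ-bound b (suc w) ε@(mkℚ (+ p) r _) ε>0 h = ℤₚ.drop‿+≤+ (subst₂ ℤ._≤_ left right (ℚᵘₚ.drop-*≤* sum≤))
    where
    W = suc w
    sum≤ : mkℚᵘ (+ b) w ℚᵘ.+ mkℚᵘ (+ p) r ℚᵘ.≤ ℚᵘ.½
    sum≤ = ℚᵘₚ.≤-respˡ-≃ (ℚᵘₚ.≃-trans (ℚₚ.toℚᵘ-homo-+ (+ b ℚ./ W) ε) (ℚᵘₚ.+-congˡ (mkℚᵘ (+ p) r) (toℚᵘ-/ b w)))
      (ℚₚ.toℚᵘ-mono-≤ (subst ((+ b ℚ./ W) ℚ.+ ε ℚ.≤_) half (ℚₚ.+-monoˡ-≤ ε h)))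
      where half : (½ ℚ.- ε) ℚ.+ ε ≡ ½
            half = trans (ℚₚ.+-assoc ½ (ℚ.- ε) ε) (trans (cong (½ ℚ.+_) (ℚₚ.+-inverseˡ ε)) (ℚₚ.+-identityʳ ½))
    left : ((+ b) ℤ.* (+ suc r) ℤ.+ (+ p) ℤ.* (+ W)) ℤ.* (+ 2) ≡ + ((b * suc r + p * W) * 2)
    left = trans (cong (ℤ._* (+ 2)) (cong₂ ℤ._+_ (sym (ℤₚ.pos-* b (suc r))) (sym (ℤₚ.pos-* p W)))) (sym (ℤₚ.pos-* (b * suc r + p * W) 2))
    right : (+ 1) ℤ.* (+ (W * suc r)) ≡ + (W * suc r)
    right = ℤₚ.*-identityˡ (+ (W * suc r))

  -- Multiplication by the C-th power of the numerator turns (1/ε)^C into a power of the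
  -- denominator, so both sides become natural numbers.
  ^ℚ-bound : ∀ ε → (ε>0 : 0ℚ ℚ.< ε) → ∀ N C → N * numerator ε ^ C ≤ denominator ε ^ C →
    + N ℚ./ 1 ℚ.≤ (+ 1 ℚ./ 1) ℚ.* ((1/ ε) {{ℚₚ.pos⇒nonZero ε {{positive ε>0}}}} ^ℚ C)
  ^ℚ-bound ε ε>0 N C h = subst (+ N ℚ./ 1 ℚ.≤_) (sym (ℚₚ.*-identityˡ (ε⁻¹ ^ℚ C)))
      (ℚₚ.*-cancelʳ-≤-pos (+ (p ^ C) ℚ./ 1) {{positive pᶜ>0}}
        (subst₂ ℚ._≤_ (/1-* N (p ^ C)) (trans (sym (power C)) (ℚₚ.*-comm (+ (p ^ C) ℚ./ 1) (ε⁻¹ ^ℚ C))) (/1-mono h)))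
    where
    ε⁻¹ = (1/ ε) {{ℚₚ.pos⇒nonZero ε {{positive ε>0}}}}
    p = numerator ε
    r = denominator ε
    pᶜ>0 : 0ℚ ℚ.< + (p ^ C) ℚ./ 1
    pᶜ>0 = ℚₚ.<-≤-trans (from-yes (0ℚ ℚₚ.<? (+ 1 ℚ./ 1))) (/1-mono (m^n>0 p {{>-nonZero (numerator-pos ε ε>0)}} C))
    power : ∀ C → (+ (p ^ C) ℚ./ 1) ℚ.* (ε⁻¹ ^ℚ C) ≡ + (r ^ C) ℚ./ 1
    power zero    = ℚₚ.*-identityʳ _
    power (suc C) = begin
      (+ (p * p ^ C) ℚ./ 1) ℚ.* (ε⁻¹ ℚ.* (ε⁻¹ ^ℚ C))
        ≡⟨ cong (ℚ._* (ε⁻¹ ℚ.* (ε⁻¹ ^ℚ C))) (/1-* p (p ^ C)) ⟩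
      ((+ p ℚ./ 1) ℚ.* (+ (p ^ C) ℚ./ 1)) ℚ.* (ε⁻¹ ℚ.* (ε⁻¹ ^ℚ C))
        ≡⟨ interchange (+ p ℚ./ 1) (+ (p ^ C) ℚ./ 1) ε⁻¹ (ε⁻¹ ^ℚ C) ⟩
      ((+ p ℚ./ 1) ℚ.* ε⁻¹) ℚ.* ((+ (p ^ C) ℚ./ 1) ℚ.* (ε⁻¹ ^ℚ C))
        ≡⟨ cong₂ ℚ._*_ (numerator-*-1/ ε ε>0) (power C) ⟩
      (+ r ℚ./ 1) ℚ.* (+ (r ^ C) ℚ./ 1)
        ≡⟨ /1-* r (r ^ C) ⟨
      + (r * r ^ C) ℚ./ 1 ∎
      where
      open ≡-Reasoning
      open import Algebra.Properties.CommutativeSemigroup (CommutativeMonoid.commutativeSemigroup ℚₚ.*-1-commutativeMonoid) using (interchange)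

  -- From the potential to the list size

  concatMap-map-unique : ∀ {A B C : Set} (f : A → B → C) → (∀ {w x y z} → f w y ≡ f x z → w ≡ x × y ≡ z) →
    ∀ {xs ys} → Unique xs → Unique ys → Unique (concatMap (λ x → map (f x) ys) xs)
  concatMap-map-unique f inj {xs} {ys} uxs uys = subst Unique (go xs) (Uniqueₚ.cartesianProductWith⁺ f inj uxs uys)
    where go : ∀ xs → List.cartesianProductWith f xs ys ≡ concatMap (λ x → map (f x) ys) xs
          go []       = refl
          go (x ∷ xs) = cong (map (f x) ys ++_) (go xs)

  allVecs-unique : ∀ {A : Set} {xs : List A} → Unique xs → ∀ n → Unique (allVecs xs n)
  allVecs-unique u zero    = [] ∷ []
  allVecs-unique u (suc n) = concatMap-map-unique _∷_ (λ eq → Vecₚ.∷-injectiveˡ eq , Vecₚ.∷-injectiveʳ eq) u (allVecs-unique u n)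

  -- The potential bound concerns pairwise incongruent functions, so the enumeration must not repeat
  -- any.
  allLin-unique : ∀ G n → Unique (allLin G n)
  allLin-unique G n = concatMap-map-unique _,_ (λ eq → cong proj₁ eq , cong proj₂ eq) (Uniqueₚ.allFin⁺ (order G))
    (allVecs-unique (Uniqueₚ.allFin⁺ (order G)) n)

  module _ (G : FinAbGroup) where
    open Linear G

    trivial : Subgroup G
    trivial = record
      { mem = _≡ 𝟘 ; mem? = _≟ 𝟘 ; mem-𝟘 = refl
      ; mem-⊕ = λ p r → trans (cong₂ _⊕_ p r) (⊕-identityˡ 𝟘)
      ; mem-⊖ = λ p → trans (cong ⊖_ p) ⊖𝟘 }

    open Subgroup trivial

    congruent⇒≡ : ∀ {n} (P Q : Lin G n) → Congruent P Q → P ≡ Q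
    congruent⇒≡ (a₀ , as) (b₀ , bs) (p , ps) = cong₂ _,_ (x⊝y≡𝟘⇒x≡y a₀ b₀ p) (go as bs ps)
      where go : ∀ {n} (as bs : Vec (Carrier G) n) → VAll (_≡ 𝟘) (as -ᵛ bs) → as ≡ bs
            go [] [] _ = refl
            go (a ∷ as) (b ∷ bs) (p ∷ ps) = cong₂ _∷_ (x⊝y≡𝟘⇒x≡y a b p) (go as bs ps)

    module _ {n : ℕ} (f : Vec Bool n → Carrier G) where

      disagreements : Lin G n → ℕ
      disagreements P = length (filter (λ x → ¬? (f x ≟ evalP G P x)) (cube n))

      agreement+disagreements : ∀ P → 2 ^ n ≤ agreement-mod f P + disagreements P
      agreement+disagreements P = begin
        2 ^ n                                   ≡⟨ trans (∑-cube-const n 1) (*-identityʳ (2 ^ n)) ⟨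
        ∑ (cube n) (λ _ → 1)                    ≤⟨ ∑-mono (cube n) pt ⟩
        ∑ (cube n) (λ x → ⟦ f x ⊝ evalP G P x ≟ 𝟘 ⟧ + ⟦ ¬? (f x ≟ evalP G P x) ⟧)
                                                ≡⟨ ∑-+ (cube n) _ _ ⟩
        agreement-mod f P + ∑ (cube n) (λ x → ⟦ ¬? (f x ≟ evalP G P x) ⟧)
                                                ≡⟨ cong (λ z → agreement-mod f P + z) (length-filter (λ x → ¬? (f x ≟ evalP G P x)) (cube n)) ⟨
        agreement-mod f P + disagreements P     ∎
        where
        open ≤-Reasoning
        pt : ∀ x → 1 ≤ ⟦ f x ⊝ evalP G P x ≟ 𝟘 ⟧ + ⟦ ¬? (f x ≟ evalP G P x) ⟧
        pt x with f x ⊝ evalP G P x ≟ 𝟘 | f x ≟ evalP G P x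
        ... | yes _ | _     = s≤s z≤n
        ... | no _  | no _  = s≤s z≤n
        ... | no ¬p | yes e = contradiction (trans (cong (_⊝ evalP G P x) e) (⊝-self (evalP G P x))) ¬p

      adv-lower : ∀ ε → 0ℚ ℚ.< ε → ∀ P → δ G n f P ℚ.≤ ½ ℚ.- ε → numerator ε * 2 ^ n ≤ denominator ε * adv-mod f P
      -- The estimate gives 2pw ≤ r · `adv-mod f P`; the factor 2 is given away.
      adv-lower ε ε>0 P h = ≤-trans (m≤m+n (p * w) (p * w)) (+-cancelʳ-≤ (2 * b * r) _ _ (begin
        p * w + p * w + 2 * b * r               ≡⟨ lem₁ p w b r ⟩
        (b * r + p * w) * 2                     ≤⟨ δ-bound b w {{m^n≢0 2 n}} ε ε>0 h ⟩
        w * r                                   ≡⟨ *-comm w r ⟩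
        r * w                                   ≤⟨ *-monoʳ-≤ r w≤ ⟩
        r * (adv-mod f P + 2 * b)               ≡⟨ lem₂ r (adv-mod f P) b ⟩
        r * adv-mod f P + 2 * b * r             ∎))
        where
        open ≤-Reasoning
        p = numerator ε
        r = denominator ε
        w = 2 ^ n
        b = disagreements P
        agr = agreement-mod f P
        lem₁ : ∀ p w b r → p * w + p * w + 2 * b * r ≡ (b * r + p * w) * 2
        lem₁ = solve-∀
        lem₂ : ∀ r a b → r * (a + 2 * b) ≡ r * a + 2 * b * r
        lem₂ = solve-∀
        w≤ : w ≤ adv-mod f P + 2 * b
        w≤ = +-cancelˡ-≤ w w _ (begin
          w + w                                 ≡⟨ cong (λ z → w + z) (+-identityʳ w) ⟨
          2 * w                                 ≤⟨ *-monoʳ-≤ 2 (agreement+disagreements P) ⟩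
          2 * (agr + b)                         ≡⟨ *-distribˡ-+ 2 agr b ⟩
          2 * agr + 2 * b                       ≤⟨ +-monoˡ-≤ (2 * b) (m≤n+m∸n (2 * agr) w) ⟩
          w + adv-mod f P + 2 * b               ≡⟨ +-assoc w (adv-mod f P) (2 * b) ⟩
          w + (adv-mod f P + 2 * b)             ∎)

    -- Each listed function has advantage at least εW and so contributes at least (εW)^C to a sum
    -- that is at most W^C.
    list-bound : ∀ {C} → PotentialBound C G trivial → ∀ ε → 0ℚ ℚ.< ε → ∀ n (f : Vec Bool n → Carrier G) →
      listSize G n f ε * numerator ε ^ C ≤ denominator ε ^ C
    list-bound {C} bound ε ε>0 n f = *-cancelʳ-≤ _ _ (w ^ C) {{m^n≢0 w C {{m^n≢0 2 n}}}} (begin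
        N * p ^ C * w ^ C                       ≡⟨ trans (*-assoc N (p ^ C) (w ^ C)) (cong (N *_) (sym (^-distribʳ-* p w C))) ⟩
        N * (p * w) ^ C                         ≡⟨ ∑-const Ps ((p * w) ^ C) ⟨
        ∑ Ps (λ _ → (p * w) ^ C)                ≤⟨ ∑-mono-∈ Ps (λ {P} P∈ → ^-monoˡ-≤ C (adv-lower f ε ε>0 P
                                                     (proj₂ (∈-filter⁻ close? {xs = allLin G n} P∈)))) ⟩
        ∑ Ps (λ P → (r * adv-mod f P) ^ C)      ≡⟨ ∑-cong Ps (λ P → ^-distribʳ-* r (adv-mod f P) C) ⟩
        ∑ Ps (λ P → r ^ C * adv-mod f P ^ C)    ≡⟨ ∑-*ˡ Ps (r ^ C) (λ P → adv-mod f P ^ C) ⟩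
        r ^ C * ∑ Ps (λ P → adv-mod f P ^ C)    ≤⟨ *-monoʳ-≤ (r ^ C) (bound f Ps
                                                     (AllPairs.map (λ {P} {Q} ne c → ne (congruent⇒≡ P Q c)) (AllPairsₚ.filter⁺ close? (allLin-unique G n)))) ⟩
        r ^ C * w ^ C                           ∎)
      where
      open ≤-Reasoning
      p = numerator ε
      r = denominator ε
      w = 2 ^ n
      close? : ∀ P → Dec (δ G n f P ℚ.≤ ½ ℚ.- ε)
      close? P = δ G n f P ℚₚ.≤? ½ ℚ.- ε
      Ps = filter close? (allLin G n)
      N = length Ps

    q-group-bound : ∀ {C} Z q → IsQGroup q G →
      (∀ i j → ∃ λ c → toℕ i + toℕ j ≡ toℕ (Linear._⊕_ Z i j) + c * q) →
      (∀ (S : Subgroup G) g → ¬ Subgroup.mem S g → Subgroup.mem S (mulN G q g) →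
        ∀ i → Subgroup.mem S (mulN G (toℕ i) g) → i ≡ Linear.𝟘 Z) →
      (∃ λ (i : Carrier Z) → toℕ i ≡ 1) → PowerSumBound C Z → PotentialBound C G trivial
    q-group-bound {C} Z q isQ carry kernel generator bound =
      Chain.potential-bound G Z q C (λ a → proj₁ (isQ a) , proj₁ (proj₂ (proj₂ (isQ a)))) carry kernel generator bound
        (Subgroup.nonmembers trivial) trivial ≤-refl

  -- The two primes and the final exponent

  carry₂ : ∀ (i j : Fin 2) → ∃ λ c → toℕ i + toℕ j ≡ toℕ (i Two.+₂ j) + c * 2
  carry₂ i j = let (c , eq) = from-yes (Finₚ.all? λ i → Finₚ.all? λ j → Finₚ.any? {n = 2} λ c →
                     toℕ i + toℕ j Data.Nat.≟ toℕ (i Two.+₂ j) + toℕ c * 2) i j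
               in toℕ c , eq

  carry₃ : ∀ (i j : Fin 3) → ∃ λ c → toℕ i + toℕ j ≡ toℕ (i Three.+₃ j) + c * 3
  carry₃ i j = let (c , eq) = from-yes (Finₚ.all? λ i → Finₚ.all? λ j → Finₚ.any? {n = 2} λ c →
                     toℕ i + toℕ j Data.Nat.≟ toℕ (i Three.+₃ j) + toℕ c * 3) i j
               in toℕ c , eq

  module _ {G : FinAbGroup} (S : Subgroup G) (g : Carrier G) (g∉ : ¬ Subgroup.mem S g) where
    open Subgroup S
    open Linear G

    kernel₂ : ∀ (i : Fin 2) → mem (mulN G (toℕ i) g) → i ≡ zero
    kernel₂ zero       _ = refl
    kernel₂ (suc zero) p = contradiction (subst mem (mulN-1 G g) p) g∉

    -- If 2g and 3g lie in `S`, so does their difference g; here the primality of 3 enters.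
    kernel₃ : mem (mulN G 3 g) → ∀ (i : Fin 3) → mem (mulN G (toℕ i) g) → i ≡ zero
    kernel₃ 3g∈ zero             _ = refl
    kernel₃ 3g∈ (suc zero)       p = contradiction (subst mem (mulN-1 G g) p) g∉
    kernel₃ 3g∈ (suc (suc zero)) p = contradiction (subst mem g≡ (mem-⊝ 3g∈ p)) g∉
      where g≡ : mulN G 3 g ⊝ mulN G 2 g ≡ g
            g≡ = trans (⊕-assoc g (mulN G 2 g) (⊖ mulN G 2 g)) (trans (cong (g ⊕_) (⊝-self (mulN G 2 g))) (⊕-identityʳ g))

  n≤2^n : ∀ n → n ≤ 2 ^ n
  n≤2^n zero    = z≤n
  n≤2^n (suc n) = ≤-trans (+-mono-≤ (m^n>0 2 n) (n≤2^n n)) (≤-reflexive (cong (λ z → 2 ^ n + z) (sym (+-identityʳ (2 ^ n)))))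

  -- Abstract, because the constants are too large to be unfolded by conversion checking.
  abstract
    M₂ M₃ : ℕ
    M₂ = 3 + 2 * 6 ^ 8
    M₃ = 3 + 48 * Three.K 4 * 6 ^ 8

    tail₂ : Bounds.TailBound Two.ℤ₂ M₂
    tail₂ = Bounds.tail-bound Two.ℤ₂ 2 Two.small-domain Two.coarse

    tail₃ : Bounds.TailBound Three.ℤ₃ M₃
    tail₃ = Bounds.tail-bound Three.ℤ₃ (48 * Three.K 4) Three.small-domain Three.coarse

  -- `adv-power-sum` asks for 9M ≤ 2^e. The crude n ≤ 2^n permits e = 9(M₂ + M₃), and the sum of the
  -- two constants lets one exponent serve both primes.
  excess exponent : ℕ
  excess = 9 * (M₂ + M₃)
  exponent = 9 + suc excess

  power-sum₂ : PowerSumBound exponent Two.ℤ₂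
  power-sum₂ = Bounds.adv-power-sum Two.ℤ₂ {M₂} excess tail₂ (≤-trans (*-monoʳ-≤ 9 (m≤m+n M₂ M₃)) (n≤2^n excess))

  power-sum₃ : PowerSumBound exponent Three.ℤ₃
  power-sum₃ = Bounds.adv-power-sum Three.ℤ₃ {M₃} excess tail₃ (≤-trans (*-monoʳ-≤ 9 (m≤n+m M₃ M₂)) (n≤2^n excess))

  potential : ∀ q → (q ≡ 2 ⊎ q ≡ 3) → ∀ G → IsQGroup q G → PotentialBound exponent G (trivial G)
  potential .2 (inj₁ refl) G isQ = q-group-bound G {exponent} Two.ℤ₂ 2 isQ carry₂
    (λ S g g∉ _ → kernel₂ S g g∉) (suc zero , refl) power-sum₂
  potential .3 (inj₂ refl) G isQ = q-group-bound G {exponent} Three.ℤ₃ 3 isQ carry₃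
    (λ S g g∉ → kernel₃ S g g∉) (suc zero , refl) power-sum₃

open import Defs
open import Data.Nat using (ℕ)
open import Data.Integer using (+_)
open import Data.Rational using (ℚ; _/_; _≤_; _<_; _*_; 0ℚ; 1/_; Positive; positive)
open import Data.Rational.Properties using (pos⇒nonZero)
open import Data.Vec using (Vec)
open import Data.Bool using (Bool)
open import Data.Product using (Σ; ∃; _,_)
open import Data.Sum using (_⊎_)
open import Relation.Binary.PropositionalEquality using (_≡_)
open ListDecoding using (exponent; potential; list-bound; ^ℚ-bound)

theorem4p3 : Σ ℕ λ C → Σ ℕ λ d →
    ∀ (q : ℕ) → (q ≡ 2 ⊎ q ≡ 3) →
    ∀ (G : FinAbGroup) → IsQGroup q G →
    ∀ (ε : ℚ) → (ε>0 : 0ℚ < ε) →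
    ∀ (n : ℕ) (f : Vec Bool n → Carrier G) →
    ((+ listSize G n f ε) / 1) ≤ ((+ C) / 1) * ((1/ ε) {{pos⇒nonZero ε {{positive ε>0}}}} ^ℚ d)
theorem4p3 = 1 , exponent , λ q q∈ G isQ ε ε>0 n f →
  ^ℚ-bound ε ε>0 (listSize G n f ε) exponent (list-bound G {exponent} (potential q q∈ G isQ) ε ε>0 n f)
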